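{- For every connected bipartite graph $H$ on at most $5$ vertices and every positive integer $a$, the graph $H^{+a}$ is common.
   Context: All graphs are finite and simple. For a graph $H$ and a positive integer $a$, $H^{+a}$ is the graph obtained from $H$ by adding $a$ new vertices, each adjacent to every vertex of $H$ and not adjacent to each other. A graphon is a measurable symmetric function $W:[0,1]^2\to[0,1]$; for a graph $F$, $t_F(W)=\int_{[0,1]^{V(F)}}\prod_{xy\in E(F)}W(z_x,z_y)\,dz$. A graph $F$ with $e(F)$ edges is common if the minimum number of labelled monochromatic copies of $F$ over all 2-edge-colourings of $K_n$ is asymptotically at least that of the uniformly random colouring; equivalently, $t_F(W)+t_F(1-W)\ge 2^{1-e(F)}$ for every graphon $W$. -}

module Defs where

open import Data.Nat using (ℕ; zero; suc; _+_; _*_; _∸_; _^_; _≤_)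
open import Data.Fin using (Fin; splitAt; _<?_)
open import Data.Bool using (Bool; true; false; _∧_; not; if_then_else_)
open import Data.Bool.Properties using () renaming (_≟_ to _≟ᵇ_)
open import Data.Sum using (inj₁; inj₂)
open import Data.List using (List; []; _∷_; length; filter; map; concatMap; allFin)
open import Data.Bool.ListAction using (and)
open import Data.Vec using (Vec; []; _∷_; lookup)
open import Data.Product using (∃; Σ; _×_; _,_; proj₁; proj₂)
open import Relation.Nullary using (¬_)
open import Relation.Nullary.Decidable using (⌊_⌋)
open import Relation.Binary.PropositionalEquality using (_≡_; _≢_; refl)
import Data.Fin.Properties as FinP

record Graph (n : ℕ) : Set where
  field
    adj   : Fin n → Fin n → Bool
    sym   : ∀ i j → adj i j ≡ adj j i
    irrefl : ∀ i → adj i i ≡ false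
open Graph public

data Reach {n : ℕ} (G : Graph n) : Fin n → Fin n → Set where
  here : ∀ {i} → Reach G i i
  step : ∀ {i k j} → adj G i k ≡ true → Reach G k j → Reach G i j

Connected : ∀ {n} → Graph n → Set
Connected {n} G = (1 ≤ n) × (∀ i j → Reach G i j)

Bipartite : ∀ {n} → Graph n → Set
Bipartite {n} G = ∃ λ (f : Fin n → Bool) → ∀ i j → adj G i j ≡ true → f i ≢ f j

plusAdj : ∀ {n} a → Graph n → Fin (n + a) → Fin (n + a) → Bool
plusAdj {n} a H x y with splitAt n x | splitAt n y
... | inj₁ i | inj₁ j = adj H i j
... | inj₁ _ | inj₂ _ = true
... | inj₂ _ | inj₁ _ = true
... | inj₂ _ | inj₂ _ = false

plusSym : ∀ {n} a (H : Graph n) x y → plusAdj a H x y ≡ plusAdj a H y x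
plusSym {n} a H x y with splitAt n x | splitAt n y
... | inj₁ i | inj₁ j = sym H i j
... | inj₁ _ | inj₂ _ = refl
... | inj₂ _ | inj₁ _ = refl
... | inj₂ _ | inj₂ _ = refl

plusIrr : ∀ {n} a (H : Graph n) x → plusAdj a H x x ≡ false
plusIrr {n} a H x with splitAt n x
... | inj₁ i = irrefl H i
... | inj₂ _ = refl

_⁺ : ∀ {n} → Graph n → (a : ℕ) → Graph (n + a)
(H ⁺) a = record { adj = plusAdj a H ; sym = plusSym a H ; irrefl = plusIrr a H }

pairs : (v : ℕ) → List (Fin v × Fin v)
pairs v = concatMap (λ i → map (λ j → (i , j)) (allFin v)) (allFin v)

edgeCount : ∀ {v} → Graph v → ℕ
edgeCount {v} F =
  length (filter (λ p → adjLt p ≟ᵇ true) (pairs v))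
  where
    adjLt : Fin v × Fin v → Bool
    adjLt p = ⌊ proj₁ p <? proj₂ p ⌋ ∧ adj F (proj₁ p) (proj₂ p)

allMaps : (v N : ℕ) → List (Vec (Fin N) v)
allMaps zero    N = [] ∷ []
allMaps (suc v) N = concatMap (λ x → map (x ∷_) (allMaps v N)) (allFin N)

injectiveᵇ : ∀ {v N} → Vec (Fin N) v → Bool
injectiveᵇ {v} φ = and (map (λ i → and (map (λ j →
  ⌊ i Data.Fin.≟ j ⌋ Data.Bool.∨ not ⌊ lookup φ i Data.Fin.≟ lookup φ j ⌋) (allFin v))) (allFin v))

monoᵇ : ∀ {v N} → Graph v → (Fin N → Fin N → Bool) → Bool → Vec (Fin N) v → Bool
monoᵇ {v} F c b φ = and (map (λ i → and (map (λ j →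
  not (adj F i j) Data.Bool.∨ ⌊ c (lookup φ i) (lookup φ j) ≟ᵇ b ⌋) (allFin v))) (allFin v))

monoCount : ∀ {v} → Graph v → (N : ℕ) → (Fin N → Fin N → Bool) → Bool → ℕ
monoCount {v} F N c b =
  length (filter (λ φ → injectiveᵇ φ ∧ monoᵇ F c b φ ≟ᵇ true) (allMaps v N))

monoCopies : ∀ {v} → Graph v → (N : ℕ) → (Fin N → Fin N → Bool) → ℕ
monoCopies F N c = monoCount F N c true + monoCount F N c false

-- Falling factorial N(N-1)...(N-v+1) = number of labelled copies of F in K_N.
fall : ℕ → ℕ → ℕ
fall N zero    = 1
fall N (suc v) = (N ∸ v) * fall N v

-- A 2-edge-colouring of K_N (symmetric function; diagonal irrelevant).
Colouring : ℕ → Set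
Colouring N = Σ (Fin N → Fin N → Bool) λ c → ∀ i j → c i j ≡ c j i

-- F is common: min over colourings of #monochromatic labelled copies is
-- asymptotically at least the random-colouring expectation fall N v · 2^{1-e(F)}.
-- "Asymptotically at least": for every ε = 1/k there is N₀ such that for all N ≥ N₀
-- and every colouring, copies ≥ (1 - 1/k) · fall N v / 2^{e-1}, written over ℕ as
-- k · 2^{e-1} · copies ≥ (k - 1) · fall N v.
Common : ∀ {v} → Graph v → Set
Common {v} F = ∀ (k : ℕ) → 1 ≤ k → ∃ λ (N₀ : ℕ) → ∀ (N : ℕ) → N₀ ≤ N →
  (c : Colouring N) →
  (k ∸ 1) * fall N v ≤ k * 2 ^ (edgeCount F ∸ 1) * monoCopies F N (proj₁ c)

{-# OPTIONS --safe #-}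

-- Let f = ±1 be the colouring and write E(f) for the product of 1 + f over the edges of H and D(f)
-- for the sum over the apex u of the product of 1 + f(z,u) over the vertices z of H. A homomorphism
-- count of H^{+a} is, up to a power of 2, the sum of E(f) D(f)^a over all maps z, and Bernoulli's
-- inequality D^a ≥ N^a + a N^(a-1) (D - N) reduces the theorem to
--   (A)  ∑ E(f) + E(-f) ≥ 2 N^n,    (B)  ∑ E(f) (D(f) - N) + E(-f) (D(-f) - N) ≥ 0.
-- Up to isomorphism H is one of 11 graphs. For each of them (A) and (B) are linear inequalities
-- between the densities t(F,f) = ∑ ∏_F f of graphs F on at most 6 vertices. They are certified by
-- writing the left-hand side, modulo relabelling the vertices of F, as a sum of squares
--   ∑_t w(t) (∑_y ℓ(t,y))²,   w(t) a product of factors 1 ± ∏ f,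
-- over 4-tuples t (a flag algebra certificate over the integers), which is checked by evaluation.

module Submission where

open import Defs
open import Data.Bool using (Bool; true; false; not; if_then_else_; _∧_; _∨_)
open import Data.Bool.ListAction using (all; any)
open import Data.Bool.Properties using (T-≡) renaming (_≟_ to _≟ᵇ_)
open import Data.Empty using (⊥-elim)
open import Data.Fin as Fin using (Fin; zero; suc; #_; _↑ˡ_; _↑ʳ_; cast; splitAt; toℕ; _<?_)
open import Data.Fin.Patterns
import Data.Fin.Properties as FinP
open import Data.Integer as ℤ using (ℤ; +_; -[1+_]; _+_; _*_; -_; _-_; _^_; _≤_; 0ℤ; 1ℤ; -1ℤ; +≤+; ∣_∣; Positive; nonNegative)
import Data.Integer.Properties as ℤP
open import Data.Integer.Tactic.RingSolver using (solve-∀)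
open import Data.List as List using (List; []; _∷_; foldr; length; allFin; filter; concatMap; tabulate; cartesianProduct)
import Data.List.Properties as ListP
open import Data.List.Membership.Propositional using (_∈_)
open import Data.List.Membership.Propositional.Properties using (∈-allFin; ∈-++⁺ˡ; ∈-++⁺ʳ; ∈-map⁺; ∈-cartesianProduct⁺)
open import Data.List.Relation.Unary.Any using (here; there)
open import Data.Maybe using (Maybe; just; nothing)
open import Data.Nat as ℕ using (ℕ; zero; suc; _<ᵇ_; _≡ᵇ_)
open import Data.Nat.DivMod using (_/_; _%_)
import Data.Nat.Properties as ℕP
open import Data.Product using (_×_; _,_; -,_; proj₁; proj₂; ∃; Σ)
open import Data.Product.Properties using (≡-dec)
open import Data.Sum using (_⊎_; inj₁; inj₂)
open import Data.Unit using (⊤; tt)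
open import Data.Vec as Vec using (Vec; []; _∷_; _++_; lookup; updateAt)
open import Data.Vec.Properties using (lookup-map; lookup-++ˡ; lookup-++ʳ; lookup-splitAt; lookup∘tabulate; map-∘; map-lookup-allFin)
open import Data.Vec.Relation.Unary.All using (All; []; _∷_)
open import Function using (_∘_; id; Equivalence)
open import Relation.Binary.PropositionalEquality as ≡ hiding (sym)
open import Relation.Nullary using (yes; no)
open import Relation.Nullary.Decidable using (⌊_⌋; from-yes; _⊎-dec_)
open import Algebra.Properties.Semiring.Sum ℤP.+-*-semiring
  using (sum; sum-cong-≗; ∑-distrib-+; ∑-comm; *-distribˡ-sum; *-distribʳ-sum)

-- The tangent is taken at N because N is the typical value of D(f) in a random colouring. There the
-- tangent bound, (A) and (B) are all tight to leading order, and as a enters only through the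
-- coefficients of the tangent, one pair of inequalities serves every a. The bound may be multiplied
-- by E(f), a product of factors 0 and 2. A base graph with its apex needs at most 6 vertices,
-- exactly what a type of 4 vertices and the two copies y, y′ of the vertex summed inside a square
-- provide. Since f and its negative occur together, only monomials of even degree matter. Rounded
-- numerical certificates are not exact: after their squares are subtracted, errors of either sign
-- remain. These are completed to further squares, paid for by the densities of K(2,s), where slack
-- is left. Neither the choice of relabellings nor the choice of these squares has to be trusted,
-- since every step is a relabelling, a positive scaling or the removal of nonnegative blocks; only
-- the vanishing of the last polynomial is checked. All maps are counted, not just injective ones,
-- so that the variables are independent; the difference is of order N^(v-1).

private variable
  A B : Set
  N n m v : ℕ

-- Sums over tuples

sum-mono : {g h : Fin N → ℤ} → (∀ x → g x ≤ h x) → sum g ≤ sum h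
sum-mono {zero} g≤h = ℤP.≤-refl
sum-mono {suc N} g≤h = ℤP.+-mono-≤ (g≤h zero) (sum-mono (g≤h ∘ suc))

sum-const : ∀ c → sum {N} (λ _ → c) ≡ + N * c
sum-const {zero} c = refl
sum-const {suc N} c = trans (cong (λ s → c + s) (sum-const {N} c)) (≡.sym (ℤP.suc-* (+ N) c))

-- Nested single sums: fixing the first coordinate or splitting off a prefix then follows by
-- recursion.
∑ⱽ : (Vec (Fin N) n → ℤ) → ℤ
∑ⱽ {n = zero} g = g []
∑ⱽ {n = suc n} g = sum λ x → ∑ⱽ (g ∘ (x ∷_))

∑ⱽ-cong : {g h : Vec (Fin N) n → ℤ} → (∀ z → g z ≡ h z) → ∑ⱽ g ≡ ∑ⱽ h
∑ⱽ-cong {n = zero} g≗h = g≗h []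
∑ⱽ-cong {n = suc n} g≗h = sum-cong-≗ λ x → ∑ⱽ-cong (g≗h ∘ (x ∷_))

∑ⱽ-mono : {g h : Vec (Fin N) n → ℤ} → (∀ z → g z ≤ h z) → ∑ⱽ g ≤ ∑ⱽ h
∑ⱽ-mono {n = zero} g≤h = g≤h []
∑ⱽ-mono {n = suc n} g≤h = sum-mono λ x → ∑ⱽ-mono (g≤h ∘ (x ∷_))

∑ⱽ-distrib-+ : (g h : Vec (Fin N) n → ℤ) → ∑ⱽ (λ z → g z + h z) ≡ ∑ⱽ g + ∑ⱽ h
∑ⱽ-distrib-+ {n = zero} g h = refl
∑ⱽ-distrib-+ {n = suc n} g h = trans
  (sum-cong-≗ λ x → ∑ⱽ-distrib-+ (g ∘ (x ∷_)) (h ∘ (x ∷_)))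
  (∑-distrib-+ (λ x → ∑ⱽ (g ∘ (x ∷_))) (λ x → ∑ⱽ (h ∘ (x ∷_))))

*-distribˡ-∑ⱽ : ∀ c (g : Vec (Fin N) n → ℤ) → c * ∑ⱽ g ≡ ∑ⱽ (λ z → c * g z)
*-distribˡ-∑ⱽ {n = zero} c g = refl
*-distribˡ-∑ⱽ {n = suc n} c g = trans
  (*-distribˡ-sum c (λ x → ∑ⱽ (g ∘ (x ∷_))))
  (sum-cong-≗ λ x → *-distribˡ-∑ⱽ c (g ∘ (x ∷_)))

∑ⱽ-const : ∀ c → ∑ⱽ {N} {n} (λ _ → c) ≡ (+ N) ^ n * c
∑ⱽ-const {n = zero} c = ≡.sym (ℤP.*-identityˡ c)
∑ⱽ-const {N} {suc n} c = begin
  sum {N} (λ _ → ∑ⱽ {N} {n} (λ _ → c))  ≡⟨ sum-cong-≗ {N} (λ _ → ∑ⱽ-const {N} {n} c) ⟩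
  sum {N} (λ _ → (+ N) ^ n * c)         ≡⟨ sum-const {N} ((+ N) ^ n * c) ⟩
  + N * ((+ N) ^ n * c)                 ≡⟨ ℤP.*-assoc (+ N) ((+ N) ^ n) c ⟨
  (+ N) ^ suc n * c                     ∎
  where open ≡-Reasoning

∑ⱽ-++ : ∀ m (g : Vec (Fin N) (m ℕ.+ n) → ℤ) → ∑ⱽ g ≡ ∑ⱽ {n = m} (λ z → ∑ⱽ λ w → g (z ++ w))
∑ⱽ-++ zero g = refl
∑ⱽ-++ (suc m) g = sum-cong-≗ λ x → ∑ⱽ-++ m (g ∘ (x ∷_))

0≤∑ⱽ : {g : Vec (Fin N) n → ℤ} → (∀ z → 0ℤ ≤ g z) → 0ℤ ≤ ∑ⱽ g
0≤∑ⱽ {N} {n} {g} 0≤g = begin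
  0ℤ                  ≡⟨ ℤP.*-zeroʳ ((+ N) ^ n) ⟨
  (+ N) ^ n * 0ℤ      ≡⟨ ∑ⱽ-const {N} {n} 0ℤ ⟨
  ∑ⱽ {N} {n} (λ _ → 0ℤ) ≤⟨ ∑ⱽ-mono 0≤g ⟩
  ∑ⱽ g                ∎
  where open ℤP.≤-Reasoning

-- Adjacent transpositions generate all permutations, and for a sum each of them only interchanges
-- two neighbouring summations. Positions out of range act as the identity, so any list of numbers
-- is a valid word.
swap : ℕ → Vec A n → Vec A n
swap k [] = []
swap k (x ∷ []) = x ∷ []
swap zero (x ∷ y ∷ v) = y ∷ x ∷ v
swap (suc k) (x ∷ v) = x ∷ swap k v

permute : List ℕ → Vec A n → Vec A n
permute ks v = foldr swap v ks

map-swap : ∀ (h : A → B) k (v : Vec A n) → Vec.map h (swap k v) ≡ swap k (Vec.map h v)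
map-swap h k [] = refl
map-swap h k (x ∷ []) = refl
map-swap h zero (x ∷ y ∷ v) = refl
map-swap h (suc k) (x ∷ y ∷ v) = cong (h x ∷_) (map-swap h k (y ∷ v))

map-permute : ∀ (h : A → B) ks (v : Vec A n) → Vec.map h (permute ks v) ≡ permute ks (Vec.map h v)
map-permute h [] v = refl
map-permute h (k ∷ ks) v = trans (map-swap h k (permute ks v)) (cong (swap k) (map-permute h ks v))

∑ⱽ-swap : ∀ k (g : Vec (Fin N) n → ℤ) → ∑ⱽ (g ∘ swap k) ≡ ∑ⱽ g
∑ⱽ-swap {n = zero} k g = refl
∑ⱽ-swap {n = suc zero} k g = refl
∑ⱽ-swap {N} {n = suc (suc n)} zero g = ∑-comm {N} {N} λ x y → ∑ⱽ λ v → g (y ∷ x ∷ v)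
∑ⱽ-swap {n = suc (suc n)} (suc k) g = sum-cong-≗ λ x → ∑ⱽ-swap k (g ∘ (x ∷_))

∑ⱽ-permute : ∀ ks (g : Vec (Fin N) n → ℤ) → ∑ⱽ (g ∘ permute ks) ≡ ∑ⱽ g
∑ⱽ-permute [] g = refl
∑ⱽ-permute (k ∷ ks) g = trans (∑ⱽ-permute ks (g ∘ swap k)) (∑ⱽ-swap k g)

-- Polynomials in signs and sums of squares

0≤+ : ∀ {i j} → 0ℤ ≤ i → 0ℤ ≤ j → 0ℤ ≤ i + j
0≤+ = ℤP.+-mono-≤

0≤* : ∀ {i j} → 0ℤ ≤ i → 0ℤ ≤ j → 0ℤ ≤ i * j
0≤* {i} {j} 0≤i 0≤j = subst (_≤ i * j) (ℤP.*-zeroʳ i)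
  (ℤP.*-monoˡ-≤-nonNeg i {{nonNegative 0≤i}} 0≤j)

0≤i*i : ∀ i → 0ℤ ≤ i * i
0≤i*i (+ n) = 0≤* {+ n} {+ n} (+≤+ ℕ.z≤n) (+≤+ ℕ.z≤n)
0≤i*i -[1+ n ] = +≤+ ℕ.z≤n

∏ : List A → (A → ℤ) → ℤ
∏ xs g = foldr (λ x p → g x * p) 1ℤ xs

∏-cong : ∀ (xs : List A) {g h : A → ℤ} → (∀ x → g x ≡ h x) → ∏ xs g ≡ ∏ xs h
∏-cong [] g≗h = refl
∏-cong (x ∷ xs) g≗h = cong₂ _*_ (g≗h x) (∏-cong xs g≗h)

∏-++ : ∀ (xs ys : List A) (g : A → ℤ) → ∏ (xs List.++ ys) g ≡ ∏ xs g * ∏ ys g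
∏-++ [] ys g = ≡.sym (ℤP.*-identityˡ _)
∏-++ (x ∷ xs) ys g = trans (cong (g x *_) (∏-++ xs ys g)) (≡.sym (ℤP.*-assoc (g x) _ _))

∏-map : ∀ {D : Set} (h : D → A) (xs : List D) (g : A → ℤ) → ∏ (List.map h xs) g ≡ ∏ xs (g ∘ h)
∏-map h [] g = refl
∏-map h (x ∷ xs) g = cong (g (h x) *_) (∏-map h xs g)

IsSign : ℤ → Set
IsSign x = x * x ≡ 1ℤ

-- Polynomials in ±1 variables: node p q stands for p + x q, and products use x² = 1.
data Poly : ℕ → Set where
  nil  : Poly n
  leaf : ℤ → Poly 0
  node : Poly n → Poly n → Poly (suc n)

⟦_⟧ : Poly n → Vec ℤ n → ℤ
⟦ nil ⟧ xs = 0ℤ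
⟦ leaf c ⟧ [] = c
⟦ node p q ⟧ (x ∷ xs) = ⟦ p ⟧ xs + x * ⟦ q ⟧ xs

const : ℤ → Poly n
const {zero} c = leaf c
const {suc n} c = node (const c) nil

⟦const⟧ : ∀ c (xs : Vec ℤ n) → ⟦ const c ⟧ xs ≡ c
⟦const⟧ c [] = refl
⟦const⟧ c (x ∷ xs) rewrite ⟦const⟧ c xs | ℤP.*-zeroʳ x = ℤP.+-identityʳ c

scale : ℤ → Poly n → Poly n
scale a nil = nil
scale a (leaf c) = leaf (a * c)
scale a (node p q) = node (scale a p) (scale a q)

⟦scale⟧ : ∀ a (p : Poly n) xs → ⟦ scale a p ⟧ xs ≡ a * ⟦ p ⟧ xs
⟦scale⟧ a nil xs = ≡.sym (ℤP.*-zeroʳ a)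
⟦scale⟧ a (leaf c) [] = refl
⟦scale⟧ a (node p q) (x ∷ xs) rewrite ⟦scale⟧ a p xs | ⟦scale⟧ a q xs = lem a x (⟦ p ⟧ xs) (⟦ q ⟧ xs)
  where
  lem : ∀ a x p q → a * p + x * (a * q) ≡ a * (p + x * q)
  lem = solve-∀

infixl 6 _⊕_ _⊖_
infixl 7 _⊗_

_⊕_ : Poly n → Poly n → Poly n
nil ⊕ q = q
leaf a ⊕ nil = leaf a
leaf a ⊕ leaf b = leaf (a + b)
node p q ⊕ nil = node p q
node p q ⊕ node p′ q′ = node (p ⊕ p′) (q ⊕ q′)

⟦⊕⟧ : ∀ (p q : Poly n) xs → ⟦ p ⊕ q ⟧ xs ≡ ⟦ p ⟧ xs + ⟦ q ⟧ xs
⟦⊕⟧ nil q xs = ≡.sym (ℤP.+-identityˡ _)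
⟦⊕⟧ (leaf a) nil [] = ≡.sym (ℤP.+-identityʳ a)
⟦⊕⟧ (leaf a) (leaf b) [] = refl
⟦⊕⟧ (node p q) nil (x ∷ xs) = ≡.sym (ℤP.+-identityʳ _)
⟦⊕⟧ (node p q) (node p′ q′) (x ∷ xs) rewrite ⟦⊕⟧ p p′ xs | ⟦⊕⟧ q q′ xs =
  lem x (⟦ p ⟧ xs) (⟦ q ⟧ xs) (⟦ p′ ⟧ xs) (⟦ q′ ⟧ xs)
  where
  lem : ∀ x p q p′ q′ → (p + p′) + x * (q + q′) ≡ (p + x * q) + (p′ + x * q′)
  lem = solve-∀

_⊖_ : Poly n → Poly n → Poly n
p ⊖ q = p ⊕ scale -1ℤ q

⟦⊖⟧ : ∀ (p q : Poly n) xs → ⟦ p ⊖ q ⟧ xs ≡ ⟦ p ⟧ xs - ⟦ q ⟧ xs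
⟦⊖⟧ p q xs rewrite ⟦⊕⟧ p (scale -1ℤ q) xs | ⟦scale⟧ -1ℤ q xs =
  cong (λ t → ⟦ p ⟧ xs + t) (ℤP.-1*i≡-i (⟦ q ⟧ xs))

_⊗_ : Poly n → Poly n → Poly n
nil ⊗ _ = nil
leaf a ⊗ nil = nil
leaf a ⊗ leaf b = leaf (a * b)
node p q ⊗ nil = nil
node p q ⊗ node p′ q′ = node (p ⊗ p′ ⊕ q ⊗ q′) (p ⊗ q′ ⊕ q ⊗ p′)

⟦⊗⟧ : ∀ (p q : Poly n) {xs} → All IsSign xs → ⟦ p ⊗ q ⟧ xs ≡ ⟦ p ⟧ xs * ⟦ q ⟧ xs
⟦⊗⟧ nil q _ = refl
⟦⊗⟧ (leaf a) nil [] = ≡.sym (ℤP.*-zeroʳ a)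
⟦⊗⟧ (leaf a) (leaf b) [] = refl
⟦⊗⟧ (node p q) nil {x ∷ xs} _ = ≡.sym (ℤP.*-zeroʳ (⟦ p ⟧ xs + x * ⟦ q ⟧ xs))
⟦⊗⟧ (node p q) (node p′ q′) {x ∷ xs} (xx ∷ s)
  rewrite ⟦⊕⟧ (p ⊗ p′) (q ⊗ q′) xs | ⟦⊕⟧ (p ⊗ q′) (q ⊗ p′) xs
        | ⟦⊗⟧ p p′ s | ⟦⊗⟧ q q′ s | ⟦⊗⟧ p q′ s | ⟦⊗⟧ q p′ s = begin
  -- A factor 1 is inserted so that the sign relation can turn it into `x * x`; what remains is a
  -- ring identity.
  (P * P′ + Q * Q′) + x * (P * Q′ + Q * P′)          ≡⟨ cong (λ t → (P * P′ + t) + x * (P * Q′ + Q * P′)) (ℤP.*-identityˡ (Q * Q′)) ⟨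
  (P * P′ + 1ℤ * (Q * Q′)) + x * (P * Q′ + Q * P′)   ≡⟨ cong (λ t → (P * P′ + t * (Q * Q′)) + x * (P * Q′ + Q * P′)) xx ⟨
  (P * P′ + x * x * (Q * Q′)) + x * (P * Q′ + Q * P′) ≡⟨ lem x P Q P′ Q′ ⟩
  (P + x * Q) * (P′ + x * Q′)                        ∎
  where
  open ≡-Reasoning
  P = ⟦ p ⟧ xs
  Q = ⟦ q ⟧ xs
  P′ = ⟦ p′ ⟧ xs
  Q′ = ⟦ q′ ⟧ xs
  lem : ∀ x p q p′ q′ → (p * p′ + x * x * (q * q′)) + x * (p * q′ + q * p′) ≡ (p + x * q) * (p′ + x * q′)
  lem = solve-∀

-- Since x² = 1, multiplication by x turns p + x q into q + x p and merely exchanges the two halves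
-- of a node.
mulVar : Fin n → Poly n → Poly n
mulVar k nil = nil
mulVar zero (node p q) = node q p
mulVar (suc k) (node p q) = node (mulVar k p) (mulVar k q)

⟦mulVar⟧ : ∀ (k : Fin n) p {xs} → All IsSign xs → ⟦ mulVar k p ⟧ xs ≡ lookup xs k * ⟦ p ⟧ xs
⟦mulVar⟧ k nil {xs} _ = ≡.sym (ℤP.*-zeroʳ (lookup xs k))
⟦mulVar⟧ zero (node p q) {x ∷ xs} (xx ∷ s) = begin
  Q + x * P            ≡⟨ cong (_+ x * P) (ℤP.*-identityˡ Q) ⟨
  1ℤ * Q + x * P       ≡⟨ cong (λ t → t * Q + x * P) xx ⟨
  x * x * Q + x * P    ≡⟨ lem x P Q ⟩
  x * (P + x * Q)      ∎
  where
  open ≡-Reasoning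
  P = ⟦ p ⟧ xs
  Q = ⟦ q ⟧ xs
  lem : ∀ x p q → x * x * q + x * p ≡ x * (p + x * q)
  lem = solve-∀
⟦mulVar⟧ (suc k) (node p q) {x ∷ xs} (_ ∷ s) rewrite ⟦mulVar⟧ k p s | ⟦mulVar⟧ k q s =
  lem (lookup xs k) x (⟦ p ⟧ xs) (⟦ q ⟧ xs)
  where
  lem : ∀ k x p q → k * p + x * (k * q) ≡ k * (p + x * q)
  lem = solve-∀

parity : Bool → Poly n → Poly n
parity b nil = nil
parity true (leaf c) = leaf c
parity false (leaf c) = nil
parity b (node p q) = node (parity b p) (parity (not b) q)

negated : Vec ℤ n → Vec ℤ n
negated = Vec.map (λ x → - x)

sign : Bool → ℤ
sign b = if b then 1ℤ else -1ℤ

sign-not : ∀ b → sign (not b) ≡ - sign b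
sign-not true = refl
sign-not false = refl

-- Negating all variables multiplies a monomial by the sign of its degree, so even monomials double
-- and odd ones cancel. Passing below a variable changes the parity still required, hence the
-- general `b`.
⟦parity⟧ : ∀ b (p : Poly n) xs → ⟦ p ⟧ xs + sign b * ⟦ p ⟧ (negated xs) ≡ + 2 * ⟦ parity b p ⟧ xs
⟦parity⟧ b nil xs rewrite ℤP.*-zeroʳ (sign b) = refl
⟦parity⟧ true (leaf c) [] = lem c
  where
  lem : ∀ c → c + 1ℤ * c ≡ + 2 * c
  lem = solve-∀
⟦parity⟧ false (leaf c) [] = lem c
  where
  lem : ∀ c → c + -1ℤ * c ≡ 0ℤ
  lem = solve-∀
⟦parity⟧ b (node p q) (x ∷ xs) = begin
  (P + x * Q) + sign b * (P⁻ + - x * Q⁻)                 ≡⟨ lem (sign b) x P Q P⁻ Q⁻ ⟩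
  (P + sign b * P⁻) + x * (Q + - sign b * Q⁻)            ≡⟨ cong (λ t → (P + sign b * P⁻) + x * (Q + t * Q⁻)) (sign-not b) ⟨
  (P + sign b * P⁻) + x * (Q + sign (not b) * Q⁻)        ≡⟨ cong₂ (λ s t → s + x * t) (⟦parity⟧ b p xs) (⟦parity⟧ (not b) q xs) ⟩
  + 2 * ⟦ parity b p ⟧ xs + x * (+ 2 * ⟦ parity (not b) q ⟧ xs) ≡⟨ lem₂ x (⟦ parity b p ⟧ xs) (⟦ parity (not b) q ⟧ xs) ⟩
  + 2 * (⟦ parity b p ⟧ xs + x * ⟦ parity (not b) q ⟧ xs) ∎
  where
  open ≡-Reasoning
  P = ⟦ p ⟧ xs
  Q = ⟦ q ⟧ xs
  P⁻ = ⟦ p ⟧ (negated xs)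
  Q⁻ = ⟦ q ⟧ (negated xs)
  lem : ∀ s x p q p⁻ q⁻ → (p + x * q) + s * (p⁻ + - x * q⁻) ≡ (p + s * p⁻) + x * (q + - s * q⁻)
  lem = solve-∀
  lem₂ : ∀ x p q → + 2 * p + x * (+ 2 * q) ≡ + 2 * (p + x * q)
  lem₂ = solve-∀

-- Cancellation leaves trees with zero leaves instead of `nil`, so the whole tree has to be
-- inspected.
isZero : Poly n → Bool
isZero nil = true
isZero (leaf (+ zero)) = true
isZero (leaf _) = false
isZero (node p q) = if isZero p then isZero q else false

⟦isZero⟧ : ∀ (p : Poly n) → isZero p ≡ true → ∀ xs → ⟦ p ⟧ xs ≡ 0ℤ
⟦isZero⟧ nil _ xs = refl
⟦isZero⟧ (leaf (+ zero)) _ [] = refl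
⟦isZero⟧ (node p q) eq (x ∷ xs) with isZero p in eqp
... | true rewrite ⟦isZero⟧ p eqp xs | ⟦isZero⟧ q eq xs | ℤP.*-zeroʳ x = refl

-- Integrands on six vertices and the shape of a certificate

Vertex : Set
Vertex = Fin 6

Edge : Set
Edge = Vertex × Vertex

-- Loops are variables too: f(x,x) is not assumed to be 1.
edges : Vec Edge 21
edges =
  (0F , 0F) ∷ (1F , 1F) ∷ (2F , 2F) ∷ (3F , 3F) ∷ (4F , 4F) ∷ (5F , 5F) ∷
  (0F , 1F) ∷ (0F , 2F) ∷ (0F , 3F) ∷ (1F , 2F) ∷ (1F , 3F) ∷ (2F , 3F) ∷
  (0F , 4F) ∷ (1F , 4F) ∷ (2F , 4F) ∷ (3F , 4F) ∷
  (0F , 5F) ∷ (1F , 5F) ∷ (2F , 5F) ∷ (3F , 5F) ∷ (4F , 5F) ∷ []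

-- The table is symmetric: both orders of a pair name the same variable, which is where the symmetry
-- of f is built in.
positions : Vec (Vec (Fin 21) 6) 6
positions =
  (# 0 ∷ # 6 ∷ # 7 ∷ # 8 ∷ # 12 ∷ # 16 ∷ []) ∷
  (# 6 ∷ # 1 ∷ # 9 ∷ # 10 ∷ # 13 ∷ # 17 ∷ []) ∷
  (# 7 ∷ # 9 ∷ # 2 ∷ # 11 ∷ # 14 ∷ # 18 ∷ []) ∷
  (# 8 ∷ # 10 ∷ # 11 ∷ # 3 ∷ # 15 ∷ # 19 ∷ []) ∷
  (# 12 ∷ # 13 ∷ # 14 ∷ # 15 ∷ # 4 ∷ # 20 ∷ []) ∷
  (# 16 ∷ # 17 ∷ # 18 ∷ # 19 ∷ # 20 ∷ # 5 ∷ []) ∷ []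

position : Edge → Fin 21
position (i , j) = lookup (lookup positions i) j

edges-position : ∀ i j → lookup edges (position (i , j)) ≡ (i , j) ⊎ lookup edges (position (i , j)) ≡ (j , i)
edges-position = from-yes (FinP.all? λ i → FinP.all? λ j →
  (lookup edges (position (i , j)) ≟ᵉ (i , j)) ⊎-dec (lookup edges (position (i , j)) ≟ᵉ (j , i)))
  where _≟ᵉ_ = ≡-dec FinP._≟_ FinP._≟_

monomial : List Edge → Poly 21
monomial L = foldr (mulVar ∘ position) (const 1ℤ) L

rename : Vec (Fin n) n → List (Fin n × Fin n) → List (Fin n × Fin n)
rename t = List.map λ (i , j) → lookup t i , lookup t j

relabel : List ℕ → List (Fin n × Fin n) → List (Fin n × Fin n)
relabel ks = rename (permute ks (Vec.allFin _))

lookup-permute : ∀ {A : Set} ks (z : Vec A n) i → lookup z (lookup (permute ks (Vec.allFin n)) i) ≡ lookup (permute ks z) i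
lookup-permute {n = n} ks z i = begin
  lookup z (lookup (permute ks (Vec.allFin n)) i)           ≡⟨ lookup-map i (lookup z) (permute ks (Vec.allFin n)) ⟨
  lookup (Vec.map (lookup z) (permute ks (Vec.allFin n))) i ≡⟨ cong (λ v → lookup v i) (map-permute (lookup z) ks (Vec.allFin n)) ⟩
  lookup (permute ks (Vec.map (lookup z) (Vec.allFin n))) i ≡⟨ cong (λ v → lookup (permute ks v) i) (map-lookup-allFin z) ⟩
  lookup (permute ks z) i                               ∎
  where open ≡-Reasoning

-- ρ chooses a relabelling for every monomial; any choice is sound.
collect : (List Edge → List ℕ) → Vec Edge n → List Edge → Poly n → Poly 21 → Poly 21
collect ρ es L nil acc = acc
collect ρ es L (leaf (+ zero)) acc = acc
collect ρ es L (leaf c) acc = scale c (monomial (relabel (ρ L) L)) ⊕ acc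
collect ρ (e ∷ es) L (node p q) acc = collect ρ es L p (collect ρ es (e ∷ L) q acc)

normalise : (List Edge → List ℕ) → Poly 21 → Poly 21
normalise ρ p = collect ρ edges [] p nil

-- A type is a 4-tuple t of vertices; a factor (b , L) is 1 ± ∏_L f.
Factor : Set
Factor = Bool × List (Fin 4 × Fin 4)

-- Term (c , L , S) is the function y ↦ c · ∏_{ij ∈ L} f(tᵢ,tⱼ) · ∏_{s ∈ S} f(tₛ,y).
Term : Set
Term = ℤ × List (Fin 4 × Fin 4) × List (Fin 4)

Form : Set
Form = List Term

record Block : Set where
  constructor _∙_
  field
    factors : List Factor
    squares : List (ℕ × Form)
open Block public

typeEdge : Fin 4 × Fin 4 → Edge
typeEdge (i , j) = i ↑ˡ 2 , j ↑ˡ 2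

factorPoly : Factor → Poly 21
factorPoly (b , L) = const 1ℤ ⊕ scale (sign b) (monomial (List.map typeEdge L))

termEdges : Fin 2 → List (Fin 4 × Fin 4) → List (Fin 4) → List Edge
termEdges v L S = List.map typeEdge L List.++ List.map (λ s → s ↑ˡ 2 , 4 ↑ʳ v) S

formPoly : Fin 2 → Form → Poly 21
formPoly v = foldr (λ (c , L , S) p → scale c (monomial (termEdges v L S)) ⊕ p) nil

-- The square of ∑_y ℓ(t,y) is a double sum over y and y′, placed at the vertices 4 and 5 with one
-- copy of ℓ each.
squaresPoly : List (ℕ × Form) → Poly 21
squaresPoly = foldr (λ (c , ℓ) p → scale (+ c) (formPoly 0F ℓ ⊗ formPoly 1F ℓ) ⊕ p) nil

blockPoly : Block → Poly 21
blockPoly (fs ∙ qs) = foldr (λ φ p → factorPoly φ ⊗ p) (squaresPoly qs) fs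

gram : List Block → Poly 21
gram = foldr (λ b p → blockPoly b ⊕ p) nil

-- Evaluating integrands at a symmetric sign matrix

module Evaluation {N} (f : Fin N → Fin N → ℤ)
  (f-sym : ∀ x y → f x y ≡ f y x) (f-sign : ∀ x y → IsSign (f x y)) where

  at : ∀ {k} → Vec (Fin N) k → Fin k × Fin k → ℤ
  at z (i , j) = f (lookup z i) (lookup z j)

  values : Vec (Fin N) 6 → Vec ℤ 21
  values z = Vec.map (at z) edges

  map-signs : ∀ {k} (z : Vec (Fin N) k) (es : Vec (Fin k × Fin k) m) → All IsSign (Vec.map (at z) es)
  map-signs z [] = []
  map-signs z ((i , j) ∷ es) = f-sign (lookup z i) (lookup z j) ∷ map-signs z es

  lookup-values : ∀ z e → lookup (values z) (position e) ≡ at z e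
  lookup-values z e@(i , j) with edges-position i j
  ... | inj₁ eq = trans (lookup-map (position e) (at z) edges) (cong (at z) eq)
  ... | inj₂ eq = trans (lookup-map (position e) (at z) edges)
                    (trans (cong (at z) eq) (f-sym (lookup z j) (lookup z i)))

  ⟦monomial⟧ : ∀ L z → ⟦ monomial L ⟧ (values z) ≡ ∏ L (at z)
  ⟦monomial⟧ [] z = ⟦const⟧ 1ℤ (values z)
  ⟦monomial⟧ (e ∷ L) z = trans (⟦mulVar⟧ (position e) (monomial L) (map-signs z edges))
    (cong₂ _*_ (lookup-values z e) (⟦monomial⟧ L z))

  ∏-relabel : ∀ ks (L : List (Fin n × Fin n)) z → ∏ (relabel ks L) (at z) ≡ ∏ L (at (permute ks z))
  ∏-relabel ks L z = trans (∏-map _ L (at z))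
    (∏-cong L λ (i , j) → cong₂ f (lookup-permute ks z i) (lookup-permute ks z j))

  -- Relabelling a monomial permutes the summation variables and leaves the sum unchanged. This
  -- holds for every word `ks`, so the choice of word needs no justification.
  ∑-monomial-relabel : ∀ c ks (L : List Edge) acc →
    ∑ⱽ (λ z → ⟦ scale c (monomial (relabel ks L)) ⊕ acc ⟧ (values z))
      ≡ ∑ⱽ (λ z → ∏ L (at z) * c) + ∑ⱽ (λ z → ⟦ acc ⟧ (values z))
  ∑-monomial-relabel c ks L acc = begin
    ∑ⱽ (λ z → ⟦ scale c (monomial (relabel ks L)) ⊕ acc ⟧ (values z))
      ≡⟨ ∑ⱽ-cong (λ z → trans (⟦⊕⟧ (scale c (monomial (relabel ks L))) acc (values z))
           (cong (_+ ⟦ acc ⟧ (values z)) (trans (⟦scale⟧ c (monomial (relabel ks L)) (values z))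
             (trans (ℤP.*-comm c _) (cong (_* c) (trans (⟦monomial⟧ (relabel ks L) z) (∏-relabel ks L z))))))) ⟩
    ∑ⱽ (λ z → ∏ L (at (permute ks z)) * c + ⟦ acc ⟧ (values z))
      ≡⟨ ∑ⱽ-distrib-+ (λ z → ∏ L (at (permute ks z)) * c) (λ z → ⟦ acc ⟧ (values z)) ⟩
    ∑ⱽ (λ z → ∏ L (at (permute ks z)) * c) + ∑ⱽ (λ z → ⟦ acc ⟧ (values z))
      ≡⟨ cong (_+ ∑ⱽ (λ z → ⟦ acc ⟧ (values z))) (∑ⱽ-permute ks (λ z → ∏ L (at z) * c)) ⟩
    ∑ⱽ (λ z → ∏ L (at z) * c) + ∑ⱽ (λ z → ⟦ acc ⟧ (values z)) ∎
    where open ≡-Reasoning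

  ∑-zero : ∀ (g : Vec (Fin N) 6 → ℤ) s → s ≡ ∑ⱽ (λ z → g z * 0ℤ) + s
  ∑-zero g s = ≡.sym (begin
    ∑ⱽ (λ z → g z * 0ℤ) + s   ≡⟨ cong (_+ s) (∑ⱽ-cong (λ z → trans (ℤP.*-zeroʳ (g z)) (≡.sym (ℤP.*-zeroˡ 0ℤ)))) ⟩
    -- Writing 0 as 0 · 0 lets a factor 0 be pulled out of the sum, which then vanishes by
    -- computation.
    ∑ⱽ {N} {6} (λ z → 0ℤ * 0ℤ) + s   ≡⟨ cong (_+ s) (*-distribˡ-∑ⱽ {N} {6} 0ℤ (λ _ → 0ℤ)) ⟨
    0ℤ + s                    ≡⟨ ℤP.+-identityˡ s ⟩
    s ∎)
    where open ≡-Reasoning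

  -- `L` holds the variables taken on the way down the tree, so the subtree `p` stands for ∏_L f
  -- times its own value; a node splits this into two such summands.
  ∑-collect : ∀ ρ (es : Vec Edge n) L p acc → ∑ⱽ (λ z → ⟦ collect ρ es L p acc ⟧ (values z))
    ≡ ∑ⱽ (λ z → ∏ L (at z) * ⟦ p ⟧ (Vec.map (at z) es)) + ∑ⱽ (λ z → ⟦ acc ⟧ (values z))
  ∑-collect ρ es L nil acc = ∑-zero (λ z → ∏ L (at z)) _
  ∑-collect ρ [] L (leaf (+ zero)) acc = ∑-zero (λ z → ∏ L (at z)) _
  ∑-collect ρ [] L (leaf c@(+ suc _)) acc = ∑-monomial-relabel c (ρ L) L acc
  ∑-collect ρ [] L (leaf c@(-[1+ _ ])) acc = ∑-monomial-relabel c (ρ L) L acc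
  ∑-collect ρ (e ∷ es) L (node p q) acc = begin
    ∑ⱽ (λ z → ⟦ collect ρ es L p (collect ρ es (e ∷ L) q acc) ⟧ (values z))
      ≡⟨ ∑-collect ρ es L p (collect ρ es (e ∷ L) q acc) ⟩
    ∑ⱽ (λ z → ∏ L (at z) * P z) + ∑ⱽ (λ z → ⟦ collect ρ es (e ∷ L) q acc ⟧ (values z))
      ≡⟨ cong (λ s → ∑ⱽ (λ z → ∏ L (at z) * P z) + s) (∑-collect ρ es (e ∷ L) q acc) ⟩
    ∑ⱽ (λ z → ∏ L (at z) * P z) + (∑ⱽ (λ z → at z e * ∏ L (at z) * Q z) + R)
      ≡⟨ ℤP.+-assoc (∑ⱽ (λ z → ∏ L (at z) * P z)) _ R ⟨
    ∑ⱽ (λ z → ∏ L (at z) * P z) + ∑ⱽ (λ z → at z e * ∏ L (at z) * Q z) + R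
      ≡⟨ cong (_+ R) (∑ⱽ-distrib-+ (λ z → ∏ L (at z) * P z) (λ z → at z e * ∏ L (at z) * Q z)) ⟨
    ∑ⱽ (λ z → ∏ L (at z) * P z + at z e * ∏ L (at z) * Q z) + R
      ≡⟨ cong (_+ R) (∑ⱽ-cong λ z → lem (∏ L (at z)) (at z e) (P z) (Q z)) ⟩
    ∑ⱽ (λ z → ∏ L (at z) * (P z + at z e * Q z)) + R ∎
    where
    open ≡-Reasoning
    R = ∑ⱽ (λ z → ⟦ acc ⟧ (values z))
    P Q : Vec (Fin N) 6 → ℤ
    P z = ⟦ p ⟧ (Vec.map (at z) es)
    Q z = ⟦ q ⟧ (Vec.map (at z) es)
    lem : ∀ l e p q → l * p + e * l * q ≡ l * (p + e * q)
    lem = solve-∀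

  ∑-normalise : ∀ ρ p → ∑ⱽ (λ z → ⟦ normalise ρ p ⟧ (values z)) ≡ ∑ⱽ (λ z → ⟦ p ⟧ (values z))
  ∑-normalise ρ p = begin
    ∑ⱽ (λ z → ⟦ normalise ρ p ⟧ (values z))                ≡⟨ ∑-collect ρ edges [] p nil ⟩
    ∑ⱽ (λ z → 1ℤ * ⟦ p ⟧ (values z)) + ∑ⱽ {N} {6} (λ _ → 0ℤ) ≡⟨ ∑ⱽ-distrib-+ (λ z → 1ℤ * ⟦ p ⟧ (values z)) (λ _ → 0ℤ) ⟨
    ∑ⱽ (λ z → 1ℤ * ⟦ p ⟧ (values z) + 0ℤ)                   ≡⟨ ∑ⱽ-cong (λ z → lem (⟦ p ⟧ (values z))) ⟩
    ∑ⱽ (λ z → ⟦ p ⟧ (values z))                             ∎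
    where
    open ≡-Reasoning
    lem : ∀ p → 1ℤ * p + 0ℤ ≡ p
    lem = solve-∀

  factorValue : Vec (Fin N) 4 → Factor → ℤ
  factorValue t (b , L) = 1ℤ + sign b * ∏ L (at t)

  termValue : Vec (Fin N) 4 → Fin N → Term → ℤ
  termValue t y (c , L , S) = c * (∏ L (at t) * ∏ S (λ s → f (lookup t s) y))

  formValue : Vec (Fin N) 4 → Form → Fin N → ℤ
  formValue t ℓ y = foldr (λ τ s → termValue t y τ + s) 0ℤ ℓ

  squaresValue : Vec (Fin N) 4 → List (ℕ × Form) → Fin N → Fin N → ℤ
  squaresValue t qs y y′ = foldr (λ (c , ℓ) s → + c * (formValue t ℓ y * formValue t ℓ y′) + s) 0ℤ qs

  module _ (t : Vec (Fin N) 4) (w : Vec (Fin N) 2) where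
    private
      z = t ++ w
      xs = values z
      signs = map-signs z edges

    ∏-typeEdge : ∀ L → ∏ (List.map typeEdge L) (at z) ≡ ∏ L (at t)
    ∏-typeEdge L = trans (∏-map typeEdge L (at z))
      (∏-cong L λ (i , j) → cong₂ f (lookup-++ˡ t w i) (lookup-++ˡ t w j))

    ⟦factorPoly⟧ : ∀ φ → ⟦ factorPoly φ ⟧ xs ≡ factorValue t φ
    ⟦factorPoly⟧ (b , L) = begin
      ⟦ const 1ℤ ⊕ scale (sign b) (monomial L′) ⟧ xs        ≡⟨ ⟦⊕⟧ (const 1ℤ) (scale (sign b) (monomial L′)) xs ⟩
      ⟦ const 1ℤ ⟧ xs + ⟦ scale (sign b) (monomial L′) ⟧ xs ≡⟨ cong₂ _+_ (⟦const⟧ 1ℤ xs) (⟦scale⟧ (sign b) (monomial L′) xs) ⟩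
      1ℤ + sign b * ⟦ monomial L′ ⟧ xs                      ≡⟨ cong (λ p → 1ℤ + sign b * p) (trans (⟦monomial⟧ L′ z) (∏-typeEdge L)) ⟩
      1ℤ + sign b * ∏ L (at t)                              ∎
      where
      open ≡-Reasoning
      L′ = List.map typeEdge L

    ⟦formPoly⟧ : ∀ v ℓ → ⟦ formPoly v ℓ ⟧ xs ≡ formValue t ℓ (lookup w v)
    ⟦formPoly⟧ v [] = refl
    ⟦formPoly⟧ v ((c , L , S) ∷ ℓ) = begin
      ⟦ scale c (monomial T) ⊕ formPoly v ℓ ⟧ xs       ≡⟨ ⟦⊕⟧ (scale c (monomial T)) (formPoly v ℓ) xs ⟩
      ⟦ scale c (monomial T) ⟧ xs + ⟦ formPoly v ℓ ⟧ xs ≡⟨ cong₂ _+_ (⟦scale⟧ c (monomial T) xs) (⟦formPoly⟧ v ℓ) ⟩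
      c * ⟦ monomial T ⟧ xs + formValue t ℓ (lookup w v) ≡⟨ cong (λ p → c * p + formValue t ℓ (lookup w v)) eq ⟩
      formValue t ((c , L , S) ∷ ℓ) (lookup w v)        ∎
      where
      open ≡-Reasoning
      T = termEdges v L S
      eq : ⟦ monomial T ⟧ xs ≡ ∏ L (at t) * ∏ S (λ s → f (lookup t s) (lookup w v))
      eq = trans (⟦monomial⟧ T z) (trans (∏-++ (List.map typeEdge L) _ (at z))
        (cong₂ _*_ (∏-typeEdge L) (trans (∏-map _ S (at z))
          (∏-cong S λ s → cong₂ f (lookup-++ˡ t w s) (lookup-++ʳ t w v)))))

    ⟦squaresPoly⟧ : ∀ qs → ⟦ squaresPoly qs ⟧ xs ≡ squaresValue t qs (lookup w 0F) (lookup w 1F)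
    ⟦squaresPoly⟧ [] = refl
    ⟦squaresPoly⟧ ((c , ℓ) ∷ qs) = begin
      ⟦ scale (+ c) (formPoly 0F ℓ ⊗ formPoly 1F ℓ) ⊕ squaresPoly qs ⟧ xs
        ≡⟨ ⟦⊕⟧ (scale (+ c) (formPoly 0F ℓ ⊗ formPoly 1F ℓ)) (squaresPoly qs) xs ⟩
      ⟦ scale (+ c) (formPoly 0F ℓ ⊗ formPoly 1F ℓ) ⟧ xs + ⟦ squaresPoly qs ⟧ xs
        ≡⟨ cong₂ _+_ (trans (⟦scale⟧ (+ c) (formPoly 0F ℓ ⊗ formPoly 1F ℓ) xs)
             (cong (+ c *_) (trans (⟦⊗⟧ (formPoly 0F ℓ) (formPoly 1F ℓ) signs)
               (cong₂ _*_ (⟦formPoly⟧ 0F ℓ) (⟦formPoly⟧ 1F ℓ))))) (⟦squaresPoly⟧ qs) ⟩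
      squaresValue t ((c , ℓ) ∷ qs) (lookup w 0F) (lookup w 1F) ∎
      where open ≡-Reasoning

    ⟦blockPoly⟧ : ∀ b → ⟦ blockPoly b ⟧ xs
      ≡ ∏ (factors b) (factorValue t) * squaresValue t (squares b) (lookup w 0F) (lookup w 1F)
    ⟦blockPoly⟧ ([] ∙ qs) = trans (⟦squaresPoly⟧ qs) (≡.sym (ℤP.*-identityˡ _))
    ⟦blockPoly⟧ ((φ ∷ fs) ∙ qs) = begin
      ⟦ factorPoly φ ⊗ blockPoly (fs ∙ qs) ⟧ xs          ≡⟨ ⟦⊗⟧ (factorPoly φ) (blockPoly (fs ∙ qs)) signs ⟩
      ⟦ factorPoly φ ⟧ xs * ⟦ blockPoly (fs ∙ qs) ⟧ xs   ≡⟨ cong₂ _*_ (⟦factorPoly⟧ φ) (⟦blockPoly⟧ (fs ∙ qs)) ⟩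
      factorValue t φ * (∏ fs (factorValue t) * V)       ≡⟨ ℤP.*-assoc (factorValue t φ) _ V ⟨
      ∏ (φ ∷ fs) (factorValue t) * V                     ∎
      where
      open ≡-Reasoning
      V = squaresValue t qs (lookup w 0F) (lookup w 1F)

  ∏-sign : ∀ {k} (z : Vec (Fin N) k) L → IsSign (∏ L (at z))
  ∏-sign z [] = refl
  ∏-sign z (e@(i , j) ∷ L) = trans (lem (at z e) (∏ L (at z)))
    (cong₂ _*_ (f-sign (lookup z i) (lookup z j)) (∏-sign z L))
    where
    lem : ∀ a b → a * b * (a * b) ≡ a * a * (b * b)
    lem = solve-∀

  -- With u = ± ∏_L f one has u² = 1, hence 2 (1 + u) = (1 + u)².
  0≤factorValue : ∀ t φ → 0ℤ ≤ factorValue t φ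
  0≤factorValue t (b , L) = ℤP.*-cancelˡ-≤-pos 0ℤ (1ℤ + u) (+ 2)
    (subst (0ℤ ≤_) (trans (lem u) (trans (cong (λ s → 1ℤ + + 2 * u + s) (square b)) (lem₂ u))) (0≤i*i (1ℤ + u)))
    where
    u = sign b * ∏ L (at t)
    square : ∀ b → IsSign (sign b * ∏ L (at t))
    square true = trans (lem₃ (∏ L (at t))) (∏-sign t L)
      where
      lem₃ : ∀ p → 1ℤ * p * (1ℤ * p) ≡ p * p
      lem₃ = solve-∀
    square false = trans (lem₃ (∏ L (at t))) (∏-sign t L)
      where
      lem₃ : ∀ p → -1ℤ * p * (-1ℤ * p) ≡ p * p
      lem₃ = solve-∀
    lem : ∀ u → (1ℤ + u) * (1ℤ + u) ≡ 1ℤ + + 2 * u + u * u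
    lem = solve-∀
    lem₂ : ∀ u → 1ℤ + + 2 * u + 1ℤ ≡ + 2 * (1ℤ + u)
    lem₂ = solve-∀

  0≤factors : ∀ t fs → 0ℤ ≤ ∏ fs (factorValue t)
  0≤factors t [] = +≤+ ℕ.z≤n
  0≤factors t (φ ∷ fs) = 0≤* (0≤factorValue t φ) (0≤factors t fs)

  sum₂ : (Fin N → Fin N → ℤ) → ℤ
  sum₂ g = sum λ y → sum λ y′ → g y y′

  sum₂-product : ∀ c (g : Fin N → ℤ) → sum₂ (λ y y′ → c * (g y * g y′)) ≡ c * (sum g * sum g)
  sum₂-product c g = begin
    (sum λ y → sum λ y′ → c * (g y * g y′))  ≡⟨ sum-cong-≗ (λ y → trans (sum-cong-≗ λ y′ → ≡.sym (ℤP.*-assoc c (g y) (g y′))) (≡.sym (*-distribˡ-sum (c * g y) g))) ⟩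
    (sum λ y → c * g y * sum g)              ≡⟨ sum-cong-≗ (λ y → lem c (g y) (sum g)) ⟩
    (sum λ y → c * sum g * g y)              ≡⟨ *-distribˡ-sum (c * sum g) g ⟨
    c * sum g * sum g                        ≡⟨ ℤP.*-assoc c (sum g) (sum g) ⟩
    c * (sum g * sum g)                      ∎
    where
    open ≡-Reasoning
    lem : ∀ c a b → c * a * b ≡ c * b * a
    lem = solve-∀

  0≤squares : ∀ t qs → 0ℤ ≤ sum₂ (squaresValue t qs)
  0≤squares t [] = 0≤∑ⱽ {N} {2} {g = λ _ → 0ℤ} λ _ → ℤP.≤-refl
  0≤squares t ((c , ℓ) ∷ qs) = subst (0ℤ ≤_) (≡.sym eq)
    (0≤+ (0≤* {+ c} (+≤+ ℕ.z≤n) (0≤i*i (sum g))) (0≤squares t qs))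
    where
    g = formValue t ℓ
    h : Fin N → Fin N → ℤ
    h y y′ = + c * (g y * g y′)
    eq : sum₂ (λ y y′ → h y y′ + squaresValue t qs y y′) ≡ + c * (sum g * sum g) + sum₂ (squaresValue t qs)
    eq = trans (trans (sum-cong-≗ λ y → ∑-distrib-+ (h y) (squaresValue t qs y))
           (∑-distrib-+ (λ y → sum (h y)) (λ y → sum (squaresValue t qs y))))
         (cong (_+ sum₂ (squaresValue t qs)) (sum₂-product (+ c) g))

  -- The factors depend on the type t alone, so they leave the inner sum over y and y′; that sum is
  -- a nonnegative combination of squares.
  0≤block : ∀ b → 0ℤ ≤ ∑ⱽ (λ z → ⟦ blockPoly b ⟧ (values z))
  0≤block b = subst (0ℤ ≤_) (≡.sym (trans (∑ⱽ-++ 4 (λ z → ⟦ blockPoly b ⟧ (values z))) (∑ⱽ-cong eq)))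
    (0≤∑ⱽ {n = 4} λ t → 0≤* (0≤factors t (factors b)) (0≤squares t (squares b)))
    where
    eq : ∀ t → ∑ⱽ {n = 2} (λ w → ⟦ blockPoly b ⟧ (values (t ++ w)))
             ≡ ∏ (factors b) (factorValue t) * sum₂ (squaresValue t (squares b))
    eq t = trans (∑ⱽ-cong {n = 2} λ w → ⟦blockPoly⟧ t w b)
      (≡.sym (*-distribˡ-∑ⱽ {n = 2} (∏ (factors b) (factorValue t)) V))
      where
      V : Vec (Fin N) 2 → ℤ
      V w = squaresValue t (squares b) (lookup w 0F) (lookup w 1F)

  0≤gram : ∀ bs → 0ℤ ≤ ∑ⱽ (λ z → ⟦ gram bs ⟧ (values z))
  0≤gram [] = 0≤∑ⱽ {N} {6} {g = λ _ → 0ℤ} λ _ → ℤP.≤-refl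
  0≤gram (b ∷ bs) = subst (0ℤ ≤_)
    (≡.sym (trans (∑ⱽ-cong λ z → ⟦⊕⟧ (blockPoly b) (gram bs) (values z))
      (∑ⱽ-distrib-+ (λ z → ⟦ blockPoly b ⟧ (values z)) (λ z → ⟦ gram bs ⟧ (values z)))))
    (0≤+ (0≤block b) (0≤gram bs))

-- Checking certificates

_==_ : Fin n → Fin n → Bool
zero == zero = true
suc i == suc j = i == j
_ == _ = false

Colours : Set
Colours = Vec ℕ 6

-- A numerical form of colour refinement: every vertex adds the squares of the old colours of its
-- neighbours. A coincidence of colours can at worst keep isomorphic monomials apart and make a
-- check fail.
refine : List Edge → Colours → Colours
refine L c = foldr (λ (i , j) → add i j ∘ add j i) c L
  where
  add : Vertex → Vertex → Colours → Colours
  add i j d = updateAt d i (ℕ._+ lookup c j ℕ.* lookup c j)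

heaviest : Colours → Vertex → List Vertex → ℕ × Vertex × List Vertex
heaviest c v [] = 0 , v , []
heaviest c v (w ∷ vs) with heaviest c w vs
... | p , u , rest = if lookup c v <ᵇ lookup c u then suc p , u , v ∷ rest else 0 , v , w ∷ vs

descending : ℕ → ℕ → List ℕ
descending d zero = []
descending d (suc p) = d ℕ.+ p ∷ descending d p

-- As a renaming, `descending d p` sends the vertex at position d + p to d and shifts those passed
-- over by one, so concatenating these words lists the vertices by decreasing colour.
-- `individualise` may break the remaining symmetry after each choice.
selectionSort : (Vertex → Colours → Colours) → ℕ → ℕ → Colours → List Vertex → List ℕ
selectionSort individualise zero d c vs = []
selectionSort individualise (suc fuel) d c [] = []
selectionSort individualise (suc fuel) d c (v ∷ vs) with heaviest c v vs
... | p , u , rest = descending d p List.++ selectionSort individualise fuel (suc d) (individualise u c) rest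

vertices : List Vertex
vertices = List.allFin 6

byDegree byRefinement : List Edge → List ℕ
byDegree L = selectionSort (λ _ → id) 6 0 (refine L (Vec.replicate 6 1)) vertices
byRefinement L = selectionSort individualise 6 0 (refine L (refine L (refine L (Vec.replicate 6 1)))) vertices
  where
  individualise : Vertex → Colours → Colours
  individualise v c = refine L (refine L (updateAt c v (λ x → suc (x ℕ.+ x))))

-- A cheap sort by degree merges many monomials before the costlier refinement is run on the rest.
canonical : Poly 21 → Poly 21
canonical = normalise byRefinement ∘ normalise byDegree

Nonneg : Poly 21 → Set
Nonneg p = ∀ {N} (f : Fin N → Fin N → ℤ) (f-sym : ∀ x y → f x y ≡ f y x) (f-sign : ∀ x y → IsSign (f x y)) →
  0ℤ ≤ ∑ⱽ (λ z → ⟦ p ⟧ (Evaluation.values f f-sym f-sign z))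

nonneg-canonical : ∀ p → Nonneg (canonical p) → Nonneg p
nonneg-canonical p 0≤p f f-sym f-sign = subst (0ℤ ≤_)
  (trans (∑-normalise byRefinement (normalise byDegree p)) (∑-normalise byDegree p)) (0≤p f f-sym f-sign)
  where open Evaluation f f-sym f-sign

∑-⊖ : ∀ {N} (values : Vec (Fin N) 6 → Vec ℤ 21) p q →
  ∑ⱽ (λ z → ⟦ p ⟧ (values z)) ≡ ∑ⱽ (λ z → ⟦ p ⊖ q ⟧ (values z)) + ∑ⱽ (λ z → ⟦ q ⟧ (values z))
∑-⊖ values p q = trans
  (∑ⱽ-cong λ z → trans (lem (⟦ p ⟧ (values z)) (⟦ q ⟧ (values z)))
    (cong (_+ ⟦ q ⟧ (values z)) (≡.sym (⟦⊖⟧ p q (values z)))))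
  (∑ⱽ-distrib-+ (λ z → ⟦ p ⊖ q ⟧ (values z)) (λ z → ⟦ q ⟧ (values z)))
  where
  lem : ∀ a b → a ≡ (a - b) + b
  lem = solve-∀

nonneg-gram : ∀ p bs → Nonneg (p ⊖ gram bs) → Nonneg p
nonneg-gram p bs 0≤r f f-sym f-sign = subst (0ℤ ≤_) (≡.sym (∑-⊖ values p (gram bs)))
  (0≤+ (0≤r f f-sym f-sign) (0≤gram bs))
  where open Evaluation f f-sym f-sign

nonneg-isZero : ∀ p → isZero p ≡ true → Nonneg p
nonneg-isZero p p≡0 f f-sym f-sign = 0≤∑ⱽ {n = 6} λ z → ℤP.≤-reflexive (≡.sym (⟦isZero⟧ p p≡0 (values z)))
  where open Evaluation f f-sym f-sign

∑-scale : ∀ {N} (values : Vec (Fin N) 6 → Vec ℤ 21) a p →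
  ∑ⱽ (λ z → ⟦ scale a p ⟧ (values z)) ≡ a * ∑ⱽ (λ z → ⟦ p ⟧ (values z))
∑-scale values a p = trans (∑ⱽ-cong λ z → ⟦scale⟧ a p (values z))
  (≡.sym (*-distribˡ-∑ⱽ a (λ z → ⟦ p ⟧ (values z))))

nonneg-double : ∀ p → Nonneg (scale (+ 2) p) → Nonneg p
nonneg-double p 0≤2p f f-sym f-sign = ℤP.*-cancelˡ-≤-pos 0ℤ _ (+ 2)
  (subst (0ℤ ≤_) (∑-scale values (+ 2) p) (0≤2p f f-sym f-sign))
  where open Evaluation f f-sym f-sign

-- Absorbing rounding errors into squares

neighbours : Vertex → List Edge → List Vertex
neighbours v L = List.filterᵇ (λ u → any (λ (i , j) → (i == u ∧ j == v) ∨ (i == v ∧ j == u)) L) vertices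

twins : List Edge → List Vertex → List Vertex → Bool
twins L S S′ = (length L ≡ᵇ length S ℕ.+ length S′) ∧ all (λ s → any (s ==_) S′) S

-- (weight , y , y′ , S , S′) with nonadjacent y and y′ and their neighbourhoods S and S′
Split : Set
Split = ℕ × Vertex × Vertex × List Vertex × List Vertex

-- Small neighbourhoods are preferred: a path on five vertices, for instance, is charged through its
-- two ends to K(2,1). Twins get weight 0, so that a K(2,s) is recognised and kept for the final
-- round.
splitWeight : List Edge → List Vertex → List Vertex → ℕ
splitWeight L S S′ = if twins L S S′ then 0 else suc (2 ℕ.* length S) ℕ.* suc (2 ℕ.* length S′)

lighter : Split → Maybe Split → Maybe Split
lighter s nothing = just s
lighter s@(a , _) (just t@(b , _)) = just (if a <ᵇ b then s else t)

considerSplit : List Edge → Vec (List Vertex) 6 → Vertex → Vertex → Maybe Split → Maybe Split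
considerSplit L nbrs y y′ s with lookup nbrs y | lookup nbrs y′
... | [] | _ = s
... | _ | [] = s
-- The vertices must be nonadjacent because each form sees only one of them, so the product of two
-- forms has no factor f(y,y′).
... | S | S′ = if (Fin.toℕ y <ᵇ Fin.toℕ y′) ∧ not (any (y ==_) S′)
                 then lighter (splitWeight L S S′ , y , y′ , S , S′) s
                 else s

lightestSplit : List Edge → Vec (List Vertex) 6 → Maybe Split
lightestSplit L nbrs = foldr (λ y s → foldr (considerSplit L nbrs y) s vertices) nothing vertices

renumber : Vertex → Vertex → Vec (Fin 4) 6
renumber y y′ = go 0F (Vec.allFin 6)
  where
  next : Fin 4 → Fin 4
  next 0F = 1F
  next 1F = 2F
  next 2F = 3F
  next 3F = 3F
  go : Fin 4 → Vec Vertex n → Vec (Fin 4) n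
  go k [] = []
  go k (v ∷ vs) = if (v == y) ∨ (v == y′) then k ∷ go k vs else k ∷ go (next k) vs

-- Twice a term x w φ_S(y) φ_S′(y′) is absorbed by ∣x∣ (φ_S ± w φ_S′)², at the expense of the
-- complete bipartite graphs K(2,∣S∣) and K(2,∣S′∣). These are the squares φ_S² and are
-- removed in the final round.
absorbTerm : Bool → Bool → ℤ → Vec (Fin 4) 6 → List Edge → List Vertex → List Vertex → List (ℕ × Form)
absorbTerm false false x ν w S S′ = (∣ x ∣ , (1ℤ , [] , List.map (lookup ν) S) ∷
  (ℤ.sign x ℤ.◃ 1 , List.map (λ (i , j) → lookup ν i , lookup ν j) w , List.map (lookup ν) S′) ∷ []) ∷ []
absorbTerm true true x ν w S S′ = (2 ℕ.* ∣ x ∣ , (1ℤ , [] , List.map (lookup ν) S) ∷ []) ∷ []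
absorbTerm _ _ x ν w S S′ = []

absorb : Bool → List Edge → ℤ → List (ℕ × Form)
absorb final L x with lightestSplit L (Vec.map (λ v → neighbours v L) (Vec.allFin 6))
... | nothing = []
... | just (_ , y , y′ , S , S′) = absorbTerm final (twins L S S′) x (renumber y y′)
  (List.filterᵇ (λ (i , j) → not ((i == y) ∨ (i == y′) ∨ (j == y) ∨ (j == y′))) L) S S′

absorbAll : Bool → Vec Edge n → List Edge → Poly n → List (ℕ × Form)
absorbAll final es L nil = []
absorbAll final es L (leaf (+ zero)) = []
absorbAll final es L (leaf c) = absorb final L c
absorbAll final (e ∷ es) L (node p q) = absorbAll final es L p List.++ absorbAll final es (e ∷ L) q

reduceBy : Bool → Poly 21 → Poly 21
reduceBy final p = canonical (scale (+ 2) p ⊖ gram (([] ∙ absorbAll final edges [] p) ∷ []))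

nonneg-reduceBy : ∀ final p → Nonneg (reduceBy final p) → Nonneg p
nonneg-reduceBy final p = nonneg-double p ∘ nonneg-gram (scale (+ 2) p) bs ∘ nonneg-canonical (scale (+ 2) p ⊖ gram bs)
  where bs = ([] ∙ absorbAll final edges [] p) ∷ []

residual : ℕ → List Block → Poly 21 → Poly 21
residual k bs p = canonical (parity true (scale (+ suc k) p ⊖ gram bs))

-- The first round trades the monomials that have a split without twins for deficits in K(2,s). The
-- second clears a K(2,s) only if its total coefficient is nonnegative; everything else, the
-- constant term included, must have cancelled. Scale 0 is rejected since it would say nothing about
-- `p`.
certifies : ℕ → List Block → Poly 21 → Bool
certifies zero bs p = false
certifies (suc k) bs p = isZero (reduceBy true (reduceBy false (residual k bs p)))

module _ {N} (f : Fin N → Fin N → ℤ) where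
  negation-sym : (∀ x y → f x y ≡ f y x) → ∀ x y → - f x y ≡ - f y x
  negation-sym f-sym x y = cong -_ (f-sym x y)

  negation-sign : (∀ x y → IsSign (f x y)) → ∀ x y → IsSign (- f x y)
  negation-sign f-sign x y = trans (lem (f x y)) (f-sign x y)
    where
    lem : ∀ a → - a * - a ≡ a * a
    lem = solve-∀

module _ {N} (f : Fin N → Fin N → ℤ)
  (f-sym : ∀ x y → f x y ≡ f y x) (f-sign : ∀ x y → IsSign (f x y)) where

  open Evaluation f f-sym f-sign
  open Evaluation (λ x y → - f x y) (negation-sym f f-sym) (negation-sign f f-sign)
    using () renaming (values to values⁻; 0≤gram to 0≤gram⁻)

  private
    ∑⁺ ∑⁻ : Poly 21 → ℤ
    ∑⁺ p = ∑ⱽ (λ z → ⟦ p ⟧ (values z))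
    ∑⁻ p = ∑ⱽ (λ z → ⟦ p ⟧ (values⁻ z))

    ∑-parity : ∀ p → ∑⁺ p + ∑⁻ p ≡ + 2 * ∑⁺ (parity true p)
    ∑-parity p = begin
      ∑⁺ p + ∑⁻ p ≡⟨ ∑ⱽ-distrib-+ (λ z → ⟦ p ⟧ (values z)) (λ z → ⟦ p ⟧ (values⁻ z)) ⟨
      ∑ⱽ (λ z → ⟦ p ⟧ (values z) + ⟦ p ⟧ (values⁻ z)) ≡⟨ ∑ⱽ-cong (λ z → cong (λ v → ⟦ p ⟧ (values z) + v)
            (trans (cong ⟦ p ⟧ (map-∘ (λ x → - x) (at z) edges)) (≡.sym (ℤP.*-identityˡ _)))) ⟩
      ∑ⱽ (λ z → ⟦ p ⟧ (values z) + 1ℤ * ⟦ p ⟧ (negated (values z))) ≡⟨ ∑ⱽ-cong (λ z → ⟦parity⟧ true p (values z)) ⟩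
      ∑ⱽ (λ z → + 2 * ⟦ parity true p ⟧ (values z)) ≡⟨ *-distribˡ-∑ⱽ (+ 2) (λ z → ⟦ parity true p ⟧ (values z)) ⟨
      + 2 * ∑⁺ (parity true p) ∎
      where open ≡-Reasoning

  -- The blocks need not be even in f: each is nonnegative at f and at its negative separately. Only
  -- the even part of the remainder survives when the two evaluations are added.
  certified : ∀ k bs p → certifies k bs p ≡ true →
    0ℤ ≤ ∑ⱽ (λ z → ⟦ p ⟧ (values z)) + ∑ⱽ (λ z → ⟦ p ⟧ (values⁻ z))
  certified (suc k) bs p ok = ℤP.*-cancelˡ-≤-pos 0ℤ (∑⁺ p + ∑⁻ p) (+ suc k)
    (subst₂ _≤_ (≡.sym (ℤP.*-zeroʳ (+ suc k))) (≡.sym eq)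
      (0≤+ (0≤* {+ 2} (+≤+ ℕ.z≤n) (even-nonneg f f-sym f-sign)) (0≤+ (0≤gram bs) (0≤gram⁻ bs))))
    where
    q = scale (+ suc k) p
    r = q ⊖ gram bs
    even-nonneg : Nonneg (parity true r)
    even-nonneg = nonneg-canonical (parity true r)
      (nonneg-reduceBy false (residual k bs p)
        (nonneg-reduceBy true (reduceBy false (residual k bs p))
          (nonneg-isZero (reduceBy true (reduceBy false (residual k bs p))) ok)))
    eq : + suc k * (∑⁺ p + ∑⁻ p) ≡ + 2 * ∑⁺ (parity true r) + (∑⁺ (gram bs) + ∑⁻ (gram bs))
    eq = begin
      + suc k * (∑⁺ p + ∑⁻ p)             ≡⟨ ℤP.*-distribˡ-+ (+ suc k) (∑⁺ p) (∑⁻ p) ⟩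
      + suc k * ∑⁺ p + + suc k * ∑⁻ p     ≡⟨ cong₂ _+_ (∑-scale values (+ suc k) p) (∑-scale values⁻ (+ suc k) p) ⟨
      ∑⁺ q + ∑⁻ q                         ≡⟨ cong₂ _+_ (∑-⊖ values q (gram bs)) (∑-⊖ values⁻ q (gram bs)) ⟩
      (∑⁺ r + ∑⁺ (gram bs)) + (∑⁻ r + ∑⁻ (gram bs)) ≡⟨ lem (∑⁺ r) (∑⁺ (gram bs)) (∑⁻ r) (∑⁻ (gram bs)) ⟩
      (∑⁺ r + ∑⁻ r) + (∑⁺ (gram bs) + ∑⁻ (gram bs)) ≡⟨ cong (_+ (∑⁺ (gram bs) + ∑⁻ (gram bs))) (∑-parity r) ⟩
      + 2 * ∑⁺ (parity true r) + (∑⁺ (gram bs) + ∑⁻ (gram bs)) ∎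
      where
      open ≡-Reasoning
      lem : ∀ a b c d → (a + b) + (c + d) ≡ (a + c) + (b + d)
      lem = solve-∀

-- The two inequalities for a base graph

∏1+ : List Edge → Poly 21
∏1+ = foldr (λ e p → p ⊕ mulVar (position e) p) (const 1ℤ)

module _ {n m : ℕ} (eq : n ℕ.+ suc m ≡ 6) where
  -- The base graph takes the first `n` of the six positions and the apex the next one. The other
  -- `m` positions stay isolated and sum out to a factor N^m.
  base : Fin n → Vertex
  base i = cast eq (i ↑ˡ suc m)

  apex : Vertex
  apex = cast eq (n ↑ʳ zero)

  baseEdges : List (Fin n × Fin n) → List Edge
  baseEdges = List.map λ (i , j) → base i , base j

  apexEdges : List Edge
  apexEdges = List.map (λ i → base i , apex) (allFin n)

  -- The integrands of (A) and (B). The constant 1 is subtracted under the sum over the apex, where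
  -- it adds up to the N in D(f) - N.
  edgePoly conePoly : List (Fin n × Fin n) → Poly 21
  edgePoly L = ∏1+ (baseEdges L) ⊖ const 1ℤ
  conePoly L = ∏1+ (baseEdges L) ⊗ (∏1+ apexEdges ⊖ const 1ℤ)

-- The tangent of a power at y. Multiplying the bound for one exponent by x falls short of the next
-- one by exactly (a + 1) y^a (x - y)², which is nonnegative.
bernoulli : ∀ {x y} → 0ℤ ≤ x → 0ℤ ≤ y → ∀ a → y ^ suc a + + suc a * y ^ a * (x - y) ≤ x ^ suc a
bernoulli {x} {y} 0≤x 0≤y zero = ℤP.≤-reflexive (lem x y)
  where
  lem : ∀ x y → y * 1ℤ + 1ℤ * 1ℤ * (x - y) ≡ x * 1ℤ
  lem = solve-∀
bernoulli {x} {y} 0≤x 0≤y (suc a) = ℤP.0≤i-j⇒j≤i (subst (0ℤ ≤_) eq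
  (0≤+ (0≤* 0≤x (ℤP.i≤j⇒0≤j-i (bernoulli 0≤x 0≤y a)))
       (0≤* (0≤* {+ suc a} (+≤+ ℕ.z≤n) (0≤^ a)) (0≤i*i (x - y)))))
  where
  0≤^ : ∀ k → 0ℤ ≤ y ^ k
  0≤^ zero = +≤+ ℕ.z≤n
  0≤^ (suc k) = 0≤* 0≤y (0≤^ k)
  lem : ∀ x y p q k → x * (q - (y * p + k * p * (x - y))) + k * p * ((x - y) * (x - y))
    ≡ x * q - (y * (y * p) + (1ℤ + k) * (y * p) * (x - y))
  lem = solve-∀
  eq : x * (x ^ suc a - (y ^ suc a + + suc a * y ^ a * (x - y))) + + suc a * y ^ a * ((x - y) * (x - y))
    ≡ x ^ suc (suc a) - (y ^ suc (suc a) + + suc (suc a) * y ^ suc a * (x - y))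
  eq = lem x y (y ^ a) (x ^ suc a) (+ suc a)

edgeValue : (Fin N → Fin N → ℤ) → Vec (Fin N) n → Fin n × Fin n → ℤ
edgeValue f z (i , j) = f (lookup z i) (lookup z j)

edgeWeight : (Fin N → Fin N → ℤ) → List (Fin n × Fin n) → Vec (Fin N) n → ℤ
edgeWeight f L z = ∏ L λ e → 1ℤ + edgeValue f z e

coneWeight : (Fin N → Fin N → ℤ) → Vec (Fin N) n → Fin N → ℤ
coneWeight f z u = ∏ (allFin _) λ i → 1ℤ + f (lookup z i) u

codegree : (Fin N → Fin N → ℤ) → Vec (Fin N) n → ℤ
codegree f z = sum (coneWeight f z)

monoSign : (Fin N → Fin N → Bool) → Bool → Fin N → Fin N → ℤ
monoSign c b x y = if ⌊ c x y ≟ᵇ b ⌋ then 1ℤ else -1ℤ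

bothColours : (Fin N → Fin N → Bool) → ((Fin N → Fin N → ℤ) → ℤ) → ℤ
bothColours c F = F (monoSign c true) + F (monoSign c false)

∑ⱽ-subst : ∀ {k} (eq : n ≡ k) (g : Vec (Fin N) k → ℤ) → ∑ⱽ g ≡ ∑ⱽ (g ∘ subst (Vec (Fin N)) eq)
∑ⱽ-subst refl g = refl

lookup-subst : ∀ {k} (eq : n ≡ k) (z : Vec (Fin N) n) i → lookup (subst (Vec (Fin N)) eq z) (cast eq i) ≡ lookup z i
lookup-subst refl z i = cong (lookup z) (FinP.cast-is-id refl i)

module _ {n m} (eq : n ℕ.+ suc m ≡ 6) {N} (f : Fin N → Fin N → ℤ)
  (f-sym : ∀ x y → f x y ≡ f y x) (f-sign : ∀ x y → IsSign (f x y)) where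

  open Evaluation f f-sym f-sign using (values; map-signs; lookup-values)

  private
    extend : Vec (Fin N) n → Fin N → Vec (Fin N) m → Vec (Fin N) 6
    extend z u w = subst (Vec (Fin N)) eq (z ++ u ∷ w)

    ⟦∏1+⟧ : ∀ L z → ⟦ ∏1+ L ⟧ (values z) ≡ ∏ L (λ e → 1ℤ + edgeValue f z e)
    ⟦∏1+⟧ [] z = ⟦const⟧ 1ℤ (values z)
    ⟦∏1+⟧ (e ∷ L) z = begin
      ⟦ ∏1+ L ⊕ mulVar (position e) (∏1+ L) ⟧ (values z)
        ≡⟨ ⟦⊕⟧ (∏1+ L) (mulVar (position e) (∏1+ L)) (values z) ⟩
      P + ⟦ mulVar (position e) (∏1+ L) ⟧ (values z)
        ≡⟨ cong (λ q → P + q) (trans (⟦mulVar⟧ (position e) (∏1+ L) (map-signs z edges)) (cong (_* P) (lookup-values z e))) ⟩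
      P + edgeValue f z e * P
        ≡⟨ lem (edgeValue f z e) P ⟩
      (1ℤ + edgeValue f z e) * P
        ≡⟨ cong ((1ℤ + edgeValue f z e) *_) (⟦∏1+⟧ L z) ⟩
      ∏ (e ∷ L) (λ e → 1ℤ + edgeValue f z e) ∎
      where
      open ≡-Reasoning
      P = ⟦ ∏1+ L ⟧ (values z)
      lem : ∀ a p → p + a * p ≡ (1ℤ + a) * p
      lem = solve-∀

    lookup-base : ∀ z u w i → lookup (extend z u w) (base eq i) ≡ lookup z i
    lookup-base z u w i = trans (lookup-subst eq (z ++ u ∷ w) (i ↑ˡ suc m)) (lookup-++ˡ z (u ∷ w) i)

    lookup-apex : ∀ z u w → lookup (extend z u w) (apex {n} eq) ≡ u
    lookup-apex z u w = trans (lookup-subst eq (z ++ u ∷ w) (n ↑ʳ zero)) (lookup-++ʳ z (u ∷ w) zero)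

    ⟦baseEdges⟧ : ∀ L z u w → ⟦ ∏1+ (baseEdges eq L) ⟧ (values (extend z u w)) ≡ edgeWeight f L z
    ⟦baseEdges⟧ L z u w = trans (⟦∏1+⟧ (baseEdges eq L) (extend z u w)) (trans (∏-map _ L (λ e → 1ℤ + edgeValue f (extend z u w) e))
      (∏-cong L λ (i , j) → cong₂ (λ x y → 1ℤ + f x y) (lookup-base z u w i) (lookup-base z u w j)))

    ⟦apexEdges⟧ : ∀ z u w → ⟦ ∏1+ (apexEdges {n} eq) ⟧ (values (extend z u w)) ≡ coneWeight f z u
    ⟦apexEdges⟧ z u w = trans (⟦∏1+⟧ (apexEdges {n} eq) (extend z u w)) (trans (∏-map _ (allFin n) (λ e → 1ℤ + edgeValue f (extend z u w) e))
      (∏-cong (allFin n) λ i → cong₂ (λ x y → 1ℤ + f x y) (lookup-base z u w i) (lookup-apex z u w)))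

    ∑-extend : (p : Poly 21) (g : Vec (Fin N) n → Fin N → ℤ) →
      (∀ z u w → ⟦ p ⟧ (values (extend z u w)) ≡ g z u) →
      ∑ⱽ (λ z → ⟦ p ⟧ (values z)) ≡ (+ N) ^ m * ∑ⱽ (λ z → sum (g z))
    ∑-extend p g p≗g = begin
      ∑ⱽ (λ z → ⟦ p ⟧ (values z))
        ≡⟨ trans (∑ⱽ-subst eq (λ z → ⟦ p ⟧ (values z))) (∑ⱽ-++ n _) ⟩
      ∑ⱽ (λ z → sum λ u → ∑ⱽ λ w → ⟦ p ⟧ (values (extend z u w)))
        ≡⟨ ∑ⱽ-cong (λ z → sum-cong-≗ λ u → trans (∑ⱽ-cong λ w → p≗g z u w) (∑ⱽ-const {N} {m} (g z u))) ⟩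
      ∑ⱽ (λ z → sum λ u → (+ N) ^ m * g z u)
        ≡⟨ ∑ⱽ-cong (λ z → *-distribˡ-sum ((+ N) ^ m) (g z)) ⟨
      ∑ⱽ (λ z → (+ N) ^ m * sum (g z))
        ≡⟨ *-distribˡ-∑ⱽ ((+ N) ^ m) (λ z → sum (g z)) ⟨
      (+ N) ^ m * ∑ⱽ (λ z → sum (g z)) ∎
      where open ≡-Reasoning

  -- No edge meets the apex here, so its position is summed out as well and the exponent is `suc m`.
  ∑-edgePoly : ∀ L → ∑ⱽ (λ z → ⟦ edgePoly eq L ⟧ (values z)) ≡ (+ N) ^ suc m * ∑ⱽ (λ z → edgeWeight f L z - 1ℤ)
  ∑-edgePoly L = trans (∑-extend (edgePoly eq L) (λ z _ → edgeWeight f L z - 1ℤ) λ z u w →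
      trans (⟦⊖⟧ (∏1+ (baseEdges eq L)) (const 1ℤ) (values (extend z u w)))
        (cong₂ _-_ (⟦baseEdges⟧ L z u w) (⟦const⟧ 1ℤ (values (extend z u w)))))
    (begin
      (+ N) ^ m * ∑ⱽ (λ z → sum {N} λ _ → edgeWeight f L z - 1ℤ)
        ≡⟨ cong ((+ N) ^ m *_) (trans (∑ⱽ-cong λ z → sum-const {N} (edgeWeight f L z - 1ℤ))
             (≡.sym (*-distribˡ-∑ⱽ (+ N) (λ z → edgeWeight f L z - 1ℤ)))) ⟩
      (+ N) ^ m * (+ N * S)     ≡⟨ lem ((+ N) ^ m) (+ N) S ⟩
      (+ N) ^ suc m * S         ∎)
    where
    open ≡-Reasoning
    S = ∑ⱽ (λ z → edgeWeight f L z - 1ℤ)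
    lem : ∀ p q s → p * (q * s) ≡ q * p * s
    lem = solve-∀

  ∑-conePoly : ∀ L → ∑ⱽ (λ z → ⟦ conePoly eq L ⟧ (values z))
    ≡ (+ N) ^ m * ∑ⱽ (λ z → edgeWeight f L z * (codegree f z - + N))
  ∑-conePoly L = trans (∑-extend (conePoly eq L) (λ z u → edgeWeight f L z * (coneWeight f z u - 1ℤ)) λ z u w →
      trans (⟦⊗⟧ (∏1+ (baseEdges eq L)) (∏1+ (apexEdges {n} eq) ⊖ const 1ℤ) (map-signs (extend z u w) edges))
        (cong₂ _*_ (⟦baseEdges⟧ L z u w)
          (trans (⟦⊖⟧ (∏1+ (apexEdges {n} eq)) (const 1ℤ) (values (extend z u w)))
            (cong₂ _-_ (⟦apexEdges⟧ z u w) (⟦const⟧ 1ℤ (values (extend z u w)))))))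
    (cong ((+ N) ^ m *_) (∑ⱽ-cong λ z → trans (≡.sym (*-distribˡ-sum (edgeWeight f L z) (λ u → coneWeight f z u - 1ℤ)))
      (cong (edgeWeight f L z *_) (trans (∑-distrib-+ (coneWeight f z) (λ _ → - 1ℤ))
        (cong (λ s → codegree f z + s) (trans (sum-const {N} (- 1ℤ)) (lem (+ N))))))))
    where
    lem : ∀ k → k * - 1ℤ ≡ - k
    lem = solve-∀

module _ (c : Fin N → Fin N → Bool) where
  monoSign-sign : ∀ b x y → IsSign (monoSign c b x y)
  monoSign-sign b x y with ⌊ c x y ≟ᵇ b ⌋
  ... | true = refl
  ... | false = refl

  monoSign-neg : ∀ x y → - monoSign c true x y ≡ monoSign c false x y
  monoSign-neg x y with c x y
  ... | true = refl
  ... | false = refl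

  0≤1+monoSign : ∀ b x y → 0ℤ ≤ 1ℤ + monoSign c b x y
  0≤1+monoSign b x y with ⌊ c x y ≟ᵇ b ⌋
  ... | true = +≤+ ℕ.z≤n
  ... | false = +≤+ ℕ.z≤n

0≤∏ : ∀ {C : Set} (xs : List C) {g : C → ℤ} → (∀ x → 0ℤ ≤ g x) → 0ℤ ≤ ∏ xs g
0≤∏ [] 0≤g = +≤+ ℕ.z≤n
0≤∏ (x ∷ xs) 0≤g = 0≤* (0≤g x) (0≤∏ xs 0≤g)

0≤+N^ : ∀ N k → 0ℤ ≤ (+ N) ^ k
0≤+N^ N zero = +≤+ ℕ.z≤n
0≤+N^ N (suc k) = 0≤* {+ N} (+≤+ ℕ.z≤n) (0≤+N^ N k)

0<+N^ : ∀ N k → Positive ((+ suc N) ^ k)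
0<+N^ N zero = _
0<+N^ N (suc k) with (+ suc N) ^ k | 0<+N^ N k
... | + suc _ | _ = _

record Certified (n : ℕ) (L : List (Fin n × Fin n)) : Set where
  field
    {spare} : ℕ
    eq : n ℕ.+ suc spare ≡ 6
    edgeScale coneScale : ℕ
    edgeBlocks coneBlocks : List Block
    edgeOk : certifies edgeScale edgeBlocks (edgePoly eq L) ≡ true
    coneOk : certifies coneScale coneBlocks (conePoly eq L) ≡ true

module _ {L : List (Fin n × Fin n)} (cert : Certified n L)
  (c : Fin (suc N) → Fin (suc N) → Bool) (c-sym : ∀ x y → c x y ≡ c y x) where
  open Certified cert

  private
    f = monoSign c true
    f-sym : ∀ b x y → monoSign c b x y ≡ monoSign c b y x
    f-sym b x y = cong (λ a → if ⌊ a ≟ᵇ b ⌋ then 1ℤ else -1ℤ) (c-sym x y)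
    X = + suc N

    -- A certificate speaks about f and its negative, which are the sign matrices of the two
    -- colours; `T-cong` makes this exchange. Cancelling the power of N contributed by the isolated
    -- positions requires a nonempty vertex set, hence `suc N`.
    bound : ∀ (p : Poly 21) k (T : (Fin (suc N) → Fin (suc N) → ℤ) → ℤ) →
      (∀ g g-sym g-sign → ∑ⱽ (λ z → ⟦ p ⟧ (Evaluation.values g g-sym g-sign z)) ≡ X ^ k * T g) →
      (∀ {g h} → (∀ x y → g x y ≡ h x y) → T g ≡ T h) →
      ∀ M bs → certifies M bs p ≡ true → 0ℤ ≤ bothColours c T
    bound p k T T-eq T-cong M bs ok = ℤP.*-cancelˡ-≤-pos 0ℤ (bothColours c T) (X ^ k) {{0<+N^ N k}}
      (subst₂ _≤_ (≡.sym (ℤP.*-zeroʳ (X ^ k))) (trans (cong₂ _+_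
          (T-eq f (f-sym true) (monoSign-sign c true))
          (T-eq (λ x y → - f x y) (negation-sym f (f-sym true)) (negation-sign f (monoSign-sign c true))))
        (trans (≡.sym (ℤP.*-distribˡ-+ (X ^ k) _ _)) (cong (λ t → X ^ k * (T f + t)) (T-cong (monoSign-neg c)))))
        (certified f (f-sym true) (monoSign-sign c true) M bs p ok))

  edgeWeight-cong : ∀ {g h : Fin (suc N) → Fin (suc N) → ℤ} → (∀ x y → g x y ≡ h x y) →
    ∀ z → edgeWeight g L z ≡ edgeWeight h L z
  edgeWeight-cong g≗h z = ∏-cong L λ (i , j) → cong (λ t → 1ℤ + t) (g≗h (lookup z i) (lookup z j))

  codegree-cong : ∀ {g h : Fin (suc N) → Fin (suc N) → ℤ} → (∀ x y → g x y ≡ h x y) →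
    ∀ (z : Vec _ n) → codegree g z ≡ codegree h z
  codegree-cong g≗h z = sum-cong-≗ λ u → ∏-cong (allFin n) λ i → cong (λ t → 1ℤ + t) (g≗h (lookup z i) u)

  edgeBound : 0ℤ ≤ bothColours c λ g → ∑ⱽ (λ z → edgeWeight g L z - 1ℤ)
  edgeBound = bound (edgePoly eq L) (suc spare) _ (λ g s t → ∑-edgePoly eq g s t L)
    (λ g≗h → ∑ⱽ-cong λ z → cong (_- 1ℤ) (edgeWeight-cong g≗h z)) edgeScale edgeBlocks edgeOk

  coneBound : 0ℤ ≤ bothColours c λ g → ∑ⱽ (λ z → edgeWeight g L z * (codegree g z - X))
  coneBound = bound (conePoly eq L) spare _ (λ g s t → ∑-conePoly eq g s t L)
    (λ g≗h → ∑ⱽ-cong λ z → cong₂ (λ e d → e * (d - X)) (edgeWeight-cong g≗h z) (codegree-cong g≗h z))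
    coneScale coneBlocks coneOk

  multiconeBound : ∀ a → + 2 * X ^ (n ℕ.+ suc a) ≤ bothColours c λ g → ∑ⱽ λ z → edgeWeight g L z * codegree g z ^ suc a
  multiconeBound a = ℤP.≤-trans (ℤP.0≤i-j⇒j≤i (subst (0ℤ ≤_) eq₂
      (0≤+ (0≤* (0≤+N^ (suc N) (suc a)) edgeBound) (0≤* (0≤* {+ suc a} (+≤+ ℕ.z≤n) (0≤+N^ (suc N) a)) coneBound))))
    (ℤP.+-mono-≤ (colourwise true) (colourwise false))
    where
    E D : Bool → Vec (Fin (suc N)) n → ℤ
    E b z = edgeWeight (monoSign c b) L z
    D b z = codegree (monoSign c b) z
    -- E is written as (E - 1) + 1: the first part is what (A) controls, and the 1 produces the main
    -- term N^(n+a+1) of each colour.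
    lower : Bool → Vec (Fin (suc N)) n → ℤ
    lower b z = X ^ suc a * (E b z - 1ℤ) + (+ suc a * X ^ a * (E b z * (D b z - X)) + X ^ suc a)
    0≤E : ∀ b z → 0ℤ ≤ E b z
    0≤E b z = 0≤∏ L λ (i , j) → 0≤1+monoSign c b (lookup z i) (lookup z j)
    0≤D : ∀ b z → 0ℤ ≤ D b z
    0≤D b z = subst (_≤ D b z) (trans (sum-const {suc N} 0ℤ) (ℤP.*-zeroʳ X))
      (sum-mono λ u → 0≤∏ (allFin n) λ i → 0≤1+monoSign c b (lookup z i) u)
    colourwise : ∀ b → ∑ⱽ (lower b) ≤ ∑ⱽ (λ z → E b z * D b z ^ suc a)
    colourwise b = ∑ⱽ-mono λ z → ℤP.0≤i-j⇒j≤i (subst (0ℤ ≤_)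
        (lem (E b z) (D b z ^ suc a) (D b z) (X ^ suc a) X (+ suc a * X ^ a))
        (0≤* (0≤E b z) (ℤP.i≤j⇒0≤j-i (bernoulli {D b z} {X} (0≤D b z) (+≤+ ℕ.z≤n) a))))
      where
      lem : ∀ e q d p x k → e * (q - (p + k * (d - x))) ≡ e * q - (p * (e - 1ℤ) + (k * (e * (d - x)) + p))
      lem = solve-∀
    ∑lower : ∀ b → ∑ⱽ (lower b) ≡ X ^ suc a * ∑ⱽ (λ z → E b z - 1ℤ)
      + (+ suc a * X ^ a * ∑ⱽ (λ z → E b z * (D b z - X)) + X ^ n * X ^ suc a)
    ∑lower b = trans (∑ⱽ-distrib-+ (λ z → X ^ suc a * (E b z - 1ℤ)) _) (cong₂ _+_
      (≡.sym (*-distribˡ-∑ⱽ (X ^ suc a) (λ z → E b z - 1ℤ)))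
      (trans (∑ⱽ-distrib-+ (λ z → + suc a * X ^ a * (E b z * (D b z - X))) _) (cong₂ _+_
        (≡.sym (*-distribˡ-∑ⱽ (+ suc a * X ^ a) (λ z → E b z * (D b z - X))))
        (∑ⱽ-const {suc N} {n} (X ^ suc a)))))
    eq₂ : X ^ suc a * (∑ⱽ (λ z → E true z - 1ℤ) + ∑ⱽ (λ z → E false z - 1ℤ))
        + + suc a * X ^ a * (∑ⱽ (λ z → E true z * (D true z - X)) + ∑ⱽ (λ z → E false z * (D false z - X)))
        ≡ (∑ⱽ (lower true) + ∑ⱽ (lower false)) - + 2 * X ^ (n ℕ.+ suc a)
    eq₂ = trans (lem (X ^ suc a) (∑ⱽ λ z → E true z - 1ℤ) (∑ⱽ λ z → E false z - 1ℤ) (+ suc a * X ^ a)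
              (∑ⱽ λ z → E true z * (D true z - X)) (∑ⱽ λ z → E false z * (D false z - X)) (X ^ n * X ^ suc a))
            (cong₂ (λ s p → s - + 2 * p) (≡.sym (cong₂ _+_ (∑lower true) (∑lower false))) (≡.sym (ℤP.^-distribˡ-+-* X n (suc a))))
      where
      lem : ∀ p s t k u v q → p * (s + t) + k * (u + v) ≡ ((p * s + (k * u + q)) + (p * t + (k * v + q))) - + 2 * q
      lem = solve-∀

-- Homomorphism counts and edge counts

∏ⱽ : (A → ℤ) → Vec A n → ℤ
∏ⱽ h [] = 1ℤ
∏ⱽ h (x ∷ z) = h x * ∏ⱽ h z

∏ⱽ-swap : ∀ (h : A → ℤ) k (z : Vec A n) → ∏ⱽ h (swap k z) ≡ ∏ⱽ h z
∏ⱽ-swap h k [] = refl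
∏ⱽ-swap h k (x ∷ []) = refl
∏ⱽ-swap h zero (x ∷ y ∷ z) = lem (h x) (h y) (∏ⱽ h z)
  where
  lem : ∀ a b c → b * (a * c) ≡ a * (b * c)
  lem = solve-∀
∏ⱽ-swap h (suc k) (x ∷ y ∷ z) = cong (h x *_) (∏ⱽ-swap h k (y ∷ z))

∏ⱽ-permute : ∀ (h : A → ℤ) ks (z : Vec A n) → ∏ⱽ h (permute ks z) ≡ ∏ⱽ h z
∏ⱽ-permute h [] z = refl
∏ⱽ-permute h (k ∷ ks) z = trans (∏ⱽ-swap h k (permute ks z)) (∏ⱽ-permute h ks z)

∏-tabulate : ∀ (ι : Fin n → A) (g : A → ℤ) → ∏ (tabulate ι) g ≡ ∏ (allFin n) (g ∘ ι)
∏-tabulate {zero} ι g = refl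
∏-tabulate {suc n} ι g = cong (g (ι zero) *_)
  (trans (∏-tabulate (ι ∘ suc) g) (≡.sym (∏-tabulate suc (g ∘ ι))))

∏-allFin : ∀ (h : A → ℤ) (z : Vec A n) → ∏ (allFin n) (h ∘ lookup z) ≡ ∏ⱽ h z
∏-allFin h [] = refl
∏-allFin h (x ∷ z) = cong (h x *_) (trans (∏-tabulate suc (h ∘ lookup (x ∷ z))) (∏-allFin h z))

-- The new vertices are pairwise nonadjacent and range independently, which is why `a` of them
-- contribute the a-th power of the codegree.
power-sum : ∀ (g : Fin N → ℤ) a → sum g ^ a ≡ ∑ⱽ {n = a} (∏ⱽ g)
power-sum g zero = refl
power-sum g (suc a) = begin
  sum g * sum g ^ a                          ≡⟨ cong (sum g *_) (power-sum g a) ⟩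
  sum g * ∑ⱽ {n = a} (∏ⱽ g)                  ≡⟨ *-distribʳ-sum (∑ⱽ {n = a} (∏ⱽ g)) g ⟩
  (sum λ x → g x * ∑ⱽ {n = a} (∏ⱽ g))        ≡⟨ sum-cong-≗ (λ x → *-distribˡ-∑ⱽ {n = a} (g x) (∏ⱽ g)) ⟩
  ∑ⱽ {n = suc a} (∏ⱽ g)                      ∎
  where open ≡-Reasoning

module _ (f : Fin N → Fin N → ℤ) where
  -- The codegree multiplies over all coordinates of z and is invariant under permuting them, so
  -- moving the edges of L amounts to permuting the summation variables.
  ∑-relabel : ∀ ks (L : List (Fin n × Fin n)) a →
    ∑ⱽ (λ z → edgeWeight f (relabel ks L) z * codegree f z ^ a) ≡ ∑ⱽ (λ z → edgeWeight f L z * codegree f z ^ a)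
  ∑-relabel {n} ks L a = trans
    (∑ⱽ-cong λ z → cong₂ (λ e d → e * d ^ a)
      (trans (∏-map _ L (λ e → 1ℤ + edgeValue f z e)) (∏-cong L λ (i , j) →
        cong₂ (λ x y → 1ℤ + f x y) (lookup-permute ks z i) (lookup-permute ks z j)))
      (sum-cong-≗ λ u → trans (∏-allFin (λ x → 1ℤ + f x u) z)
        (trans (≡.sym (∏ⱽ-permute (λ x → 1ℤ + f x u) ks z)) (≡.sym (∏-allFin (λ x → 1ℤ + f x u) (permute ks z))))))
    (∑ⱽ-permute ks (λ z → edgeWeight f L z * codegree f z ^ a))

indicator : Bool → ℤ
indicator b = if b then 1ℤ else 0ℤ

0≤indicator : ∀ b → 0ℤ ≤ indicator b
0≤indicator true = +≤+ ℕ.z≤n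
0≤indicator false = +≤+ ℕ.z≤n

indicator-∧ : ∀ a b → indicator a * indicator b ≡ indicator (a ∧ b)
indicator-∧ true b = ℤP.*-identityˡ (indicator b)
indicator-∧ false b = refl

indicator-mono : ∀ {a b} → (a ≡ true → b ≡ true) → indicator a ≤ indicator b
indicator-mono {false} a⇒b = 0≤indicator _
indicator-mono {true} a⇒b rewrite a⇒b refl = ℤP.≤-refl

∧-true : ∀ {a b} → a ∧ b ≡ true → a ≡ true × b ≡ true
∧-true {true} eq = refl , eq

and-map⁺ : ∀ (p : A → Bool) xs → (∀ x → p x ≡ true) → all p xs ≡ true
and-map⁺ p [] p≡true = refl
and-map⁺ p (x ∷ xs) p≡true rewrite p≡true x = and-map⁺ p xs p≡true

all-∈ : ∀ (p : A → Bool) {x xs} → all p xs ≡ true → x ∈ xs → p x ≡ true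
all-∈ p eq (here refl) = proj₁ (∧-true eq)
all-∈ p eq (there x∈xs) = all-∈ p (proj₂ (∧-true eq)) x∈xs

∏-indicator : ∀ c (p : A → Bool) xs → ∏ xs (λ x → c * indicator (p x)) ≡ c ^ length xs * indicator (all p xs)
∏-indicator c p [] = refl
∏-indicator c p (x ∷ xs) = begin
  c * indicator (p x) * ∏ xs (λ x → c * indicator (p x))                 ≡⟨ cong (c * indicator (p x) *_) (∏-indicator c p xs) ⟩
  c * indicator (p x) * (c ^ length xs * indicator (all p xs))           ≡⟨ lem c (indicator (p x)) (c ^ length xs) _ ⟩
  c * c ^ length xs * (indicator (p x) * indicator (all p xs))           ≡⟨ cong (c * c ^ length xs *_) (indicator-∧ (p x) (all p xs)) ⟩
  c ^ length (x ∷ xs) * indicator (all p (x ∷ xs))                       ∎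
  where
  open ≡-Reasoning
  lem : ∀ c i k j → c * i * (k * j) ≡ c * k * (i * j)
  lem = solve-∀

-- One inclusion is enough to infer a monochromatic copy from agreement on `L`; the power of 2 is
-- controlled separately, by comparing the length of `L` with the edge count.
Covers : List (Fin n × Fin n) → (Fin n → Fin n → Bool) → Set
Covers L A = ∀ i j → A i j ≡ true → (i , j) ∈ L ⊎ (j , i) ∈ L

homCount : ∀ {v} → Graph v → (N : ℕ) → (Fin N → Fin N → Bool) → Bool → ℤ
homCount {v} F N c b = ∑ⱽ {N} {v} λ φ → indicator (monoᵇ F c b φ)

module _ (c : Fin N → Fin N → Bool) (c-sym : ∀ x y → c x y ≡ c y x) (b : Bool) where
  private
    agree : Fin N → Fin N → Bool
    agree x y = ⌊ c x y ≟ᵇ b ⌋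

    agree-sym : ∀ x y → agree x y ≡ agree y x
    agree-sym x y = cong (λ a → ⌊ a ≟ᵇ b ⌋) (c-sym x y)

    1+monoSign : ∀ x y → 1ℤ + monoSign c b x y ≡ + 2 * indicator (agree x y)
    1+monoSign x y with agree x y
    ... | true = refl
    ... | false = refl

    edgesAgree : List (Fin n × Fin n) → Vec (Fin N) n → Bool
    edgesAgree L z = all (λ (i , j) → agree (lookup z i) (lookup z j)) L

    coneAgree : Vec (Fin N) n → Fin N → Bool
    coneAgree z u = all (λ i → agree (lookup z i) u) (allFin _)

    multiconeAgree : ∀ {a} → Vec (Fin N) n → Vec (Fin N) a → Bool
    multiconeAgree z w = all (coneAgree z ∘ lookup w) (allFin _)

  monoᵇ-cone : ∀ {a} (H : Graph n) {L} → Covers L (adj H) → ∀ z (w : Vec (Fin N) a) →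
    edgesAgree L z ∧ multiconeAgree z w ≡ true → monoᵇ ((H ⁺) a) c b (z ++ w) ≡ true
  monoᵇ-cone {n} {a} H {L} cov z w ok =
    and-map⁺ _ (allFin (n ℕ.+ a)) λ x → and-map⁺ _ (allFin (n ℕ.+ a)) λ y → agrees x y
    where
    cone : ∀ i k → agree (lookup z i) (lookup w k) ≡ true
    cone i k = all-∈ (λ i → agree (lookup z i) (lookup w k))
      (all-∈ (coneAgree z ∘ lookup w) (proj₂ (∧-true ok)) (∈-allFin k)) (∈-allFin i)
    edge : ∀ {e} → e ∈ L → agree (lookup z (proj₁ e)) (lookup z (proj₂ e)) ≡ true
    edge = all-∈ (λ (i , j) → agree (lookup z i) (lookup z j)) (proj₁ (∧-true ok))
    agrees : ∀ x y → not (plusAdj a H x y) ∨ agree (lookup (z ++ w) x) (lookup (z ++ w) y) ≡ true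
    agrees x y rewrite lookup-splitAt n z w x | lookup-splitAt n z w y with splitAt n x | splitAt n y
    ... | inj₂ k | inj₂ l = refl
    ... | inj₁ i | inj₂ l = cone i l
    ... | inj₂ k | inj₁ j = trans (agree-sym (lookup w k) (lookup z j)) (cone j k)
    ... | inj₁ i | inj₁ j with adj H i j in eq
    ...   | false = refl
    ...   | true with cov i j eq
    ...     | inj₁ ij∈L = edge ij∈L
    ...     | inj₂ ji∈L = trans (agree-sym (lookup z i) (lookup z j)) (edge ji∈L)

  -- Each factor 1 + f is twice an indicator. The product therefore equals a power of 2 when all
  -- listed and all cone edges have colour `b`, and 0 otherwise.
  multicone≤homCount : ∀ a (H : Graph n) {L} → Covers L (adj H) →
    ∑ⱽ (λ z → edgeWeight (monoSign c b) L z * codegree (monoSign c b) z ^ a)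
      ≤ (+ 2) ^ (length L ℕ.+ n ℕ.* a) * homCount ((H ⁺) a) N c b
  multicone≤homCount {n} a H {L} cov = begin
    ∑ⱽ (λ z → edgeWeight f L z * codegree f z ^ a)
      ≡⟨ ∑ⱽ-cong (λ z → trans (cong (edgeWeight f L z *_) (power-sum (coneWeight f z) a))
           (*-distribˡ-∑ⱽ {n = a} (edgeWeight f L z) (∏ⱽ (coneWeight f z)))) ⟩
    ∑ⱽ (λ z → ∑ⱽ {n = a} λ w → edgeWeight f L z * ∏ⱽ (coneWeight f z) w)
      ≤⟨ ∑ⱽ-mono (λ z → ∑ⱽ-mono {n = a} λ w → bound z w) ⟩
    ∑ⱽ (λ z → ∑ⱽ {n = a} λ w → P * indicator (monoᵇ ((H ⁺) a) c b (z ++ w)))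
      ≡⟨ ∑ⱽ-++ n (λ φ → P * indicator (monoᵇ ((H ⁺) a) c b φ)) ⟨
    ∑ⱽ (λ φ → P * indicator (monoᵇ ((H ⁺) a) c b φ))
      ≡⟨ *-distribˡ-∑ⱽ P (λ φ → indicator (monoᵇ ((H ⁺) a) c b φ)) ⟨
    P * homCount ((H ⁺) a) N c b ∎
    where
    open ℤP.≤-Reasoning
    f = monoSign c b
    P = (+ 2) ^ (length L ℕ.+ n ℕ.* a)
    cone-eq : ∀ z u → coneWeight f z u ≡ (+ 2) ^ n * indicator (coneAgree z u)
    cone-eq z u = trans (∏-cong (allFin n) λ i → 1+monoSign (lookup z i) u)
      (trans (∏-indicator (+ 2) (λ i → agree (lookup z i) u) (allFin n))
        (cong (λ k → (+ 2) ^ k * indicator (coneAgree z u)) (ListP.length-tabulate {n = n} id)))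
    eq : ∀ z (w : Vec (Fin N) a) → edgeWeight f L z * ∏ⱽ (coneWeight f z) w
       ≡ P * indicator (edgesAgree L z ∧ multiconeAgree z w)
    eq z w = R.begin
      edgeWeight f L z * ∏ⱽ (coneWeight f z) w
        R.≡⟨ cong₂ _*_
          (trans (∏-cong L λ (i , j) → 1+monoSign (lookup z i) (lookup z j))
            (∏-indicator (+ 2) (λ (i , j) → agree (lookup z i) (lookup z j)) L))
          (trans (≡.sym (∏-allFin (coneWeight f z) w)) (trans (∏-cong (allFin a) λ k → cone-eq z (lookup w k))
            (trans (∏-indicator ((+ 2) ^ n) (coneAgree z ∘ lookup w) (allFin a))
              (cong (λ k → ((+ 2) ^ n) ^ k * indicator (multiconeAgree z w)) (ListP.length-tabulate {n = a} id))))) ⟩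
      (+ 2) ^ length L * indicator (edgesAgree L z) * (((+ 2) ^ n) ^ a * indicator (multiconeAgree z w))
        R.≡⟨ lem ((+ 2) ^ length L) _ (((+ 2) ^ n) ^ a) _ ⟩
      (+ 2) ^ length L * ((+ 2) ^ n) ^ a * (indicator (edgesAgree L z) * indicator (multiconeAgree z w))
        R.≡⟨ cong₂ _*_
          (trans (cong ((+ 2) ^ length L *_) (ℤP.^-*-assoc (+ 2) n a)) (≡.sym (ℤP.^-distribˡ-+-* (+ 2) (length L) (n ℕ.* a))))
          (indicator-∧ (edgesAgree L z) (multiconeAgree z w)) ⟩
      P * indicator (edgesAgree L z ∧ multiconeAgree z w) R.∎
      where
      module R = ≡-Reasoning
      lem : ∀ p i q j → p * i * (q * j) ≡ p * q * (i * j)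
      lem = solve-∀
    bound : ∀ z (w : Vec (Fin N) a) → edgeWeight f L z * ∏ⱽ (coneWeight f z) w
          ≤ P * indicator (monoᵇ ((H ⁺) a) c b (z ++ w))
    bound z w = subst (_≤ P * indicator (monoᵇ ((H ⁺) a) c b (z ++ w))) (≡.sym (eq z w))
      (ℤP.*-monoˡ-≤-nonNeg P {{ℤ.nonNegative (0≤+N^ 2 (length L ℕ.+ n ℕ.* a))}}
        (indicator-mono (monoᵇ-cone H cov z w)))

-- Counting in lists by sums of indicators

count : (A → Bool) → List A → ℤ
count p xs = + length (filter (λ x → p x ≟ᵇ true) xs)

count-++ : ∀ (p : A → Bool) xs ys → count p (xs List.++ ys) ≡ count p xs + count p ys
count-++ p xs ys = cong +_ (trans (cong length (ListP.filter-++ _ xs ys)) (ListP.length-++ (filter _ xs)))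

count-∷ : ∀ (p : A → Bool) x xs → count p (x ∷ xs) ≡ indicator (p x) + count p xs
count-∷ p x xs with p x
... | true = refl
... | false = ≡.sym (ℤP.+-identityˡ _)

count-map : ∀ {J : Set} (p : A → Bool) (h : J → A) xs → count p (List.map h xs) ≡ count (p ∘ h) xs
count-map p h [] = refl
count-map p h (x ∷ xs) = trans (count-∷ p (h x) (List.map h xs))
  (trans (cong (λ k → indicator (p (h x)) + k) (count-map p h xs)) (≡.sym (count-∷ (p ∘ h) x xs)))

count-concatMap : ∀ {J : Set} (p : A → Bool) (h : J → List A) (ι : Fin n → J) →
  count p (concatMap h (tabulate ι)) ≡ sum λ i → count p (h (ι i))
count-concatMap {n = zero} p h ι = refl
count-concatMap {n = suc n} p h ι = trans (count-++ p (h (ι zero)) _)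
  (cong (λ k → count p (h (ι zero)) + k) (count-concatMap p h (ι ∘ suc)))

count-tabulate : ∀ (p : A → Bool) (ι : Fin n → A) → count p (tabulate ι) ≡ sum λ i → indicator (p (ι i))
count-tabulate {n = zero} p ι = refl
count-tabulate {n = suc n} p ι = trans (count-∷ p (ι zero) _) (cong (λ k → indicator (p (ι zero)) + k) (count-tabulate p (ι ∘ suc)))

count-allMaps : ∀ v N (p : Vec (Fin N) v → Bool) → count p (allMaps v N) ≡ ∑ⱽ (indicator ∘ p)
count-allMaps zero N p = trans (count-∷ p [] []) (ℤP.+-identityʳ _)
count-allMaps (suc v) N p = trans (count-concatMap p (λ x → List.map (x ∷_) (allMaps v N)) id)
  (sum-cong-≗ λ x → trans (count-map p (x ∷_) (allMaps v N)) (count-allMaps v N (p ∘ (x ∷_))))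

edgeCount-sum : ∀ (G : Graph n) → + edgeCount G ≡ sum λ i → sum λ j → indicator (⌊ i <? j ⌋ ∧ adj G i j)
edgeCount-sum {n} G = trans (count-concatMap {n = n} isEdge (λ i → List.map (λ j → i , j) (allFin n)) id)
  (sum-cong-≗ λ i → trans (count-map isEdge (λ j → i , j) (allFin n)) (count-tabulate (λ j → isEdge (i , j)) id))
  where
  isEdge : Fin n × Fin n → Bool
  isEdge (i , j) = ⌊ i <? j ⌋ ∧ adj G i j

sum-++ : ∀ n (g : Fin (n ℕ.+ m) → ℤ) → sum g ≡ (sum λ i → g (i ↑ˡ m)) + (sum λ k → g (n ↑ʳ k))
sum-++ zero g = ≡.sym (ℤP.+-identityˡ _)
sum-++ (suc n) g = trans (cong (λ s → g zero + s) (sum-++ n (g ∘ suc))) (≡.sym (ℤP.+-assoc (g zero) _ _))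

0≤sum : {g : Fin n → ℤ} → (∀ i → 0ℤ ≤ g i) → 0ℤ ≤ sum g
0≤sum {zero} 0≤g = ℤP.≤-refl
0≤sum {suc n} 0≤g = 0≤+ (0≤g zero) (0≤sum (0≤g ∘ suc))

-- Base vertices precede the new ones, so each cross edge is seen from its base end, and the rows of
-- new vertices may be dropped. A lower bound suffices because the edge count only enters as an
-- exponent of 2 on the larger side.
edgeCount-cone : ∀ a (H : Graph n) → edgeCount H ℕ.+ n ℕ.* a ℕ.≤ edgeCount ((H ⁺) a)
edgeCount-cone {n} a H = ℤP.drop‿+≤+ (begin
  + (edgeCount H ℕ.+ n ℕ.* a)
    ≡⟨ cong₂ _+_ (edgeCount-sum H) (ℤP.pos-* n a) ⟩
  sum (λ i → sum λ j → h i j) + + n * + a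
    ≡⟨ cong (λ s → sum (λ i → sum λ j → h i j) + s) (sum-const {n} (+ a)) ⟨
  sum (λ i → sum λ j → h i j) + sum {n} (λ _ → + a)
    ≡⟨ ∑-distrib-+ (λ i → sum λ j → h i j) (λ _ → + a) ⟨
  sum (λ i → sum (λ j → h i j) + + a)
    ≡⟨ sum-cong-≗ (λ i → cong₂ _+_ (sum-cong-≗ λ j → base-eq i j) (cross i)) ⟨
  sum (λ i → sum (λ j → g (i ↑ˡ a) (j ↑ˡ a)) + sum (λ k → g (i ↑ˡ a) (n ↑ʳ k)))
    ≡⟨ sum-cong-≗ (λ i → sum-++ n (g (i ↑ˡ a))) ⟨
  sum (λ i → sum (g (i ↑ˡ a)))
    ≡⟨ ℤP.+-identityʳ S₁ ⟨
  S₁ + 0ℤ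
    ≤⟨ ℤP.+-monoʳ-≤ S₁ (0≤sum λ k → 0≤sum λ y → 0≤indicator (⌊ (n ↑ʳ k) <? y ⌋ ∧ plusAdj a H (n ↑ʳ k) y)) ⟩
  S₁ + S₂
    ≡⟨ sum-++ n (λ x → sum (g x)) ⟨
  sum (λ x → sum (g x))
    ≡⟨ edgeCount-sum ((H ⁺) a) ⟨
  + edgeCount ((H ⁺) a) ∎)
  where
  open ℤP.≤-Reasoning
  h : Fin n → Fin n → ℤ
  h i j = indicator (⌊ i <? j ⌋ ∧ adj H i j)
  g : Fin (n ℕ.+ a) → Fin (n ℕ.+ a) → ℤ
  g x y = indicator (⌊ x <? y ⌋ ∧ plusAdj a H x y)
  S₁ S₂ : ℤ
  S₁ = sum λ i → sum (g (i ↑ˡ a))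
  S₂ = sum λ k → sum (g (n ↑ʳ k))
  base-eq : ∀ i j → g (i ↑ˡ a) (j ↑ˡ a) ≡ h i j
  base-eq i j = cong₂ (λ p q → indicator (p ∧ q))
    (cong₂ (λ s t → ⌊ suc s ℕ.≤? t ⌋) (FinP.toℕ-↑ˡ i a) (FinP.toℕ-↑ˡ j a)) adj-eq
    where
    adj-eq : plusAdj a H (i ↑ˡ a) (j ↑ˡ a) ≡ adj H i j
    adj-eq rewrite FinP.splitAt-↑ˡ n i a | FinP.splitAt-↑ˡ n j a = refl
  cross-eq : ∀ i k → g (i ↑ˡ a) (n ↑ʳ k) ≡ 1ℤ
  cross-eq i k = cong₂ (λ p q → indicator (p ∧ q)) lt adj-eq
    where
    adj-eq : plusAdj a H (i ↑ˡ a) (n ↑ʳ k) ≡ true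
    adj-eq rewrite FinP.splitAt-↑ˡ n i a | FinP.splitAt-↑ʳ n a k = refl
    lt : ⌊ (i ↑ˡ a) <? (n ↑ʳ k) ⌋ ≡ true
    lt with (i ↑ˡ a) <? (n ↑ʳ k)
    ... | yes _ = refl
    ... | no ≮ = ⊥-elim (≮ (subst₂ ℕ._<_ (≡.sym (FinP.toℕ-↑ˡ i a)) (≡.sym (FinP.toℕ-↑ʳ n k))
                   (ℕP.<-≤-trans (FinP.toℕ<n i) (ℕP.m≤m+n n (toℕ k)))))
  cross : ∀ i → sum (λ k → g (i ↑ˡ a) (n ↑ʳ k)) ≡ + a
  cross i = trans (sum-cong-≗ (cross-eq i)) (trans (sum-const {a} 1ℤ) (ℤP.*-identityʳ (+ a)))

-- Passing to injective maps

==-refl : (x : Fin N) → (x == x) ≡ true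
==-refl zero = refl
==-refl (suc x) = ==-refl x

sum-== : (y : Fin N) → sum (λ x → indicator (x == y)) ≡ 1ℤ
sum-== {suc N} zero = cong (λ s → 1ℤ + s) (trans (sum-const {N} 0ℤ) (ℤP.*-zeroʳ (+ N)))
sum-== {suc N} (suc y) = trans (ℤP.+-identityˡ _) (sum-== y)

occurs : Fin N → Vec (Fin N) n → Bool
occurs x [] = false
occurs x (y ∷ z) = (x == y) ∨ occurs x z

distinct : Vec (Fin N) n → Bool
distinct [] = true
distinct (x ∷ z) = not (occurs x z) ∧ distinct z

occurs-lookup : ∀ (z : Vec (Fin N) n) i → occurs (lookup z i) z ≡ true
occurs-lookup (x ∷ z) zero rewrite ==-refl x = refl
occurs-lookup (x ∷ z) (suc i) with lookup z i == x
... | true = refl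
... | false = occurs-lookup z i

distinct-injective : ∀ (z : Vec (Fin N) n) → distinct z ≡ true → ∀ i j → lookup z i ≡ lookup z j → i ≡ j
distinct-injective (x ∷ z) d zero zero eq = refl
distinct-injective (x ∷ z) d zero (suc j) eq rewrite eq | occurs-lookup z j with d
... | ()
distinct-injective (x ∷ z) d (suc i) zero eq rewrite ≡.sym eq | occurs-lookup z i with d
... | ()
distinct-injective (x ∷ z) d (suc i) (suc j) eq =
  cong suc (distinct-injective z (proj₂ (∧-true {not (occurs x z)} d)) i j eq)

distinct-injectiveᵇ : ∀ (z : Vec (Fin N) n) → distinct z ≡ true → injectiveᵇ z ≡ true
distinct-injectiveᵇ {n = n} z d = and-map⁺ _ (allFin n) λ i → and-map⁺ _ (allFin n) λ j → separated i j
  where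
  separated : ∀ i j → ⌊ i Fin.≟ j ⌋ ∨ not ⌊ lookup z i Fin.≟ lookup z j ⌋ ≡ true
  separated i j with i Fin.≟ j | lookup z i Fin.≟ lookup z j
  ... | yes _ | _ = refl
  ... | no _ | no _ = refl
  ... | no i≢j | yes eq = ⊥-elim (i≢j (distinct-injective z d i j eq))

occurrences : Fin N → Vec (Fin N) n → ℤ
occurrences x [] = 0ℤ
occurrences x (y ∷ z) = indicator (x == y) + occurrences x z

-- The number of pairs of equal coordinates. It majorises the indicator of non-injectivity, and its
-- sum splits over pairs.
collisions : Vec (Fin N) n → ℤ
collisions [] = 0ℤ
collisions (x ∷ z) = occurrences x z + collisions z

indicator-∨ : ∀ a b → indicator (a ∨ b) ≤ indicator a + indicator b
indicator-∨ true true = +≤+ (ℕ.s≤s ℕ.z≤n)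
indicator-∨ true false = ℤP.≤-refl
indicator-∨ false b = ℤP.≤-reflexive (≡.sym (ℤP.+-identityˡ _))

occurs≤occurrences : ∀ x (z : Vec (Fin N) n) → indicator (occurs x z) ≤ occurrences x z
occurs≤occurrences x [] = ℤP.≤-refl
occurs≤occurrences x (y ∷ z) = ℤP.≤-trans (indicator-∨ (x == y) (occurs x z))
  (ℤP.+-monoʳ-≤ (indicator (x == y)) (occurs≤occurrences x z))

indistinct≤collisions : ∀ (z : Vec (Fin N) n) → indicator (not (distinct z)) ≤ collisions z
indistinct≤collisions [] = ℤP.≤-refl
indistinct≤collisions (x ∷ z) = ℤP.≤-trans (split (occurs x z) (distinct z))
  (ℤP.+-mono-≤ (occurs≤occurrences x z) (indistinct≤collisions z))
  where
  split : ∀ a b → indicator (not (not a ∧ b)) ≤ indicator a + indicator (not b)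
  split true true = ℤP.≤-refl
  split true false = +≤+ (ℕ.s≤s ℕ.z≤n)
  split false b = ℤP.≤-reflexive (≡.sym (ℤP.+-identityˡ _))

sum-occurrences : ∀ (z : Vec (Fin N) n) → sum (λ x → occurrences x z) ≡ + n
sum-occurrences {N} [] = trans (sum-const {N} 0ℤ) (ℤP.*-zeroʳ (+ N))
sum-occurrences (y ∷ z) = trans (∑-distrib-+ (λ x → indicator (x == y)) (λ x → occurrences x z))
  (cong₂ _+_ (sum-== y) (sum-occurrences z))

∑-sum-comm : ∀ (g : Fin N → Vec (Fin N) n → ℤ) → sum (λ x → ∑ⱽ (g x)) ≡ ∑ⱽ (λ z → sum λ x → g x z)
∑-sum-comm {n = zero} g = refl
∑-sum-comm {N} {suc n} g = trans (∑-comm {N} {N} λ x y → ∑ⱽ (g x ∘ (y ∷_))) (sum-cong-≗ λ y → ∑-sum-comm λ x → g x ∘ (y ∷_))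

-- Each pair of coordinates agrees for N^(v-1) maps. Multiplying by N avoids that exponent, and v²
-- is a crude bound for the number of pairs.
∑-collisions : ∀ N v → + N * ∑ⱽ {N} {v} collisions ≤ + (v ℕ.* v) * (+ N) ^ v
∑-collisions N zero = ℤP.≤-reflexive (ℤP.*-zeroʳ (+ N))
∑-collisions N (suc v) = begin
  X * ∑ⱽ {N} {suc v} collisions
    ≡⟨ cong (X *_) (sum-cong-≗ {N} λ x → ∑ⱽ-distrib-+ {N} {v} (occurrences x) collisions) ⟩
  X * sum {N} (λ x → ∑ⱽ {N} {v} (occurrences x) + C)
    ≡⟨ cong (X *_) (∑-distrib-+ {N} (λ x → ∑ⱽ {N} {v} (occurrences x)) (λ _ → C)) ⟩
  X * (sum {N} (λ x → ∑ⱽ {N} {v} (occurrences x)) + sum {N} (λ _ → C))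
    ≡⟨ cong₂ (λ s t → X * (s + t))
         (trans (∑-sum-comm {N} {v} occurrences) (trans (∑ⱽ-cong {N} {v} sum-occurrences) (∑ⱽ-const {N} {v} (+ v))))
         (sum-const {N} C) ⟩
  X * (P * + v + X * C)
    ≡⟨ ℤP.*-distribˡ-+ X (P * + v) (X * C) ⟩
  X * (P * + v) + X * (X * C)
    ≤⟨ ℤP.+-monoʳ-≤ (X * (P * + v)) (ℤP.*-monoˡ-≤-nonNeg X (∑-collisions N v)) ⟩
  X * (P * + v) + X * (+ (v ℕ.* v) * P)
    ≡⟨ lem X P (+ v) (+ (v ℕ.* v)) ⟩
  (+ v + + (v ℕ.* v)) * (X * P)
    ≤⟨ ℤP.*-monoʳ-≤-nonNeg (X * P) {{ℤ.nonNegative (0≤+N^ N (suc v))}} (+≤+ v+v²≤[1+v]²) ⟩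
  + (suc v ℕ.* suc v) * (+ N) ^ suc v ∎
  where
  open ℤP.≤-Reasoning
  X = + N
  P = (+ N) ^ v
  C = ∑ⱽ {N} {v} collisions
  lem : ∀ x p v w → x * (p * v) + x * (w * p) ≡ (v + w) * (x * p)
  lem = solve-∀
  v+v²≤[1+v]² : v ℕ.+ v ℕ.* v ℕ.≤ suc v ℕ.* suc v
  v+v²≤[1+v]² = ℕP.≤-trans (ℕP.≤-reflexive (≡.sym (ℕP.*-suc v v))) (ℕP.m≤n+m (v ℕ.* suc v) (suc v))

fall≤^ : ∀ N v → fall N v ℕ.≤ N ℕ.^ v
fall≤^ N zero = ℕP.≤-refl
fall≤^ N (suc v) = ℕP.*-mono-≤ (ℕP.m∸n≤m N v) (fall≤^ N v)

pos-^ : ∀ N v → + (N ℕ.^ v) ≡ (+ N) ^ v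
pos-^ N zero = refl
pos-^ N (suc v) = trans (ℤP.pos-* N (N ℕ.^ v)) (cong (+ N *_) (pos-^ N v))

homCount≤monoCount : ∀ (F : Graph v) N c b → homCount F N c b ≤ + monoCount F N c b + ∑ⱽ {N} {v} collisions
homCount≤monoCount {v} F N c b = begin
  homCount F N c b                                      ≤⟨ ∑ⱽ-mono {N} {v} split ⟩
  ∑ⱽ {N} {v} (λ φ → indicator (injectiveᵇ φ ∧ monoᵇ F c b φ) + collisions φ)
    ≡⟨ ∑ⱽ-distrib-+ {N} {v} (λ φ → indicator (injectiveᵇ φ ∧ monoᵇ F c b φ)) collisions ⟩
  ∑ⱽ {N} {v} (λ φ → indicator (injectiveᵇ φ ∧ monoᵇ F c b φ)) + ∑ⱽ {N} {v} collisions
    ≡⟨ cong (_+ ∑ⱽ {N} {v} collisions) (count-allMaps v N (λ φ → injectiveᵇ φ ∧ monoᵇ F c b φ)) ⟨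
  + monoCount F N c b + ∑ⱽ {N} {v} collisions ∎
  where
  open ℤP.≤-Reasoning
  split : ∀ φ → indicator (monoᵇ F c b φ) ≤ indicator (injectiveᵇ φ ∧ monoᵇ F c b φ) + collisions φ
  split φ = ℤP.≤-trans (cases (injectiveᵇ φ) (monoᵇ F c b φ) (distinct-injectiveᵇ φ))
    (ℤP.+-monoʳ-≤ (indicator (injectiveᵇ φ ∧ monoᵇ F c b φ)) (indistinct≤collisions φ))
    where
    cases : ∀ i m → (distinct φ ≡ true → i ≡ true) → indicator m ≤ indicator (i ∧ m) + indicator (not (distinct φ))
    cases i m d⇒i with distinct φ
    ... | true rewrite d⇒i refl = ℤP.≤-reflexive (≡.sym (ℤP.+-identityʳ (indicator m)))
    ... | false = ℤP.≤-trans (bound m) (subst (1ℤ ≤_) (ℤP.+-comm 1ℤ (indicator (i ∧ m)))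
                    (ℤP.+-monoʳ-≤ 1ℤ (0≤indicator (i ∧ m))))
      where
      bound : ∀ m → indicator m ≤ 1ℤ
      bound true = ℤP.≤-refl
      bound false = +≤+ ℕ.z≤n

common-hom : ∀ (F : Graph v) {e} → edgeCount F ≡ suc e →
  (∀ N (c : Colouring (suc N)) → + 2 * (+ suc N) ^ v
    ≤ (+ 2) ^ suc e * (homCount F (suc N) (proj₁ c) true + homCount F (suc N) (proj₁ c) false)) →
  Common F
common-hom {v} F {e} e-eq hom zero ()
-- Above this threshold the non-injective maps, scaled by k + 1 and 2^(e+1), number at most N^v by
-- `∑-collisions`. The outer `suc` also forces N to be positive.
common-hom {v} F {e} e-eq hom (suc k) _ rewrite e-eq = suc (suc k ℕ.* 2 ℕ.^ suc e ℕ.* (v ℕ.* v)) , large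
  where
  large : ∀ N → suc (suc k ℕ.* 2 ℕ.^ suc e ℕ.* (v ℕ.* v)) ℕ.≤ N → (c : Colouring N) →
    k ℕ.* fall N v ℕ.≤ suc k ℕ.* 2 ℕ.^ e ℕ.* monoCopies F N (proj₁ c)
  large (suc N) N₀≤N (c , c-sym) = ℕP.≤-trans (ℕP.*-monoʳ-≤ k (fall≤^ (suc N) v)) (ℤP.drop‿+≤+
    (subst₂ _≤_ (trans (cong (+ k *_) (≡.sym (pos-^ (suc N) v))) (≡.sym (ℤP.pos-* k (suc N ℕ.^ v))))
      (trans (cong₂ _*_ (trans (cong (+ suc k *_) (≡.sym (pos-^ 2 e))) (≡.sym (ℤP.pos-* (suc k) (2 ℕ.^ e)))) refl)
        (≡.sym (ℤP.pos-* (suc k ℕ.* 2 ℕ.^ e) _)))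
      bound))
    where
    X P T M C : ℤ
    X = + suc N
    P = X ^ v
    T = (+ 2) ^ e
    M = + monoCopies F (suc N) c
    C = ∑ⱽ {suc N} {v} collisions
    homs≤ : homCount F (suc N) c true + homCount F (suc N) c false ≤ M + + 2 * C
    homs≤ = ℤP.≤-trans (ℤP.+-mono-≤ (homCount≤monoCount F (suc N) c true) (homCount≤monoCount F (suc N) c false))
      (ℤP.≤-reflexive (lem (+ monoCount F (suc N) c true) (+ monoCount F (suc N) c false) C))
      where
      lem : ∀ a b c → (a + c) + (b + c) ≡ (a + b) + + 2 * c
      lem = solve-∀
    P≤ : P ≤ T * (M + + 2 * C)
    P≤ = ℤP.*-cancelˡ-≤-pos P (T * (M + + 2 * C)) (+ 2) (ℤP.≤-trans (hom N (c , c-sym))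
      (ℤP.≤-trans (ℤP.*-monoˡ-≤-nonNeg (+ 2 * T) {{ℤ.nonNegative (0≤+N^ 2 (suc e))}} homs≤)
        (ℤP.≤-reflexive (ℤP.*-assoc (+ 2) T (M + + 2 * C)))))
    K = + suc k
    error : K * (+ 2 * T) * C ≤ P
    error = ℤP.*-cancelˡ-≤-pos (K * (+ 2 * T) * C) P X (begin
      X * (K * (+ 2 * T) * C)                  ≡⟨ lem X (K * (+ 2 * T)) C ⟩
      K * (+ 2 * T) * (X * C)                  ≤⟨ ℤP.*-monoˡ-≤-nonNeg (K * (+ 2 * T)) {{ℤ.nonNegative (0≤* {K} (+≤+ ℕ.z≤n) (0≤+N^ 2 (suc e)))}} (∑-collisions (suc N) v) ⟩
      K * (+ 2 * T) * (+ (v ℕ.* v) * P)        ≡⟨ ℤP.*-assoc (K * (+ 2 * T)) (+ (v ℕ.* v)) P ⟨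
      K * (+ 2 * T) * + (v ℕ.* v) * P          ≡⟨ cong (_* P) N₀-eq ⟨
      + (suc k ℕ.* 2 ℕ.^ suc e ℕ.* (v ℕ.* v)) * P ≤⟨ ℤP.*-monoʳ-≤-nonNeg P {{ℤ.nonNegative (0≤+N^ (suc N) v)}} (+≤+ (ℕP.≤-trans (ℕP.n≤1+n _) N₀≤N)) ⟩
      X * P ∎)
      where
      open ℤP.≤-Reasoning
      lem : ∀ x a c → x * (a * c) ≡ a * (x * c)
      lem = solve-∀
      N₀-eq : + (suc k ℕ.* 2 ℕ.^ suc e ℕ.* (v ℕ.* v)) ≡ K * (+ 2 * T) * + (v ℕ.* v)
      N₀-eq = trans (ℤP.pos-* (suc k ℕ.* 2 ℕ.^ suc e) (v ℕ.* v)) (cong (_* + (v ℕ.* v))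
        (trans (ℤP.pos-* (suc k) (2 ℕ.^ suc e)) (cong (K *_) (pos-^ 2 (suc e)))))
    -- Of the k + 1 copies of N^v one is spent on the error term, leaving the factor k.
    bound : + k * P ≤ K * T * M
    bound = ℤP.0≤i-j⇒j≤i (subst (0ℤ ≤_) (lem (+ k) P T M C)
      (0≤+ (0≤* {K} (+≤+ ℕ.z≤n) (ℤP.i≤j⇒0≤j-i P≤)) (ℤP.i≤j⇒0≤j-i error)))
      where
      lem : ∀ k p t m c → (1ℤ + k) * (t * (m + + 2 * c) - p) + (p - (1ℤ + k) * (+ 2 * t) * c) ≡ (1ℤ + k) * t * m - k * p
      lem = solve-∀

-- Classification of the base graphs

infixr 5 _⇒_
_⇒_ : Bool → Bool → Bool
a ⇒ b = not a ∨ b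

⇒-true : ∀ {a b} → (a ≡ true → b ≡ true) → (a ⇒ b) ≡ true
⇒-true {true} a⇒b = a⇒b refl
⇒-true {false} a⇒b = refl

⇒-elim : ∀ {a b} → (a ⇒ b) ≡ true → a ≡ true → b ≡ true
⇒-elim {true} ok _ = ok

∨-elim : ∀ {a b} → a ∨ b ≡ true → a ≡ true ⊎ b ≡ true
∨-elim {true} _ = inj₁ refl
∨-elim {false} eq = inj₂ eq

any-∃ : ∀ (p : A → Bool) xs → any p xs ≡ true → ∃ λ x → x ∈ xs × p x ≡ true
any-∃ p (x ∷ xs) eq with p x in px
... | true = x , here refl , px
... | false with any-∃ p xs eq
...   | y , y∈xs , py = y , there y∈xs , py

any-∈ : ∀ (p : A → Bool) {x xs} → x ∈ xs → p x ≡ true → any p xs ≡ true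
any-∈ p (here refl) px rewrite px = refl
any-∈ p {xs = y ∷ _} (there x∈xs) px with p y
... | true = refl
... | false = any-∈ p x∈xs px

bitVectors : ∀ n → List (Vec Bool n)
bitVectors zero = [] ∷ []
bitVectors (suc n) = List.map (true ∷_) (bitVectors n) List.++ List.map (false ∷_) (bitVectors n)

bitVectors-complete : (v : Vec Bool n) → v ∈ bitVectors n
bitVectors-complete [] = here refl
bitVectors-complete {suc n} (true ∷ v) = ∈-++⁺ˡ (∈-map⁺ (true ∷_) (bitVectors-complete v))
bitVectors-complete {suc n} (false ∷ v) = ∈-++⁺ʳ (List.map (true ∷_) (bitVectors n)) (∈-map⁺ (false ∷_) (bitVectors-complete v))

-- Adjacency functions cannot be enumerated up to propositional equality, but strictly upper
-- triangular bit matrices can; facts are then carried to a given graph pointwise.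
Triangle : ℕ → Set
Triangle zero = ⊤
Triangle (suc n) = Vec Bool n × Triangle n

triangles : ∀ n → List (Triangle n)
triangles zero = tt ∷ []
triangles (suc n) = cartesianProduct (bitVectors n) (triangles n)

triangles-complete : (t : Triangle n) → t ∈ triangles n
triangles-complete {zero} tt = here refl
triangles-complete {suc n} (r , t) = ∈-cartesianProduct⁺ (bitVectors-complete r) (triangles-complete t)

entry : Triangle n → Fin n → Fin n → Bool
entry (r , t) zero zero = false
entry (r , t) zero (suc j) = lookup r j
entry (r , t) (suc i) zero = lookup r i
entry (r , t) (suc i) (suc j) = entry t i j

entry-sym : ∀ (t : Triangle n) i j → entry t i j ≡ entry t j i
entry-sym (r , t) zero zero = refl
entry-sym (r , t) zero (suc j) = refl
entry-sym (r , t) (suc i) zero = refl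
entry-sym (r , t) (suc i) (suc j) = entry-sym t i j

entry-irrefl : ∀ (t : Triangle n) i → entry t i i ≡ false
entry-irrefl (r , t) zero = refl
entry-irrefl (r , t) (suc i) = entry-irrefl t i

graph : Triangle n → Graph n
graph t = record { adj = entry t ; sym = entry-sym t ; irrefl = entry-irrefl t }

triangle : (Fin n → Fin n → Bool) → Triangle n
triangle {zero} A = tt
triangle {suc n} A = Vec.tabulate (A zero ∘ suc) , triangle (λ i j → A (suc i) (suc j))

entry-triangle : ∀ (A : Fin n → Fin n → Bool) → (∀ i j → A i j ≡ A j i) → (∀ i → A i i ≡ false) →
  ∀ i j → entry (triangle A) i j ≡ A i j
entry-triangle A A-sym A-irr zero zero = ≡.sym (A-irr zero)
entry-triangle A A-sym A-irr zero (suc j) = lookup∘tabulate (A zero ∘ suc) j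
entry-triangle A A-sym A-irr (suc i) zero = trans (lookup∘tabulate (A zero ∘ suc) i) (A-sym zero (suc i))
entry-triangle A A-sym A-irr (suc i) (suc j) =
  entry-triangle (λ i j → A (suc i) (suc j)) (λ i j → A-sym (suc i) (suc j)) (A-irr ∘ suc) i j

forall₂ : (Fin n → Fin n → Bool) → Bool
forall₂ {n} p = all (λ i → all (p i) (allFin n)) (allFin n)

forall₂-true : ∀ (p : Fin n → Fin n → Bool) → (∀ i j → p i j ≡ true) → forall₂ p ≡ true
forall₂-true p ok = and-map⁺ _ (allFin _) λ i → and-map⁺ (p i) (allFin _) (ok i)

forall₂-elim : ∀ (p : Fin n → Fin n → Bool) → forall₂ p ≡ true → ∀ i j → p i j ≡ true
forall₂-elim p ok i j = all-∈ (p i) (all-∈ (λ i → all (p i) (allFin _)) ok (∈-allFin i)) (∈-allFin j)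

module _ (A : Fin n → Fin n → Bool) where
  closedᵇ : Vec Bool n → Bool
  closedᵇ S = forall₂ λ i j → A i j ⇒ lookup S i ⇒ lookup S j

  -- Connectivity is tested through vertex sets closed under adjacency, of which only the empty and
  -- the full one may occur. Only completeness of the test matters: a graph accepted wrongly would
  -- merely have to be represented too.
  connectedᵇ : Bool
  connectedᵇ = all (λ S → closedᵇ S ⇒ forall₂ λ i j → lookup S i ⇒ lookup S j) (bitVectors n)

  bipartiteᵇ : Bool
  bipartiteᵇ = any (λ S → forall₂ λ i j → A i j ⇒ xor (lookup S i) (lookup S j)) (bitVectors n)
    where
    xor : Bool → Bool → Bool
    xor a b = if a then not b else b

connected-complete : (H : Graph n) → Connected H → connectedᵇ (adj H) ≡ true
connected-complete {n} H (_ , reach) = and-map⁺ _ (bitVectors n) λ S → ⇒-true λ closed →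
  forall₂-true _ λ i j → ⇒-true (spread S closed (reach i j))
  where
  spread : ∀ S → closedᵇ (adj H) S ≡ true → ∀ {i j} → Reach H i j → lookup S i ≡ true → lookup S j ≡ true
  spread S closed here Si = Si
  spread S closed (step {i} {k} ik r) Si = spread S closed r
    (⇒-elim (⇒-elim {adj H i k} (forall₂-elim (λ i j → adj H i j ⇒ lookup S i ⇒ lookup S j) closed i k) ik) Si)

bipartite-complete : (H : Graph n) → Bipartite H → bipartiteᵇ (adj H) ≡ true
bipartite-complete H (f , proper) = any-∈ _ (bitVectors-complete (Vec.tabulate f))
  (forall₂-true _ λ i j → ⇒-true λ ij → subst₂ (λ a b → (if a then not b else b) ≡ true)
    (≡.sym (lookup∘tabulate f i)) (≡.sym (lookup∘tabulate f j)) (different (proper i j ij)))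
  where
  different : ∀ {a b} → a ≢ b → (if a then not b else b) ≡ true
  different {true} {true} a≢b = ⊥-elim (a≢b refl)
  different {true} {false} a≢b = refl
  different {false} {true} a≢b = refl
  different {false} {false} a≢b = ⊥-elim (a≢b refl)

coversᵇ : List (Fin n × Fin n) → (Fin n → Fin n → Bool) → Bool
coversᵇ L A = forall₂ λ i j → A i j ⇒ any (λ (k , l) → (k == i ∧ l == j) ∨ (k == j ∧ l == i)) L

==-sound : ∀ {i j : Fin n} → (i == j) ≡ true → i ≡ j
==-sound {i = zero} {zero} _ = refl
==-sound {i = suc i} {suc j} eq = cong suc (==-sound eq)

covers-sound : ∀ (L : List (Fin n × Fin n)) A → coversᵇ L A ≡ true → Covers L A
covers-sound L A ok i j ij with any-∃ _ L (⇒-elim (forall₂-elim _ ok i j) ij)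
... | (k , l) , kl∈L , eq with ∨-elim {k == i ∧ l == j} eq
...   | inj₁ e = inj₁ (subst₂ (λ k l → (k , l) ∈ L) (==-sound (proj₁ (∧-true e))) (==-sound (proj₂ (∧-true {k == i} e))) kl∈L)
...   | inj₂ e = inj₂ (subst₂ (λ k l → (k , l) ∈ L) (==-sound (proj₁ (∧-true e))) (==-sound (proj₂ (∧-true {k == j} e))) kl∈L)

edgeCount-cong : ∀ (G H : Graph n) → (∀ i j → adj G i j ≡ adj H i j) → edgeCount G ≡ edgeCount H
edgeCount-cong G H G≗H = ℤP.+-injective (trans (edgeCount-sum G) (trans
  (sum-cong-≗ λ i → sum-cong-≗ λ j → cong (λ a → indicator (⌊ i <? j ⌋ ∧ a)) (G≗H i j))
  (≡.sym (edgeCount-sum H))))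

-- One word of adjacent transpositions for every permutation.
words : ℕ → List (List ℕ)
words zero = [] ∷ []
words (suc n) = List.concatMap (λ w → List.map (λ k → List.downFrom k List.++ List.map suc w) (List.upTo (suc n))) (words n)

Representatives : ℕ → Set
Representatives n = List (Σ (List (Fin n × Fin n)) (Certified n))

-- A list that covers the edges and is no longer than their number contains every edge exactly once.
-- The two tests thus say that H is a relabelling of the representative.
representedᵇ : Representatives n → Graph n → Bool
representedᵇ {n} R H = any (λ (L , _) → (length L ℕ.≤ᵇ edgeCount H) ∧
  any (λ ks → coversᵇ (relabel ks L) (adj H)) (words n)) R

exhaustiveᵇ : ∀ n → Representatives n → Bool
exhaustiveᵇ n R = all (λ t → bipartiteᵇ (entry t) ∧ connectedᵇ (entry t) ⇒ representedᵇ R (graph t)) (triangles n)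

record Represented (H : Graph n) : Set where
  field
    L : List (Fin n × Fin n)
    certificate : Certified n L
    ks : List ℕ
    covers : Covers (relabel ks L) (adj H)
    few : length L ℕ.≤ edgeCount H

represented : ∀ (R : Representatives n) → exhaustiveᵇ n R ≡ true →
  (H : Graph n) → Connected H → Bipartite H → Represented H
represented {n} R ok H con bip
  with any-∃ _ R (⇒-elim {bipartiteᵇ (entry t) ∧ connectedᵇ (entry t)}
         (all-∈ (λ t → bipartiteᵇ (entry t) ∧ connectedᵇ (entry t) ⇒ representedᵇ R (graph t)) ok (triangles-complete t)) good)
  where
  t = triangle (adj H)
  same : ∀ i j → adj (graph t) i j ≡ adj H i j
  same = entry-triangle (adj H) (Graph.sym H) (irrefl H)
  G = graph t
  reach : ∀ {i j} → Reach H i j → Reach G i j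
  reach here = here
  reach (step {i} {k} e r) = step (trans (same i k) e) (reach r)
  good : bipartiteᵇ (entry t) ∧ connectedᵇ (entry t) ≡ true
  good = cong₂ _∧_
    (bipartite-complete G (proj₁ bip , λ i j ij → proj₂ bip i j (trans (≡.sym (same i j)) ij)))
    (connected-complete G (proj₁ con , λ i j → reach (proj₂ con i j)))
... | (L , cert) , _ , found
  with ∧-true {length L ℕ.≤ᵇ edgeCount (graph (triangle (adj H)))} found
... | short , fits with any-∃ _ (words n) fits
...   | ks , _ , matches = record
  { L = L ; certificate = cert ; ks = ks
  ; covers = λ i j ij → covers-sound (relabel ks L) (entry (triangle (adj H))) matches i j
      (trans (entry-triangle (adj H) (Graph.sym H) (irrefl H) i j) ij)
  ; few = subst (length L ℕ.≤_)
      (edgeCount-cong (graph (triangle (adj H))) H (entry-triangle (adj H) (Graph.sym H) (irrefl H)))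
      (ℕP.≤ᵇ⇒≤ _ _ (Equivalence.from T-≡ short))
  }

-- Certificates

module Certificates where
  open import Agda.Builtin.FromNat using (Number; fromNat)
  open import Agda.Builtin.FromNeg using (Negative; fromNeg)
  import Data.Integer.Literals as ℤLiterals
  import Data.Nat.Literals as ℕLiterals

  instance
    numberℕ : Number ℕ
    numberℕ = ℕLiterals.number

    numberℤ : Number ℤ
    numberℤ = ℤLiterals.number

    negativeℤ : Negative ℤ
    negativeℤ = ℤLiterals.negative

  bits : ∀ n → ℕ → List (Fin n)
  bits zero k = []
  bits (suc n) k = if k % 2 ≡ᵇ 1 then zero ∷ rest else rest
    where rest = List.map suc (bits n (k / 2))

  -- A feature ∑ ± ∏_{s ∈ S} f(tₛ,y) is given by its signed sets S, written in binary. All sign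
  -- patterns are used together with their negatives, with f(t₁,t₂) as the common sign; it makes
  -- the features even in f.
  features : List ℤ → Form
  features = List.map λ s → let S = bits 4 ∣ s ∣ in
    ℤ.sign s ℤ.◃ 1 , (if length S % 2 ≡ᵇ 1 then (1F , 2F) ∷ [] else []) , S

  combination : List (List ℤ) → List ℤ → Form
  combination basis a = List.concat (List.zipWith (λ x → List.map (λ (c , τ) → x * c , τ) ∘ features) a basis)

  record Pattern : Set where
    field
      signs : List Factor
      basis : List (List ℤ)

  block : Pattern → List (ℕ × List ℤ) → Block
  block p rows = Pattern.signs p ∙ List.map (λ (c , a) → c , combination (Pattern.basis p) a) rows

  -- The pair {1,2} is left out because its sign is the reference for all others.
  triangleEdges tetrahedronEdges : List (Fin 4 × Fin 4)
  triangleEdges = (0F , 1F) ∷ (0F , 2F) ∷ []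
  tetrahedronEdges = (0F , 3F) ∷ (1F , 3F) ∷ (2F , 3F) ∷ triangleEdges

  -- A factor 1 ± f(tᵢ,tⱼ) f(t₁,t₂) fixes a sign relative to the reference edge. It is even in f,
  -- and a colouring and its complement share one pattern.
  pattern-on : List (Fin 4 × Fin 4) → List (Fin 4 × Fin 4) → List (List ℤ) → Pattern
  pattern-on es negative basis = record
    { signs = List.map (λ (i , j) → not (any (λ (k , l) → (i == k) ∧ (j == l)) negative) , (i , j) ∷ (1F , 2F) ∷ []) es
    ; basis = basis
    }

  -- By the symmetry of a sign pattern it suffices to use features that are symmetric or antisymmetric
  -- under its automorphisms. The coefficients were found by semidefinite and linear programming and
  -- rounded; the rounding errors are left to absorb.

  T₀ : Pattern
  T₀ = pattern-on triangleEdges ([])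
    ((3 ∷ []) ∷
     (5 ∷ 6 ∷ []) ∷
     (1 ∷ 2 ∷ []) ∷
     (4 ∷ []) ∷
     (7 ∷ []) ∷ [])

  T₁ : Pattern
  T₁ = pattern-on triangleEdges ([])
    ((5 ∷ -6 ∷ []) ∷
     (1 ∷ -2 ∷ []) ∷ [])

  U₀ : Pattern
  U₀ = pattern-on triangleEdges ((0F , 1F) ∷ [])
    ((3 ∷ []) ∷
     (5 ∷ 6 ∷ []) ∷
     (1 ∷ 2 ∷ []) ∷
     (4 ∷ []) ∷
     (7 ∷ []) ∷ [])

  U₁ : Pattern
  U₁ = pattern-on triangleEdges ((0F , 1F) ∷ [])
    ((5 ∷ -6 ∷ []) ∷
     (1 ∷ -2 ∷ []) ∷ [])

  -- From here on all six edges of the type are fixed. The minority edges form nothing (Q), an edge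
  -- (E), a two-edge path (V), a matching (M) or a star (S). Subscript 0 marks the fully symmetric
  -- features.
  Q₀ : Pattern
  Q₀ = pattern-on tetrahedronEdges ([])
    ((1 ∷ 2 ∷ 4 ∷ 8 ∷ []) ∷
     (3 ∷ 5 ∷ 9 ∷ 6 ∷ 10 ∷ 12 ∷ []) ∷
     (7 ∷ 11 ∷ 13 ∷ 14 ∷ []) ∷
     (15 ∷ []) ∷ [])

  Q₁ : Pattern
  Q₁ = pattern-on tetrahedronEdges ([])
    ((1 ∷ -2 ∷ []) ∷
     (5 ∷ 9 ∷ -6 ∷ -10 ∷ []) ∷
     (13 ∷ -14 ∷ []) ∷ [])

  E₀ : Pattern
  E₀ = pattern-on tetrahedronEdges ((0F , 1F) ∷ [])
    ((1 ∷ 2 ∷ []) ∷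
     (4 ∷ 8 ∷ []) ∷
     (3 ∷ []) ∷
     (12 ∷ []) ∷
     (5 ∷ 9 ∷ 6 ∷ 10 ∷ []) ∷
     (7 ∷ 11 ∷ []) ∷
     (13 ∷ 14 ∷ []) ∷
     (15 ∷ []) ∷ [])

  E₁ : Pattern
  E₁ = pattern-on tetrahedronEdges ((0F , 1F) ∷ [])
    ((4 ∷ -8 ∷ []) ∷
     (5 ∷ -9 ∷ 6 ∷ -10 ∷ []) ∷
     (7 ∷ -11 ∷ []) ∷ [])

  E₂ : Pattern
  E₂ = pattern-on tetrahedronEdges ((0F , 1F) ∷ [])
    ((1 ∷ -2 ∷ []) ∷
     (5 ∷ 9 ∷ -6 ∷ -10 ∷ []) ∷
     (13 ∷ -14 ∷ []) ∷ [])

  E₃ : Pattern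
  E₃ = pattern-on tetrahedronEdges ((0F , 1F) ∷ [])
    ((5 ∷ -9 ∷ -6 ∷ 10 ∷ []) ∷ [])

  V₀ : Pattern
  V₀ = pattern-on tetrahedronEdges ((0F , 1F) ∷ (0F , 2F) ∷ [])
    ((1 ∷ []) ∷
     (2 ∷ 4 ∷ []) ∷
     (8 ∷ []) ∷
     (3 ∷ 5 ∷ []) ∷
     (9 ∷ []) ∷
     (6 ∷ []) ∷
     (10 ∷ 12 ∷ []) ∷
     (7 ∷ []) ∷
     (11 ∷ 13 ∷ []) ∷
     (14 ∷ []) ∷
     (15 ∷ []) ∷ [])

  V₁ : Pattern
  V₁ = pattern-on tetrahedronEdges ((0F , 1F) ∷ (0F , 2F) ∷ [])
    ((2 ∷ -4 ∷ []) ∷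
     (3 ∷ -5 ∷ []) ∷
     (10 ∷ -12 ∷ []) ∷
     (11 ∷ -13 ∷ []) ∷ [])

  M₀ : Pattern
  M₀ = pattern-on tetrahedronEdges ((0F , 1F) ∷ (2F , 3F) ∷ [])
    ((1 ∷ 2 ∷ 4 ∷ 8 ∷ []) ∷
     (3 ∷ 12 ∷ []) ∷
     (5 ∷ 9 ∷ 6 ∷ 10 ∷ []) ∷
     (7 ∷ 11 ∷ 13 ∷ 14 ∷ []) ∷
     (15 ∷ []) ∷ [])

  M₁ : Pattern
  M₁ = pattern-on tetrahedronEdges ((0F , 1F) ∷ (2F , 3F) ∷ [])
    ((1 ∷ -2 ∷ []) ∷
     (5 ∷ 9 ∷ -6 ∷ -10 ∷ []) ∷
     (13 ∷ -14 ∷ []) ∷ [])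

  M₂ : Pattern
  M₂ = pattern-on tetrahedronEdges ((0F , 1F) ∷ (2F , 3F) ∷ [])
    ((1 ∷ 2 ∷ -4 ∷ -8 ∷ []) ∷
     (3 ∷ -12 ∷ []) ∷
     (7 ∷ 11 ∷ -13 ∷ -14 ∷ []) ∷ [])

  M₃ : Pattern
  M₃ = pattern-on tetrahedronEdges ((0F , 1F) ∷ (2F , 3F) ∷ [])
    ((5 ∷ -9 ∷ -6 ∷ 10 ∷ []) ∷ [])

  S₀ : Pattern
  S₀ = pattern-on tetrahedronEdges ((0F , 1F) ∷ (0F , 2F) ∷ (0F , 3F) ∷ [])
    ((1 ∷ []) ∷
     (2 ∷ 4 ∷ 8 ∷ []) ∷
     (3 ∷ 5 ∷ 9 ∷ []) ∷
     (6 ∷ 10 ∷ 12 ∷ []) ∷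
     (7 ∷ 11 ∷ 13 ∷ []) ∷
     (14 ∷ []) ∷
     (15 ∷ []) ∷ [])

  S₁ : Pattern
  S₁ = pattern-on tetrahedronEdges ((0F , 1F) ∷ (0F , 2F) ∷ (0F , 3F) ∷ [])
    ((2 ∷ -4 ∷ []) ∷
     (3 ∷ -5 ∷ []) ∷
     (10 ∷ -12 ∷ []) ∷
     (11 ∷ -13 ∷ []) ∷ [])

  -- The eleven certificates

  vertexCertified : Certified 1 ([])
  vertexCertified = record
    { eq = refl
    ; edgeScale = 1 ; edgeBlocks = [] ; edgeOk = refl
    ; coneScale = 1 ; coneBlocks = [] ; coneOk = refl
    }

  -- The even part of the cone integrand consists of three two-edge paths, which are squares
  -- already, so no blocks are required.
  edgeCertified : Certified 2 ((0F , 1F) ∷ [])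
  edgeCertified = record
    { eq = refl
    ; edgeScale = 1 ; edgeBlocks = [] ; edgeOk = refl
    ; coneScale = 1 ; coneBlocks = [] ; coneOk = refl
    }

  cherryCone : List Block
  cherryCone =
    block T₀ (
      (8 , 1 ∷ 0 ∷ 1 ∷ 0 ∷ 0 ∷ []) ∷ []) ∷
    block U₀ (
      (3 , 1 ∷ 0 ∷ -3 ∷ 0 ∷ 0 ∷ []) ∷ (4 , 0 ∷ 1 ∷ 1 ∷ 3 ∷ 0 ∷ []) ∷ []) ∷
    block U₁ (
      (4 , 1 ∷ 1 ∷ []) ∷ []) ∷ []

  cherryCertified : Certified 3 ((0F , 1F) ∷ (0F , 2F) ∷ [])
  cherryCertified = record
    { eq = refl
    ; edgeScale = 1 ; edgeBlocks = [] ; edgeOk = refl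
    ; coneScale = 46 ; coneBlocks = cherryCone ; coneOk = refl
    }

  clawCone : List Block
  clawCone =
    block T₀ (
      (243 , 1 ∷ 0 ∷ 1 ∷ 0 ∷ 0 ∷ []) ∷ []) ∷
    block T₁ (
      (2 , 2 ∷ 3 ∷ []) ∷ []) ∷
    block U₀ (
      (4 , 1 ∷ 1 ∷ 0 ∷ 1 ∷ -1 ∷ []) ∷ (12 , 1 ∷ -1 ∷ -3 ∷ -2 ∷ -1 ∷ []) ∷ (10 , 1 ∷ -1 ∷ -3 ∷ -1 ∷ 0 ∷ []) ∷ []) ∷
    block U₁ (
      (44 , 1 ∷ 1 ∷ []) ∷ (10 , 1 ∷ 2 ∷ []) ∷ []) ∷ []

  clawCertified : Certified 4 ((0F , 1F) ∷ (0F , 2F) ∷ (0F , 3F) ∷ [])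
  clawCertified = record
    { eq = refl
    ; edgeScale = 1 ; edgeBlocks = [] ; edgeOk = refl
    ; coneScale = 162 ; coneBlocks = clawCone ; coneOk = refl
    }

  path₄Cone : List Block
  path₄Cone =
    block T₀ (
      (4 , 0 ∷ 0 ∷ 0 ∷ 0 ∷ 1 ∷ []) ∷ (10 , 1 ∷ 1 ∷ 3 ∷ 1 ∷ 0 ∷ []) ∷ []) ∷
    block U₀ (
      (4 , 0 ∷ 1 ∷ 0 ∷ 3 ∷ 1 ∷ []) ∷ (1 , 0 ∷ 1 ∷ 0 ∷ 0 ∷ 0 ∷ []) ∷ (8 , 1 ∷ -1 ∷ -3 ∷ -2 ∷ 1 ∷ []) ∷
      (1 , 0 ∷ 1 ∷ 1 ∷ 3 ∷ 0 ∷ []) ∷ []) ∷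
    block U₁ (
      (15 , 1 ∷ 2 ∷ []) ∷ []) ∷ []

  path₄Certified : Certified 4 ((0F , 1F) ∷ (1F , 2F) ∷ (2F , 3F) ∷ [])
  path₄Certified = record
    { eq = refl
    ; edgeScale = 1 ; edgeBlocks = [] ; edgeOk = refl
    ; coneScale = 77 ; coneBlocks = path₄Cone ; coneOk = refl
    }

  cycle₄Cone : List Block
  cycle₄Cone =
    block T₀ (
      (11 , 1 ∷ 1 ∷ 3 ∷ 1 ∷ -1 ∷ []) ∷ (38 , 2 ∷ 2 ∷ 3 ∷ 2 ∷ 2 ∷ []) ∷ []) ∷
    block U₀ (
      (84 , 0 ∷ 1 ∷ 2 ∷ 1 ∷ 0 ∷ []) ∷ (65 , 1 ∷ 1 ∷ 1 ∷ 2 ∷ 2 ∷ []) ∷ (8 , 0 ∷ 2 ∷ 3 ∷ 3 ∷ 1 ∷ []) ∷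
      (7 , 2 ∷ -1 ∷ -3 ∷ -2 ∷ 3 ∷ []) ∷ []) ∷
    block U₁ (
      (209 , 1 ∷ 1 ∷ []) ∷ []) ∷ []

  cycle₄Certified : Certified 4 ((0F , 1F) ∷ (1F , 2F) ∷ (2F , 3F) ∷ (0F , 3F) ∷ [])
  cycle₄Certified = record
    { eq = refl
    ; edgeScale = 1 ; edgeBlocks = [] ; edgeOk = refl
    ; coneScale = 368 ; coneBlocks = cycle₄Cone ; coneOk = refl
    }

  star₄Cone : List Block
  star₄Cone =
    block Q₀ (
      (147 , 3 ∷ 1 ∷ 0 ∷ 1 ∷ []) ∷ (586 , 3 ∷ 1 ∷ 0 ∷ -1 ∷ []) ∷ (174 , 3 ∷ 1 ∷ -1 ∷ 0 ∷ []) ∷ []) ∷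
    block Q₁ (
      (107 , 3 ∷ 1 ∷ -3 ∷ []) ∷ (6698 , 1 ∷ 0 ∷ 0 ∷ []) ∷ (1587 , 3 ∷ 1 ∷ 0 ∷ []) ∷ []) ∷
    block E₀ (
      (1328 , 2 ∷ 3 ∷ -1 ∷ 3 ∷ 0 ∷ 0 ∷ 0 ∷ -1 ∷ []) ∷ (50 , 3 ∷ 2 ∷ -2 ∷ 1 ∷ 1 ∷ 0 ∷ -2 ∷ -1 ∷ []) ∷
      (1370 , 0 ∷ 1 ∷ 0 ∷ 0 ∷ 0 ∷ -1 ∷ 0 ∷ 0 ∷ []) ∷ (7001 , 0 ∷ 1 ∷ 0 ∷ 1 ∷ 0 ∷ 0 ∷ 0 ∷ 0 ∷ []) ∷
      (708 , 3 ∷ -1 ∷ -1 ∷ -1 ∷ 0 ∷ 0 ∷ 0 ∷ -1 ∷ []) ∷ (2357 , 2 ∷ -1 ∷ -1 ∷ -1 ∷ 0 ∷ 0 ∷ 0 ∷ 0 ∷ []) ∷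
      (2709 , 1 ∷ 2 ∷ -1 ∷ 2 ∷ 0 ∷ 0 ∷ 0 ∷ 0 ∷ []) ∷ (595 , 2 ∷ 2 ∷ -1 ∷ 1 ∷ 0 ∷ 0 ∷ -1 ∷ 0 ∷ []) ∷
      (267 , 1 ∷ 2 ∷ -2 ∷ 1 ∷ 0 ∷ 2 ∷ -1 ∷ 1 ∷ []) ∷ (464 , 0 ∷ 0 ∷ 0 ∷ 0 ∷ 0 ∷ 1 ∷ 0 ∷ 1 ∷ []) ∷ []) ∷
    block E₁ (
      (3145 , 1 ∷ 0 ∷ 0 ∷ []) ∷ (185 , 3 ∷ 1 ∷ -3 ∷ []) ∷ (1209 , 3 ∷ 1 ∷ 0 ∷ []) ∷ []) ∷
    block E₂ (
      (2038 , 3 ∷ 1 ∷ 0 ∷ []) ∷ (130 , 1 ∷ 1 ∷ -2 ∷ []) ∷ []) ∷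
    block E₃ (
      (1529 , 1 ∷ []) ∷ []) ∷
    block V₀ (
      (16 , 0 ∷ 0 ∷ 0 ∷ 0 ∷ 0 ∷ 0 ∷ 0 ∷ 1 ∷ 0 ∷ -1 ∷ 0 ∷ []) ∷
      (101 , 0 ∷ 0 ∷ 0 ∷ 0 ∷ 0 ∷ 0 ∷ 0 ∷ 1 ∷ 0 ∷ 0 ∷ 0 ∷ []) ∷
      (1228 , 0 ∷ 0 ∷ 1 ∷ 0 ∷ 0 ∷ 0 ∷ 0 ∷ 0 ∷ 1 ∷ 0 ∷ 0 ∷ []) ∷
      (34 , 0 ∷ 0 ∷ 0 ∷ 1 ∷ 0 ∷ 0 ∷ -1 ∷ 0 ∷ 0 ∷ 0 ∷ 0 ∷ []) ∷
      (5317 , 0 ∷ 0 ∷ 1 ∷ 0 ∷ 0 ∷ 0 ∷ 0 ∷ 0 ∷ 0 ∷ 0 ∷ 0 ∷ []) ∷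
      (947 , 1 ∷ 0 ∷ 0 ∷ 0 ∷ 0 ∷ 0 ∷ 0 ∷ 0 ∷ 0 ∷ 0 ∷ 1 ∷ []) ∷
      (183 , 1 ∷ 2 ∷ 2 ∷ 1 ∷ 0 ∷ 1 ∷ 2 ∷ 3 ∷ 2 ∷ 1 ∷ 1 ∷ []) ∷
      (436 , 0 ∷ 0 ∷ 0 ∷ 0 ∷ 0 ∷ 0 ∷ 0 ∷ 0 ∷ 0 ∷ 1 ∷ 0 ∷ []) ∷
      (3515 , 2 ∷ 3 ∷ 0 ∷ -1 ∷ 0 ∷ 1 ∷ 0 ∷ 0 ∷ 0 ∷ 0 ∷ -1 ∷ []) ∷
      (3018 , 0 ∷ 0 ∷ 1 ∷ 0 ∷ 1 ∷ 0 ∷ 0 ∷ 0 ∷ 0 ∷ 0 ∷ 0 ∷ []) ∷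
      (75 , 0 ∷ 1 ∷ 2 ∷ 3 ∷ 3 ∷ 0 ∷ 2 ∷ 1 ∷ 1 ∷ 0 ∷ 1 ∷ []) ∷
      (516 , 0 ∷ 1 ∷ 0 ∷ 0 ∷ 0 ∷ 1 ∷ 0 ∷ 0 ∷ 0 ∷ 0 ∷ 0 ∷ []) ∷
      (389 , 2 ∷ -1 ∷ 3 ∷ -1 ∷ 0 ∷ -2 ∷ 0 ∷ 1 ∷ -1 ∷ -1 ∷ 0 ∷ []) ∷
      (867 , 3 ∷ -2 ∷ -2 ∷ 1 ∷ 2 ∷ 0 ∷ -1 ∷ 0 ∷ 0 ∷ 0 ∷ 0 ∷ []) ∷
      (123 , 0 ∷ 0 ∷ 0 ∷ 0 ∷ 1 ∷ 0 ∷ 0 ∷ 0 ∷ 0 ∷ -1 ∷ 0 ∷ []) ∷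
      (461 , 2 ∷ 3 ∷ 3 ∷ -2 ∷ 0 ∷ -2 ∷ 2 ∷ -1 ∷ 1 ∷ 0 ∷ 1 ∷ []) ∷
      (4998 , 0 ∷ 1 ∷ 1 ∷ 0 ∷ 0 ∷ 0 ∷ 0 ∷ 0 ∷ 0 ∷ 0 ∷ 0 ∷ []) ∷ []) ∷
    block V₁ (
      (903 , 0 ∷ 0 ∷ 1 ∷ 1 ∷ []) ∷ (1763 , 0 ∷ 1 ∷ 1 ∷ 0 ∷ []) ∷ (5111 , 2 ∷ -1 ∷ 1 ∷ 0 ∷ []) ∷
      (2187 , 1 ∷ 0 ∷ 1 ∷ 0 ∷ []) ∷ []) ∷
    block M₀ (
      (10 , 2 ∷ 1 ∷ 2 ∷ 0 ∷ -2 ∷ []) ∷ (286 , 3 ∷ -1 ∷ 1 ∷ 0 ∷ 0 ∷ []) ∷ (23 , 1 ∷ -2 ∷ 0 ∷ -1 ∷ 3 ∷ []) ∷ []) ∷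
    block M₁ (
      (586 , 0 ∷ 1 ∷ -1 ∷ []) ∷ (406 , 2 ∷ 1 ∷ 0 ∷ []) ∷ (397 , 2 ∷ 0 ∷ 1 ∷ []) ∷ []) ∷
    block M₂ (
      (220 , 3 ∷ -2 ∷ 0 ∷ []) ∷ []) ∷
    block S₀ (
      (84 , 2 ∷ 0 ∷ 0 ∷ 0 ∷ 0 ∷ -2 ∷ 1 ∷ []) ∷ (535 , 0 ∷ 0 ∷ 0 ∷ 0 ∷ 0 ∷ 0 ∷ 1 ∷ []) ∷
      (6 , 1 ∷ 0 ∷ -1 ∷ 0 ∷ 0 ∷ 0 ∷ 2 ∷ []) ∷ (779 , 1 ∷ 0 ∷ 0 ∷ 0 ∷ 0 ∷ -1 ∷ 0 ∷ []) ∷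
      (729 , 0 ∷ 3 ∷ 0 ∷ 1 ∷ 0 ∷ 0 ∷ 1 ∷ []) ∷ (214 , 0 ∷ 2 ∷ -1 ∷ 0 ∷ 0 ∷ 0 ∷ -1 ∷ []) ∷
      (99 , 1 ∷ 3 ∷ -2 ∷ 0 ∷ -1 ∷ 0 ∷ -1 ∷ []) ∷ []) ∷
    block S₁ (
      (1185 , 1 ∷ 0 ∷ 0 ∷ -1 ∷ []) ∷ (903 , 3 ∷ -2 ∷ 0 ∷ 0 ∷ []) ∷ (510 , 3 ∷ 0 ∷ 2 ∷ 0 ∷ []) ∷
      (861 , 0 ∷ 1 ∷ 1 ∷ 0 ∷ []) ∷ []) ∷ []

  star₄Certified : Certified 5 ((0F , 1F) ∷ (0F , 2F) ∷ (0F , 3F) ∷ (0F , 4F) ∷ [])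
  star₄Certified = record
    { eq = refl
    ; edgeScale = 1 ; edgeBlocks = [] ; edgeOk = refl
    ; coneScale = 33644 ; coneBlocks = star₄Cone ; coneOk = refl
    }

  path₅Cone : List Block
  path₅Cone =
    block Q₀ (
      (9 , 0 ∷ 0 ∷ 0 ∷ 1 ∷ []) ∷ (644 , 3 ∷ 1 ∷ 0 ∷ 0 ∷ []) ∷ []) ∷
    block E₀ (
      (8 , 0 ∷ 0 ∷ 0 ∷ 0 ∷ 0 ∷ 0 ∷ 1 ∷ 0 ∷ []) ∷ (754 , 0 ∷ 2 ∷ 0 ∷ 1 ∷ 0 ∷ 0 ∷ 0 ∷ 0 ∷ []) ∷
      (730 , 3 ∷ 1 ∷ -1 ∷ 0 ∷ 1 ∷ 0 ∷ 0 ∷ 0 ∷ []) ∷ (1084 , 1 ∷ 0 ∷ -1 ∷ 0 ∷ 0 ∷ 0 ∷ 0 ∷ 0 ∷ []) ∷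
      (361 , 3 ∷ 1 ∷ 0 ∷ 0 ∷ 1 ∷ 0 ∷ 0 ∷ 0 ∷ []) ∷ (588 , 3 ∷ -1 ∷ -1 ∷ 0 ∷ 0 ∷ 0 ∷ 0 ∷ -1 ∷ []) ∷
      (1619 , 1 ∷ 3 ∷ 0 ∷ 1 ∷ 1 ∷ 0 ∷ 0 ∷ 0 ∷ []) ∷ (60 , 2 ∷ -2 ∷ -1 ∷ 0 ∷ 0 ∷ 1 ∷ 0 ∷ 1 ∷ []) ∷ []) ∷
    block E₁ (
      (574 , 3 ∷ 1 ∷ 1 ∷ []) ∷ []) ∷
    block E₂ (
      (359 , 3 ∷ 1 ∷ 0 ∷ []) ∷ (203 , 0 ∷ 0 ∷ 1 ∷ []) ∷ (310 , 0 ∷ 1 ∷ 0 ∷ []) ∷ (294 , 3 ∷ 1 ∷ 1 ∷ []) ∷ []) ∷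
    block E₃ (
      (507 , 1 ∷ []) ∷ []) ∷
    block V₀ (
      (74 , 0 ∷ 0 ∷ 3 ∷ 1 ∷ 2 ∷ 0 ∷ 0 ∷ 2 ∷ 0 ∷ 2 ∷ 1 ∷ []) ∷
      (115 , 1 ∷ 1 ∷ 3 ∷ -1 ∷ 0 ∷ 0 ∷ 1 ∷ -2 ∷ 2 ∷ 0 ∷ 0 ∷ []) ∷
      (57 , 2 ∷ 3 ∷ 0 ∷ -1 ∷ -2 ∷ 0 ∷ 2 ∷ 1 ∷ -1 ∷ 0 ∷ 0 ∷ []) ∷
      (1539 , 1 ∷ 2 ∷ 1 ∷ 0 ∷ 0 ∷ 0 ∷ 1 ∷ 0 ∷ 0 ∷ 0 ∷ 0 ∷ []) ∷
      (14 , 0 ∷ 0 ∷ 0 ∷ 0 ∷ 0 ∷ 1 ∷ 0 ∷ 0 ∷ 0 ∷ 0 ∷ -1 ∷ []) ∷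
      (876 , 1 ∷ 3 ∷ 1 ∷ -1 ∷ 0 ∷ 1 ∷ 0 ∷ 0 ∷ 0 ∷ 0 ∷ -1 ∷ []) ∷
      (939 , 1 ∷ -1 ∷ -3 ∷ 0 ∷ 0 ∷ 0 ∷ -1 ∷ 0 ∷ 0 ∷ 0 ∷ 0 ∷ []) ∷
      (400 , 0 ∷ 0 ∷ 0 ∷ 0 ∷ 0 ∷ 0 ∷ 0 ∷ 1 ∷ 0 ∷ 0 ∷ 1 ∷ []) ∷
      (343 , 1 ∷ 1 ∷ 1 ∷ 0 ∷ 0 ∷ 0 ∷ 1 ∷ 0 ∷ 1 ∷ 0 ∷ 0 ∷ []) ∷
      (756 , 1 ∷ 3 ∷ 1 ∷ 0 ∷ 0 ∷ 1 ∷ 1 ∷ 0 ∷ 0 ∷ 1 ∷ 0 ∷ []) ∷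
      (137 , 0 ∷ 0 ∷ 0 ∷ 0 ∷ 0 ∷ 0 ∷ 0 ∷ 0 ∷ 0 ∷ 1 ∷ 1 ∷ []) ∷
      (1561 , 1 ∷ 2 ∷ 1 ∷ -1 ∷ 0 ∷ 1 ∷ 0 ∷ 0 ∷ 0 ∷ 0 ∷ 0 ∷ []) ∷
      (348 , 0 ∷ 2 ∷ -1 ∷ -1 ∷ -1 ∷ 0 ∷ 1 ∷ -1 ∷ 0 ∷ 0 ∷ -1 ∷ []) ∷
      (25 , 1 ∷ 0 ∷ 1 ∷ -2 ∷ -1 ∷ 0 ∷ -1 ∷ -2 ∷ 1 ∷ 1 ∷ 1 ∷ []) ∷
      (7031 , 2 ∷ 0 ∷ 1 ∷ 0 ∷ 1 ∷ 0 ∷ 0 ∷ 0 ∷ 0 ∷ 0 ∷ 0 ∷ []) ∷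
      (96 , 2 ∷ 2 ∷ 1 ∷ -1 ∷ 0 ∷ 1 ∷ 1 ∷ -1 ∷ -1 ∷ 0 ∷ -1 ∷ []) ∷ []) ∷
    block V₁ (
      (602 , 3 ∷ -1 ∷ 1 ∷ 0 ∷ []) ∷ (1647 , 2 ∷ -1 ∷ 1 ∷ 0 ∷ []) ∷ (13 , 0 ∷ 1 ∷ 1 ∷ 0 ∷ []) ∷
      (396 , 1 ∷ -1 ∷ 0 ∷ -1 ∷ []) ∷ []) ∷
    block M₀ (
      (32 , 2 ∷ -1 ∷ 0 ∷ 0 ∷ 1 ∷ []) ∷ (78 , 3 ∷ 0 ∷ 1 ∷ 0 ∷ 0 ∷ []) ∷ []) ∷
    block M₁ (
      (350 , 2 ∷ 1 ∷ 0 ∷ []) ∷ (203 , 3 ∷ 1 ∷ 1 ∷ []) ∷ []) ∷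
    block M₂ (
      (35 , 2 ∷ -1 ∷ -1 ∷ []) ∷ []) ∷
    block S₀ (
      (238 , 3 ∷ 2 ∷ 0 ∷ 1 ∷ 0 ∷ 1 ∷ -1 ∷ []) ∷ (198 , 1 ∷ 0 ∷ 0 ∷ 0 ∷ 0 ∷ 0 ∷ 0 ∷ []) ∷
      (118 , 3 ∷ 2 ∷ -1 ∷ 1 ∷ -1 ∷ 1 ∷ -1 ∷ []) ∷ (30 , 0 ∷ 0 ∷ 0 ∷ 0 ∷ 1 ∷ 1 ∷ 0 ∷ []) ∷
      (534 , 1 ∷ 2 ∷ -1 ∷ 0 ∷ 0 ∷ 0 ∷ 0 ∷ []) ∷ (131 , 0 ∷ 0 ∷ 0 ∷ 0 ∷ 0 ∷ 0 ∷ 1 ∷ []) ∷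
      (22 , 0 ∷ 2 ∷ 1 ∷ 1 ∷ -2 ∷ -2 ∷ 0 ∷ []) ∷ (323 , 2 ∷ 3 ∷ -1 ∷ 0 ∷ 0 ∷ 0 ∷ -1 ∷ []) ∷
      (238 , 1 ∷ 0 ∷ 0 ∷ 0 ∷ 0 ∷ 1 ∷ 0 ∷ []) ∷ (75 , 1 ∷ 1 ∷ 0 ∷ 1 ∷ -1 ∷ 0 ∷ 1 ∷ []) ∷
      (311 , 2 ∷ 1 ∷ -1 ∷ 0 ∷ 1 ∷ 0 ∷ 0 ∷ []) ∷ []) ∷
    block S₁ (
      (3014 , 1 ∷ -1 ∷ 0 ∷ 0 ∷ []) ∷ (42 , 0 ∷ 0 ∷ 0 ∷ 1 ∷ []) ∷ (342 , 3 ∷ -2 ∷ 1 ∷ -1 ∷ []) ∷ []) ∷ []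

  path₅Certified : Certified 5 ((0F , 1F) ∷ (1F , 2F) ∷ (2F , 3F) ∷ (3F , 4F) ∷ [])
  path₅Certified = record
    { eq = refl
    -- The square has 4 diagonal terms, which are two-edge paths, and 12 terms with two disjoint
    -- edges. The latter are all those in four times the integrand, and 8 of its 12 two-edge paths
    -- are left to pay for the four-edge path.
    ; edgeScale = 4 ; edgeBlocks = [] ∙ ((1 , features (1 ∷ 2 ∷ 4 ∷ 8 ∷ [])) ∷ []) ∷ [] ; edgeOk = refl
    ; coneScale = 27677 ; coneBlocks = path₅Cone ; coneOk = refl
    }

  forkCone : List Block
  forkCone =
    block Q₀ (
      (243 , 3 ∷ 1 ∷ 0 ∷ 0 ∷ []) ∷ (13 , 0 ∷ 0 ∷ 0 ∷ 1 ∷ []) ∷ (322 , 3 ∷ 1 ∷ 0 ∷ -1 ∷ []) ∷ []) ∷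
    block Q₁ (
      (11162 , 1 ∷ 0 ∷ 0 ∷ []) ∷ []) ∷
    block E₀ (
      (2181 , 2 ∷ 1 ∷ -1 ∷ 1 ∷ 0 ∷ 0 ∷ 0 ∷ 0 ∷ []) ∷ (262 , 2 ∷ 3 ∷ 0 ∷ 1 ∷ 1 ∷ 0 ∷ 1 ∷ 1 ∷ []) ∷
      (415 , 2 ∷ -3 ∷ -1 ∷ -1 ∷ 0 ∷ 0 ∷ 0 ∷ 0 ∷ []) ∷ (602 , 1 ∷ -2 ∷ 0 ∷ -1 ∷ 0 ∷ 0 ∷ 0 ∷ 0 ∷ []) ∷
      (545 , 3 ∷ 2 ∷ -1 ∷ 1 ∷ 1 ∷ 0 ∷ 0 ∷ -1 ∷ []) ∷ (3843 , 0 ∷ 1 ∷ 0 ∷ 1 ∷ 0 ∷ 0 ∷ 0 ∷ 0 ∷ []) ∷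
      (607 , 0 ∷ 0 ∷ 0 ∷ 0 ∷ 0 ∷ 1 ∷ 0 ∷ 0 ∷ []) ∷ []) ∷
    block E₁ (
      (612 , 3 ∷ 1 ∷ 0 ∷ []) ∷ (4582 , 1 ∷ 0 ∷ 0 ∷ []) ∷ (85 , 0 ∷ 1 ∷ 1 ∷ []) ∷ (996 , 0 ∷ 0 ∷ 1 ∷ []) ∷ []) ∷
    block E₂ (
      (284 , 2 ∷ 1 ∷ 1 ∷ []) ∷ (1011 , 3 ∷ 1 ∷ 0 ∷ []) ∷ []) ∷
    block E₃ (
      (1406 , 1 ∷ []) ∷ []) ∷
    block V₀ (
      (445 , 0 ∷ 0 ∷ 0 ∷ 0 ∷ 0 ∷ 0 ∷ 0 ∷ 1 ∷ 0 ∷ 0 ∷ -1 ∷ []) ∷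
      (512 , 1 ∷ 0 ∷ -3 ∷ 0 ∷ 1 ∷ 0 ∷ -1 ∷ 0 ∷ -1 ∷ 0 ∷ -1 ∷ []) ∷
      (59 , 1 ∷ 0 ∷ 0 ∷ -2 ∷ -2 ∷ 0 ∷ -1 ∷ 0 ∷ -1 ∷ 0 ∷ 0 ∷ []) ∷
      (557 , 2 ∷ 3 ∷ 1 ∷ -1 ∷ 1 ∷ 1 ∷ 1 ∷ 0 ∷ 0 ∷ 0 ∷ 0 ∷ []) ∷
      (10 , 1 ∷ 0 ∷ 0 ∷ -2 ∷ 0 ∷ -1 ∷ 0 ∷ -2 ∷ 0 ∷ -1 ∷ -2 ∷ []) ∷
      (496 , 3 ∷ -3 ∷ 1 ∷ 1 ∷ 2 ∷ -1 ∷ -1 ∷ 0 ∷ 0 ∷ 0 ∷ 1 ∷ []) ∷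
      (1949 , 2 ∷ 2 ∷ 1 ∷ 0 ∷ 1 ∷ 0 ∷ 1 ∷ 0 ∷ 0 ∷ 0 ∷ 0 ∷ []) ∷
      (232 , 0 ∷ 1 ∷ 2 ∷ 0 ∷ 0 ∷ 0 ∷ 1 ∷ -1 ∷ 1 ∷ 0 ∷ -1 ∷ []) ∷
      (154 , 1 ∷ 3 ∷ 2 ∷ 0 ∷ 1 ∷ 0 ∷ 1 ∷ 2 ∷ 0 ∷ 2 ∷ -1 ∷ []) ∷
      (141 , 1 ∷ 1 ∷ 1 ∷ -2 ∷ -1 ∷ -1 ∷ 0 ∷ -1 ∷ -1 ∷ -1 ∷ 1 ∷ []) ∷
      (64 , 1 ∷ -1 ∷ 2 ∷ 0 ∷ 1 ∷ -1 ∷ 0 ∷ 1 ∷ -1 ∷ 2 ∷ 2 ∷ []) ∷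
      (797 , 1 ∷ 2 ∷ 1 ∷ 0 ∷ 0 ∷ 1 ∷ 1 ∷ 0 ∷ 0 ∷ 0 ∷ 1 ∷ []) ∷
      (303 , 0 ∷ 0 ∷ 0 ∷ 0 ∷ 0 ∷ 0 ∷ 0 ∷ 0 ∷ 0 ∷ 1 ∷ 1 ∷ []) ∷ []) ∷
    block V₁ (
      (987 , 0 ∷ 1 ∷ 1 ∷ 0 ∷ []) ∷ (495 , 3 ∷ -1 ∷ 1 ∷ 0 ∷ []) ∷ (3102 , 2 ∷ -1 ∷ 1 ∷ 0 ∷ []) ∷ []) ∷
    block M₀ (
      (397 , 2 ∷ 0 ∷ 1 ∷ 0 ∷ 0 ∷ []) ∷ (36 , 3 ∷ -1 ∷ 0 ∷ 1 ∷ 1 ∷ []) ∷ []) ∷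
    block M₁ (
      (403 , 3 ∷ 1 ∷ 0 ∷ []) ∷ (268 , 0 ∷ 0 ∷ 1 ∷ []) ∷ []) ∷
    block M₂ (
      (72 , 3 ∷ -2 ∷ -1 ∷ []) ∷ []) ∷
    block M₃ (
      (424 , 1 ∷ []) ∷ []) ∷
    block S₀ (
      (343 , 2 ∷ 3 ∷ 0 ∷ 1 ∷ 0 ∷ -1 ∷ 0 ∷ []) ∷ (37 , 3 ∷ 3 ∷ -1 ∷ 1 ∷ 1 ∷ 0 ∷ -2 ∷ []) ∷
      (57 , 0 ∷ 0 ∷ 0 ∷ 0 ∷ 1 ∷ 1 ∷ 0 ∷ []) ∷ (435 , 2 ∷ 3 ∷ -1 ∷ 0 ∷ 0 ∷ 0 ∷ 0 ∷ []) ∷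
      (193 , 1 ∷ 2 ∷ 0 ∷ 1 ∷ -1 ∷ 0 ∷ 2 ∷ []) ∷ (102 , 0 ∷ 0 ∷ 0 ∷ 0 ∷ 0 ∷ 1 ∷ -1 ∷ []) ∷
      (143 , 1 ∷ 3 ∷ -1 ∷ 1 ∷ 0 ∷ 0 ∷ 0 ∷ []) ∷ []) ∷
    block S₁ (
      (594 , 2 ∷ -1 ∷ 1 ∷ 0 ∷ []) ∷ (1490 , 2 ∷ -1 ∷ 0 ∷ 0 ∷ []) ∷ (529 , 3 ∷ -1 ∷ 0 ∷ 0 ∷ []) ∷ []) ∷ []

  forkCertified : Certified 5 ((0F , 1F) ∷ (0F , 2F) ∷ (0F , 3F) ∷ (3F , 4F) ∷ [])
  forkCertified = record
    { eq = refl
    ; edgeScale = 1 ; edgeBlocks = [] ; edgeOk = refl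
    ; coneScale = 22768 ; coneBlocks = forkCone ; coneOk = refl
    }

  bannerCone : List Block
  bannerCone =
    block Q₀ (
      (582 , 0 ∷ 0 ∷ 1 ∷ 1 ∷ []) ∷ (1638 , 3 ∷ 1 ∷ 0 ∷ 0 ∷ []) ∷ []) ∷
    block Q₁ (
      (284 , 0 ∷ 1 ∷ 3 ∷ []) ∷ (11533 , 1 ∷ 0 ∷ 0 ∷ []) ∷ []) ∷
    block E₀ (
      (2378 , 2 ∷ 2 ∷ 0 ∷ 1 ∷ 1 ∷ 0 ∷ 0 ∷ 0 ∷ []) ∷ (29 , 0 ∷ 1 ∷ 1 ∷ 0 ∷ 0 ∷ 1 ∷ -1 ∷ -1 ∷ []) ∷
      (1067 , 1 ∷ 0 ∷ -1 ∷ 0 ∷ 0 ∷ 0 ∷ 0 ∷ 0 ∷ []) ∷ (3738 , 0 ∷ 1 ∷ 0 ∷ 0 ∷ 0 ∷ 0 ∷ -1 ∷ 0 ∷ []) ∷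
      (5905 , 0 ∷ 1 ∷ 0 ∷ 0 ∷ 0 ∷ 0 ∷ 0 ∷ 0 ∷ []) ∷ (3653 , 0 ∷ 0 ∷ 0 ∷ 0 ∷ 0 ∷ 1 ∷ 0 ∷ 1 ∷ []) ∷
      (1141 , 2 ∷ 3 ∷ -1 ∷ 1 ∷ 1 ∷ 0 ∷ 0 ∷ 0 ∷ []) ∷ (251 , 3 ∷ 2 ∷ -1 ∷ 0 ∷ 1 ∷ 0 ∷ 0 ∷ 0 ∷ []) ∷
      (133 , 0 ∷ 0 ∷ 0 ∷ 0 ∷ 0 ∷ 0 ∷ 0 ∷ 1 ∷ []) ∷ (3448 , 1 ∷ 0 ∷ -1 ∷ 0 ∷ 0 ∷ -1 ∷ 0 ∷ 0 ∷ []) ∷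
      (220 , 1 ∷ -1 ∷ 0 ∷ 0 ∷ 0 ∷ 1 ∷ 0 ∷ 0 ∷ []) ∷ []) ∷
    block E₁ (
      (311 , 1 ∷ 1 ∷ 0 ∷ []) ∷ (547 , 1 ∷ 1 ∷ 2 ∷ []) ∷ (631 , 2 ∷ 1 ∷ 0 ∷ []) ∷ []) ∷
    block E₂ (
      (707 , 2 ∷ 1 ∷ 1 ∷ []) ∷ (121 , 0 ∷ 0 ∷ 1 ∷ []) ∷ (485 , 2 ∷ 1 ∷ 2 ∷ []) ∷ (12 , 1 ∷ -2 ∷ -3 ∷ []) ∷ []) ∷
    block E₃ (
      (1401 , 1 ∷ []) ∷ []) ∷
    block V₀ (
      (169 , 1 ∷ 3 ∷ 1 ∷ -2 ∷ -3 ∷ 1 ∷ 1 ∷ -1 ∷ -3 ∷ 1 ∷ -1 ∷ []) ∷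
      (2098 , 0 ∷ 0 ∷ 0 ∷ 0 ∷ 0 ∷ 0 ∷ 0 ∷ 1 ∷ 0 ∷ 0 ∷ 1 ∷ []) ∷
      (422 , 3 ∷ -1 ∷ 3 ∷ -1 ∷ 3 ∷ -1 ∷ -1 ∷ -2 ∷ -1 ∷ 0 ∷ 1 ∷ []) ∷
      (4043 , 0 ∷ 1 ∷ 1 ∷ 0 ∷ -1 ∷ 0 ∷ 1 ∷ 0 ∷ 0 ∷ 0 ∷ 0 ∷ []) ∷
      (1079 , 2 ∷ 0 ∷ 1 ∷ -1 ∷ 2 ∷ 0 ∷ -1 ∷ -1 ∷ -1 ∷ 1 ∷ 1 ∷ []) ∷
      (3309 , 0 ∷ 0 ∷ 0 ∷ 0 ∷ 0 ∷ 0 ∷ 0 ∷ 1 ∷ -1 ∷ 0 ∷ 0 ∷ []) ∷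
      (5510 , 0 ∷ 0 ∷ 0 ∷ 0 ∷ 0 ∷ 0 ∷ 0 ∷ 0 ∷ 0 ∷ 1 ∷ 0 ∷ []) ∷
      (84 , 0 ∷ 0 ∷ 0 ∷ 0 ∷ 1 ∷ 0 ∷ 0 ∷ 0 ∷ 0 ∷ 0 ∷ -1 ∷ []) ∷
      (3689 , 0 ∷ 3 ∷ 1 ∷ -1 ∷ 0 ∷ 1 ∷ 1 ∷ 0 ∷ 0 ∷ 0 ∷ 0 ∷ []) ∷
      (2254 , 0 ∷ 0 ∷ 1 ∷ 0 ∷ 0 ∷ 0 ∷ 0 ∷ 0 ∷ 0 ∷ 0 ∷ 1 ∷ []) ∷
      (531 , 1 ∷ 0 ∷ 1 ∷ 1 ∷ 1 ∷ 0 ∷ 1 ∷ 3 ∷ 2 ∷ 2 ∷ 1 ∷ []) ∷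
      (131 , 1 ∷ 3 ∷ 3 ∷ -1 ∷ -3 ∷ 0 ∷ 2 ∷ -1 ∷ 1 ∷ 0 ∷ -1 ∷ []) ∷
      (2866 , 0 ∷ 0 ∷ 1 ∷ 0 ∷ 0 ∷ 0 ∷ 0 ∷ 1 ∷ 0 ∷ 0 ∷ 0 ∷ []) ∷
      (3661 , 0 ∷ 1 ∷ 0 ∷ 0 ∷ 0 ∷ 1 ∷ 0 ∷ 0 ∷ 0 ∷ 0 ∷ 0 ∷ []) ∷
      (3885 , 0 ∷ 2 ∷ 0 ∷ 0 ∷ 0 ∷ 0 ∷ 1 ∷ 0 ∷ 0 ∷ 0 ∷ 0 ∷ []) ∷ []) ∷
    block V₁ (
      (3098 , 3 ∷ -2 ∷ 1 ∷ 0 ∷ []) ∷ (4743 , 0 ∷ 1 ∷ 0 ∷ 1 ∷ []) ∷ []) ∷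
    block M₀ (
      (9 , 2 ∷ 2 ∷ 2 ∷ 0 ∷ -3 ∷ []) ∷ (394 , 3 ∷ -1 ∷ 1 ∷ -1 ∷ 0 ∷ []) ∷ []) ∷
    block M₁ (
      (304 , 1 ∷ 1 ∷ 0 ∷ []) ∷ (319 , 3 ∷ 1 ∷ 0 ∷ []) ∷ []) ∷
    block M₂ (
      (250 , 0 ∷ 1 ∷ 1 ∷ []) ∷ (164 , 2 ∷ -2 ∷ -1 ∷ []) ∷ (111 , 3 ∷ -1 ∷ 0 ∷ []) ∷ []) ∷
    block S₀ (
      (6556 , 1 ∷ 0 ∷ 0 ∷ 0 ∷ 0 ∷ 0 ∷ 0 ∷ []) ∷ (447 , 1 ∷ -1 ∷ 0 ∷ 0 ∷ 0 ∷ 0 ∷ 0 ∷ []) ∷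
      (182 , 0 ∷ 0 ∷ 0 ∷ 1 ∷ 0 ∷ 0 ∷ -1 ∷ []) ∷ (363 , 2 ∷ 3 ∷ -1 ∷ 1 ∷ -1 ∷ 1 ∷ 0 ∷ []) ∷
      (2222 , 0 ∷ 0 ∷ 0 ∷ 0 ∷ 0 ∷ 1 ∷ 0 ∷ []) ∷ (88 , 0 ∷ 0 ∷ 1 ∷ 1 ∷ 1 ∷ -3 ∷ -2 ∷ []) ∷
      (282 , 3 ∷ 2 ∷ -1 ∷ 0 ∷ 0 ∷ 3 ∷ -2 ∷ []) ∷ (650 , 0 ∷ 0 ∷ 0 ∷ 0 ∷ 0 ∷ 1 ∷ 1 ∷ []) ∷
      (2622 , 1 ∷ 2 ∷ 0 ∷ 1 ∷ 0 ∷ 0 ∷ 0 ∷ []) ∷ (839 , 1 ∷ 0 ∷ 0 ∷ 0 ∷ 0 ∷ 0 ∷ 1 ∷ []) ∷ []) ∷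
    block S₁ (
      (2227 , 3 ∷ -2 ∷ 0 ∷ -1 ∷ []) ∷ (7239 , 1 ∷ -1 ∷ 0 ∷ 0 ∷ []) ∷ (286 , 1 ∷ -1 ∷ 1 ∷ -2 ∷ []) ∷ []) ∷ []

  bannerCertified : Certified 5 ((0F , 1F) ∷ (1F , 2F) ∷ (2F , 3F) ∷ (0F , 3F) ∷ (0F , 4F) ∷ [])
  bannerCertified = record
    { eq = refl
    -- Together the blocks give 4 two-edge paths, 4 pairs of disjoint edges, 2 four-edge paths and 2
    -- forks. Of the even part only 2 two-edge paths and the 4-cycle remain, which are themselves
    -- squares.
    ; edgeScale = 1 ; edgeBlocks = [] ∙ ((1 , features (1 ∷ 2 ∷ [])) ∷ []) ∷
      ((true , (0F , 2F) ∷ (1F , 2F) ∷ []) ∷ []) ∙ ((1 , features (1 ∷ 2 ∷ [])) ∷ []) ∷ [] ; edgeOk = refl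
    ; coneScale = 35327 ; coneBlocks = bannerCone ; coneOk = refl
    }

  bicliqueCone : List Block
  bicliqueCone =
    block Q₀ (
      (2794 , 2 ∷ 1 ∷ 0 ∷ 0 ∷ []) ∷ (195 , 2 ∷ 1 ∷ 1 ∷ 2 ∷ []) ∷ (440 , 3 ∷ 1 ∷ 0 ∷ 0 ∷ []) ∷
      (656 , 2 ∷ 1 ∷ 2 ∷ 0 ∷ []) ∷ (1051 , 3 ∷ 1 ∷ 0 ∷ 1 ∷ []) ∷ []) ∷
    block Q₁ (
      (1889 , 0 ∷ 1 ∷ 3 ∷ []) ∷ (1979 , 0 ∷ 0 ∷ 1 ∷ []) ∷ (16964 , 1 ∷ 0 ∷ 0 ∷ []) ∷ []) ∷
    block E₀ (
      (5813 , 2 ∷ 2 ∷ 0 ∷ 1 ∷ 1 ∷ 0 ∷ 0 ∷ 0 ∷ []) ∷ (918 , 1 ∷ 1 ∷ 2 ∷ 0 ∷ 1 ∷ 2 ∷ -1 ∷ 0 ∷ []) ∷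
      (1515 , 0 ∷ 0 ∷ 0 ∷ 0 ∷ 0 ∷ 1 ∷ 0 ∷ 1 ∷ []) ∷ (5359 , 0 ∷ 0 ∷ 1 ∷ 0 ∷ 0 ∷ 1 ∷ 0 ∷ 0 ∷ []) ∷
      (635 , 0 ∷ 1 ∷ 0 ∷ 1 ∷ 0 ∷ 0 ∷ 0 ∷ 0 ∷ []) ∷ (141 , 2 ∷ -2 ∷ -2 ∷ 0 ∷ 0 ∷ -1 ∷ 2 ∷ 0 ∷ []) ∷
      (114 , 2 ∷ 3 ∷ 0 ∷ 1 ∷ 1 ∷ 1 ∷ -3 ∷ 1 ∷ []) ∷ (1295 , 0 ∷ 0 ∷ 0 ∷ 0 ∷ 0 ∷ 0 ∷ 1 ∷ 1 ∷ []) ∷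
      (1805 , 3 ∷ 2 ∷ 0 ∷ 1 ∷ 1 ∷ 0 ∷ 0 ∷ 1 ∷ []) ∷ (631 , 1 ∷ -2 ∷ 1 ∷ 0 ∷ 0 ∷ 3 ∷ 1 ∷ 1 ∷ []) ∷ []) ∷
    block E₁ (
      (1051 , 2 ∷ 1 ∷ 3 ∷ []) ∷ (1708 , 0 ∷ 0 ∷ 1 ∷ []) ∷ []) ∷
    block E₂ (
      (237 , 1 ∷ 0 ∷ 0 ∷ []) ∷ (129 , 2 ∷ 1 ∷ 2 ∷ []) ∷ (774 , 3 ∷ 2 ∷ 3 ∷ []) ∷ (6234 , 2 ∷ 1 ∷ 1 ∷ []) ∷ []) ∷
    block E₃ (
      (1297 , 1 ∷ []) ∷ []) ∷
    block V₀ (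
      (223 , 2 ∷ 1 ∷ 0 ∷ -1 ∷ 1 ∷ 0 ∷ 0 ∷ -1 ∷ 0 ∷ 1 ∷ 1 ∷ []) ∷
      (2191 , 2 ∷ 1 ∷ 1 ∷ 0 ∷ 3 ∷ 0 ∷ 0 ∷ 2 ∷ -1 ∷ 2 ∷ 1 ∷ []) ∷
      (488 , 2 ∷ 3 ∷ 1 ∷ -2 ∷ 1 ∷ 1 ∷ 0 ∷ -1 ∷ -3 ∷ 2 ∷ 1 ∷ []) ∷
      (772 , 1 ∷ 0 ∷ 0 ∷ -1 ∷ 1 ∷ 0 ∷ -1 ∷ -3 ∷ -1 ∷ 0 ∷ 0 ∷ []) ∷
      (288 , 2 ∷ 2 ∷ 1 ∷ -1 ∷ -2 ∷ 1 ∷ 1 ∷ -3 ∷ 0 ∷ 0 ∷ 0 ∷ []) ∷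
      (2116 , 0 ∷ 0 ∷ 0 ∷ 0 ∷ 0 ∷ 0 ∷ 0 ∷ 1 ∷ 1 ∷ 0 ∷ 1 ∷ []) ∷
      (5517 , 1 ∷ -3 ∷ -1 ∷ 1 ∷ 1 ∷ -1 ∷ -1 ∷ 1 ∷ 1 ∷ 0 ∷ 0 ∷ []) ∷
      (1101 , 0 ∷ 2 ∷ 0 ∷ 0 ∷ 0 ∷ 0 ∷ 1 ∷ 1 ∷ -1 ∷ 0 ∷ -1 ∷ []) ∷
      (8087 , 0 ∷ 0 ∷ 0 ∷ 0 ∷ 0 ∷ 0 ∷ 0 ∷ 1 ∷ 0 ∷ 0 ∷ 1 ∷ []) ∷
      (715 , 0 ∷ 0 ∷ 2 ∷ 0 ∷ 1 ∷ 0 ∷ 0 ∷ 1 ∷ 0 ∷ 0 ∷ 1 ∷ []) ∷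
      (2315 , 1 ∷ 1 ∷ 1 ∷ 0 ∷ -1 ∷ 1 ∷ 1 ∷ -2 ∷ 0 ∷ 1 ∷ 0 ∷ []) ∷
      (1165 , 1 ∷ 2 ∷ 1 ∷ -1 ∷ 0 ∷ 0 ∷ 1 ∷ 0 ∷ 0 ∷ -1 ∷ 0 ∷ []) ∷
      (433 , 1 ∷ 2 ∷ 1 ∷ -1 ∷ 1 ∷ 1 ∷ 0 ∷ 0 ∷ -2 ∷ 1 ∷ 0 ∷ []) ∷
      (327 , 1 ∷ 0 ∷ -1 ∷ 0 ∷ 0 ∷ 0 ∷ 0 ∷ -2 ∷ -1 ∷ -1 ∷ -1 ∷ []) ∷
      (2577 , 2 ∷ 0 ∷ 0 ∷ 0 ∷ 3 ∷ 0 ∷ -1 ∷ -1 ∷ 0 ∷ 0 ∷ 0 ∷ []) ∷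
      (2153 , 0 ∷ 3 ∷ 1 ∷ -1 ∷ 0 ∷ 0 ∷ 1 ∷ 2 ∷ -1 ∷ -1 ∷ -1 ∷ []) ∷ []) ∷
    block V₁ (
      (335 , 2 ∷ -2 ∷ 1 ∷ 1 ∷ []) ∷ (2743 , 3 ∷ -3 ∷ 1 ∷ -1 ∷ []) ∷ (2072 , 0 ∷ 1 ∷ 1 ∷ 2 ∷ []) ∷
      (2669 , 1 ∷ -1 ∷ 0 ∷ 0 ∷ []) ∷ []) ∷
    block M₁ (
      (383 , 3 ∷ 1 ∷ 1 ∷ []) ∷ []) ∷
    block M₂ (
      (241 , 3 ∷ -1 ∷ -1 ∷ []) ∷ (2070 , 1 ∷ 0 ∷ 0 ∷ []) ∷ []) ∷
    block S₀ (
      (836 , 0 ∷ 0 ∷ 1 ∷ 1 ∷ -2 ∷ -2 ∷ 0 ∷ []) ∷ (610 , 1 ∷ -2 ∷ 0 ∷ -1 ∷ 2 ∷ -1 ∷ -1 ∷ []) ∷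
      (4 , 0 ∷ 0 ∷ 0 ∷ 1 ∷ 0 ∷ 0 ∷ -1 ∷ []) ∷ (193 , 3 ∷ 1 ∷ 1 ∷ 3 ∷ -2 ∷ 1 ∷ -3 ∷ []) ∷
      (666 , 0 ∷ 0 ∷ 0 ∷ 0 ∷ 0 ∷ 1 ∷ 0 ∷ []) ∷ (3705 , 3 ∷ 1 ∷ -1 ∷ 0 ∷ 0 ∷ 1 ∷ 0 ∷ []) ∷
      (690 , 1 ∷ -2 ∷ 0 ∷ -1 ∷ 0 ∷ 0 ∷ 1 ∷ []) ∷ (1602 , 3 ∷ 2 ∷ -1 ∷ 1 ∷ -1 ∷ 2 ∷ 0 ∷ []) ∷
      (128 , 0 ∷ 2 ∷ -1 ∷ 0 ∷ 0 ∷ 0 ∷ 1 ∷ []) ∷ (823 , 1 ∷ 0 ∷ -1 ∷ -1 ∷ 1 ∷ 0 ∷ -2 ∷ []) ∷ []) ∷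
    block S₁ (
      (2499 , 2 ∷ -2 ∷ 0 ∷ -1 ∷ []) ∷ (1333 , 3 ∷ -2 ∷ 1 ∷ -3 ∷ []) ∷ (547 , 0 ∷ 2 ∷ 1 ∷ -2 ∷ []) ∷
      (187 , 0 ∷ 0 ∷ 1 ∷ -3 ∷ []) ∷ (5402 , 1 ∷ -1 ∷ 0 ∷ 0 ∷ []) ∷ []) ∷ []

  bicliqueCertified : Certified 5 ((0F , 2F) ∷ (0F , 3F) ∷ (0F , 4F) ∷ (1F , 2F) ∷ (1F , 3F) ∷ (1F , 4F) ∷ [])
  bicliqueCertified = record
    { eq = refl
    -- The square of f(t₀,y) f(t₁,y) gives a 4-cycle and, with the weight, the full K(2,3). The
    -- other one, taken three times, removes all disjoint pairs, four-edge paths and forks; 3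
    -- two-edge paths and 2 four-cycles remain.
    ; edgeScale = 1 ; edgeBlocks = ((true , (0F , 2F) ∷ (1F , 2F) ∷ []) ∷ []) ∙ ((1 , features (3 ∷ [])) ∷ (3 , features (1 ∷ 2 ∷ [])) ∷ []) ∷ [] ; edgeOk = refl
    ; coneScale = 47345 ; coneBlocks = bicliqueCone ; coneOk = refl
    }

  representatives₁ : Representatives 1
  representatives₁ = (-, vertexCertified) ∷ []

  exhaustive₁ : exhaustiveᵇ 1 representatives₁ ≡ true
  exhaustive₁ = refl

  representatives₂ : Representatives 2
  representatives₂ = (-, edgeCertified) ∷ []

  exhaustive₂ : exhaustiveᵇ 2 representatives₂ ≡ true
  exhaustive₂ = refl

  representatives₃ : Representatives 3
  representatives₃ = (-, cherryCertified) ∷ []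

  exhaustive₃ : exhaustiveᵇ 3 representatives₃ ≡ true
  exhaustive₃ = refl

  representatives₄ : Representatives 4
  representatives₄ = (-, clawCertified) ∷ (-, path₄Certified) ∷ (-, cycle₄Certified) ∷ []

  exhaustive₄ : exhaustiveᵇ 4 representatives₄ ≡ true
  exhaustive₄ = refl

  representatives₅ : Representatives 5
  representatives₅ = (-, star₄Certified) ∷ (-, path₅Certified) ∷ (-, forkCertified) ∷ (-, bannerCertified) ∷ (-, bicliqueCertified) ∷ []

  exhaustive₅ : exhaustiveᵇ 5 representatives₅ ≡ true
  exhaustive₅ = refl

common-cone : ∀ {H : Graph n} → 1 ℕ.≤ n → Represented H → ∀ a → Common ((H ⁺) (suc a))
common-cone {n} {H} 1≤n rep a = common-hom F (proj₂ positive) λ N (c , c-sym) → bound N c c-sym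
  where
  open Represented rep
  F = (H ⁺) (suc a)
  K = relabel ks L
  size≤ : length K ℕ.+ n ℕ.* suc a ℕ.≤ edgeCount F
  size≤ = ℕP.≤-trans (ℕP.+-monoˡ-≤ (n ℕ.* suc a)
    (subst (ℕ._≤ edgeCount H) (≡.sym (ListP.length-map _ L)) few)) (edgeCount-cone (suc a) H)
  -- There is at least one cone edge, so the truncated subtraction in the exponent of `Common` is a
  -- true predecessor.
  positive : ∃ λ e → edgeCount F ≡ suc e
  positive with edgeCount F | ℕP.≤-trans (ℕP.*-mono-≤ 1≤n (ℕ.s≤s {n = a} ℕ.z≤n))
                                (ℕP.≤-trans (ℕP.m≤n+m (n ℕ.* suc a) (length K)) size≤)
  ... | suc e | _ = e , refl
  e = proj₁ positive
  bound : ∀ N c → (∀ x y → c x y ≡ c y x) → + 2 * (+ suc N) ^ (n ℕ.+ suc a)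
    ≤ (+ 2) ^ suc e * (homCount F (suc N) c true + homCount F (suc N) c false)
  bound N c c-sym = begin
    + 2 * (+ suc N) ^ (n ℕ.+ suc a)
      ≤⟨ multiconeBound certificate c c-sym a ⟩
    S L true + S L false
      ≡⟨ cong₂ _+_ (∑-relabel (monoSign c true) ks L (suc a)) (∑-relabel (monoSign c false) ks L (suc a)) ⟨
    S K true + S K false
      ≤⟨ ℤP.+-mono-≤ (multicone≤homCount c c-sym true (suc a) H covers) (multicone≤homCount c c-sym false (suc a) H covers) ⟩
    T′ * h true + T′ * h false
      ≡⟨ ℤP.*-distribˡ-+ T′ (h true) (h false) ⟨
    T′ * (h true + h false)
      ≤⟨ ℤP.*-monoʳ-≤-nonNeg (h true + h false) {{nonNegative (0≤+ (0≤h true) (0≤h false))}} T′≤ ⟩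
    (+ 2) ^ suc e * (h true + h false) ∎
    where
    open ℤP.≤-Reasoning
    S : List (Fin n × Fin n) → Bool → ℤ
    S M b = ∑ⱽ λ z → edgeWeight (monoSign c b) M z * codegree (monoSign c b) z ^ suc a
    h : Bool → ℤ
    h b = homCount F (suc N) c b
    T′ = (+ 2) ^ (length K ℕ.+ n ℕ.* suc a)
    0≤h : ∀ b → 0ℤ ≤ h b
    0≤h b = 0≤∑ⱽ λ φ → 0≤indicator (monoᵇ F c b φ)
    T′≤ : T′ ≤ (+ 2) ^ suc e
    T′≤ = subst₂ _≤_ (pos-^ 2 (length K ℕ.+ n ℕ.* suc a)) (pos-^ 2 (suc e))
      (+≤+ (ℕP.^-monoʳ-≤ 2 (ℕP.≤-trans size≤ (ℕP.≤-reflexive (proj₂ positive)))))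

theorem1p4 : ∀ (n : ℕ) (H : Graph n) → n ℕ.≤ 5 → Connected H → Bipartite H →
    ∀ (a : ℕ) → 1 ℕ.≤ a → Common ((H ⁺) a)
theorem1p4 n H n≤5 con bip (suc a) _ = common-cone (proj₁ con) (classify n H n≤5 con bip) a
  where
  open Certificates
  classify : ∀ n (H : Graph n) → n ℕ.≤ 5 → Connected H → Bipartite H → Represented H
  classify 0 H _ (() , _) bip
  classify 1 H _ = represented representatives₁ exhaustive₁ H
  classify 2 H _ = represented representatives₂ exhaustive₂ H
  classify 3 H _ = represented representatives₃ exhaustive₃ H
  classify 4 H _ = represented representatives₄ exhaustive₄ H
  classify 5 H _ = represented representatives₅ exhaustive₅ H
  classify (suc (suc (suc (suc (suc (suc _)))))) H (ℕ.s≤s (ℕ.s≤s (ℕ.s≤s (ℕ.s≤s (ℕ.s≤s ())))))
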